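{- Let $n\geq1$, $r=2^n$ and $M=22^{2^n}+1$. Let $\pi=1+\zeta_{11}^7+\zeta_{11}^8\in\mathbb{Z}[\zeta_{22}]$ and $\alpha=(\pi/\bar\pi)^{\tau}$, where $\tau=1+3\sigma_{ -7}+5\sigma_9+7\sigma_{ -3}+9\sigma_5$. For $k\ge0$ and $1\leq j\leq5$ define $S_k^{(j)}=f^{(j)}(\alpha_1^{(k)},\ldots,\alpha_5^{(k)})$, where $f^{(j)}$ is the $j$-th elementary symmetric polynomial in $5$ variables, $\alpha_1^{(k)}=\alpha^{22^k}+\bar\alpha^{22^k}$, and $\alpha_i^{(k)}=\sigma_{2i-1}(\alpha_1^{(k)})$ for $2\leq i\leq5$. Suppose that every integer $x$ with $1<x<11^r$ and $x^{10}\equiv1\pmod{11^r}$ does not divide $M$. Then $M$ is prime if and only if $$S_{r-1}^{(1)}\equiv-1,\quad S_{r-1}^{(2)}\equiv-4,\quad S_{r-1}^{(3)}\equiv3,\quad S_{r-1}^{(4)}\equiv3,\quad S_{r-1}^{(5)}\equiv-1\pmod M.$$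
   Context: $\zeta_m=e^{2\pi\sqrt{ -1}/m}$ and a bar denotes complex conjugation. For $c$ coprime to $22$, $\sigma_c\in G=\mathrm{Gal}(\mathbb{Q}(\zeta_{22})/\mathbb{Q})$ sends $\zeta_{22}$ to $\zeta_{22}^c$; $1$ denotes $\sigma_1$ in $\mathbb{Z}[G]$. For $\tau=\sum_{\sigma\in G}k_\sigma\sigma\in\mathbb{Z}[G]$ and $\beta\neq0$, $\beta^\tau:=\prod_{\sigma}\sigma(\beta)^{k_\sigma}$. The $S_k^{(j)}$ are rational numbers with denominators prime to $M$; congruences modulo $M$ are understood in the ring of rationals with denominator prime to $M$. -}

module Defs where

open import Data.Nat.Base as ℕ using (ℕ; zero; suc)
open import Data.Nat.Coprimality using (Coprime; coprime?)
open import Data.Integer.Base as ℤ using (ℤ; +_; -[1+_]; ∣_∣; _%ℕ_)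
open import Data.Rational.Base as ℚ using (ℚ; 0ℚ; 1ℚ; ↧ₙ_)
import Data.Rational.Properties as ℚ
open import Data.List.Base as List using (List; []; _∷_)
open import Data.Vec.Base as Vec using (Vec; []; _∷_)
open import Data.Product.Base using (_×_; _,_; ∃-syntax)
open import Relation.Nullary.Decidable.Core using (True; yes; no)
open import Relation.Binary.PropositionalEquality.Core using (_≡_)

infix  9 _⁻¹
infixr 8 _^_ _^ᶻ_ _^ᴳ_
infixl 7 _*_ _÷_
infixr 7 _•_
infixl 6 _+_
infix  4 _≡ℚ_[mod_] _≡ᴷ_[mod_]

-- The field ℚ(ζ₂₂) is ℚ[x]/(Φ₂₂) with ζ₂₂ the class of x: the vector
-- (a₀ , … , a₉) stands for a₀ + a₁ ζ₂₂ + … + a₉ ζ₂₂⁹.  Since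
-- Φ₂₂ = 1 - x + x² - … - x⁹ + x¹⁰ is irreducible of degree 10, this
-- representation is unique, so equality in the field is _≡_.
K : Set
K = Vec ℚ 10

_+_ : K → K → K
_+_ = Vec.zipWith ℚ._+_

_•_ : ℚ → K → K
q • x = Vec.map (q ℚ.*_) x

ι : ℚ → K
ι q = q ∷ Vec.replicate 9 0ℚ

0K 1K : K
0K = ι 0ℚ
1K = ι 1ℚ

-- ζ₂₂¹⁰ = - 1 + ζ₂₂ - ζ₂₂² + … + ζ₂₂⁹
ζ¹⁰ : K
ζ¹⁰ = m ∷ p ∷ m ∷ p ∷ m ∷ p ∷ m ∷ p ∷ m ∷ p ∷ []
  where
  p m : ℚ
  p = 1ℚ
  m = ℚ.- 1ℚ

-- multiplication by ζ₂₂
ζ·_ : K → K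
ζ· x = (0ℚ ∷ Vec.init x) + Vec.last x • ζ¹⁰

_*_ : K → K → K
x * y = horner x
  where
  horner : ∀ {m} → Vec ℚ m → K
  horner []       = 0K
  horner (a ∷ as) = a • y + ζ· horner as

_^_ : K → ℕ → K
x ^ zero  = 1K
x ^ suc n = x * x ^ n

sum product : List K → K
sum     = List.foldr _+_ 0K
product = List.foldr _*_ 1K

ζ₂₂ ζ₁₁ : K
ζ₂₂ = ζ· 1K
ζ₁₁ = ζ₂₂ ^ 2

-- f(y) for the polynomial f with the given coefficients, constant term first
evalAt : ∀ {m} → K → Vec ℚ m → K
evalAt y []       = 0K
evalAt y (a ∷ as) = ι a + y * evalAt y as

-- σ c is the automorphism with ζ₂₂ ↦ ζ₂₂ᶜ; c and c + 22 name the same one.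
record Gal : Set where
  constructor σ
  field
    exponent  : ℤ
    {coprime} : True (coprime? ∣ exponent ∣ 22)

_⟨_⟩ : Gal → K → K
σ c ⟨ x ⟩ = evalAt (ζ₂₂ ^ (c %ℕ 22)) x

-- Complex conjugation, which sends the root of unity ζ₂₂ to ζ₂₂⁻¹.
bar : K → K
bar x = σ (ℤ.- + 1) ⟨ x ⟩

-- Gal(ℚ(ζ₂₂)/ℚ) without the identity
nontrivial : List Gal
nontrivial = σ (+ 3) ∷ σ (+ 5) ∷ σ (+ 7) ∷ σ (+ 9) ∷ σ (+ 13) ∷ σ (+ 15) ∷ σ (+ 17) ∷ σ (+ 19) ∷ σ (+ 21) ∷ []

-- The product of the conjugates σ(x) over σ ≠ 1, so x * cofactor x is the norm.
cofactor : K → K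
cofactor x = product (List.map (_⟨ x ⟩) nontrivial)

-- The norm is rational, hence equal to its constant coefficient.
norm : K → ℚ
norm x = Vec.head (x * cofactor x)

-- The reciprocal with the convention 1/0 = 0.
recip : ℚ → ℚ
recip q with q ℚ.≟ 0ℚ
... | yes _   = 0ℚ
... | no q≢0 = ℚ.1/_ q {{ℚ.≢-nonZero q≢0}}

-- Only 0K has norm 0, so this is the inverse, with the convention 0K ⁻¹ = 0K.
_⁻¹ : K → K
x ⁻¹ = recip (norm x) • cofactor x

_÷_ : K → K → K
x ÷ y = x * y ⁻¹

_^ᶻ_ : K → ℤ → K
x ^ᶻ (+ n)    = x ^ n
x ^ᶻ -[1+ n ] = (x ⁻¹) ^ suc n

-- Elements Σ k σ of the group ring ℤ[G], as formal sums.
ℤ[G] : Set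
ℤ[G] = List (ℤ × Gal)

_^ᴳ_ : K → ℤ[G] → K
x ^ᴳ τ = product (List.map (λ (k , s) → s ⟨ x ⟩ ^ᶻ k) τ)

-- All ways of picking j entries, at distinct positions, from a list.
choose : ∀ {A : Set} → ℕ → List A → List (List A)
choose zero    xs       = [] ∷ []
choose (suc j) []       = []
choose (suc j) (x ∷ xs) = List.map (x ∷_) (choose j xs) List.++ choose (suc j) xs

elemSym : ℕ → List K → K
elemSym j xs = sum (List.map product (choose j xs))

π : K
π = 1K + ζ₁₁ ^ 7 + ζ₁₁ ^ 8

τ : ℤ[G]
τ = (+ 1 , σ (+ 1)) ∷ (+ 3 , σ (ℤ.- + 7)) ∷ (+ 5 , σ (+ 9)) ∷ (+ 7 , σ (ℤ.- + 3)) ∷ (+ 9 , σ (+ 5)) ∷ []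

α : K
α = (π ÷ bar π) ^ᴳ τ

α₁ : ℕ → K
α₁ k = α ^ (22 ℕ.^ k) + bar α ^ (22 ℕ.^ k)

αs : ℕ → List K
αs k = α₁ k ∷ List.map (_⟨ α₁ k ⟩) (σ (+ 3) ∷ σ (+ 5) ∷ σ (+ 7) ∷ σ (+ 9) ∷ [])

S : ℕ → ℕ → K
S k j = elemSym j (αs k)

-- Congruence to an integer in the ring of rationals with denominator prime
-- to M: the difference is M times an element of that ring.  As c is an
-- integer, q then lies in that ring as well.
_≡ℚ_[mod_] : ℚ → ℤ → ℕ → Set
q ≡ℚ c [mod M ] = ∃[ z ] Coprime (↧ₙ z) M × q ℚ.- c ℚ./ 1 ≡ (+ M) ℚ./ 1 ℚ.* z

-- The same for an element of K, which is in particular required to be rational.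
_≡ᴷ_[mod_] : K → ℤ → ℕ → Set
x ≡ᴷ c [mod M ] = ∃[ q ] x ≡ ι q × q ≡ℚ c [mod M ]

{-# OPTIONS --safe #-}
-- α is 23¹¹/J² up to a root of unity, where J = G¹¹ lies in ℤ[ζ₁₁] and G is the Gauss sum of a
-- character χ of order 11 modulo 23.  If M is prime then Gᴹ = χ̄(M) G modulo M by Frobenius, and
-- M ≡ 2 mod 23; likewise 23 is a square modulo M by the quadratic Gauss sum.
-- Hence α^(22^(r-1)) = χ(2) is a primitive 11th root of unity modulo M, and the conjugates of
-- ζ₁₁ + ζ₁₁⁻¹ have the prescribed symmetric functions.  Conversely, modulo a prime divisor q of M
-- these values make β = α^(22^(r-1)) a root of Φ₁₁, while α^(q¹⁰ - 1) = 1, so 11ʳ divides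
-- q¹⁰ - 1.  The least prime divisor of a composite M is below 11ʳ, contradicting the hypothesis.
module Submission where

open import Algebra.Bundles using (CommutativeRing; CommutativeSemiring)
open import Algebra.Core using (Op₁; Op₂)
open import Algebra.Structures using (IsCommutativeRing)
open import Data.Bool.Base using (true)
open import Data.Fin.Base as Fin using (Fin; inject₁; toℕ; fromℕ)
open import Data.Fin.Patterns using (0F; 1F; 2F; 3F; 4F)
import Data.Fin.Properties as Fin
import Data.Integer.Divisibility.Signed as Signed
import Data.Integer.Properties as ℤ
open import Data.List.Base as List using (List; []; _∷_)
import Data.List.Properties as List
open import Data.List.Relation.Binary.Permutation.Propositional as Perm using (_↭_)
open import Data.List.Relation.Binary.Pointwise using (Pointwise; []; _∷_)
open import Data.List.Relation.Unary.All as ListAll using ([]; _∷_)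
import Data.List.Relation.Unary.All.Properties as ListAll
open import Data.Nat.Base as ℕ using (ℕ; zero; suc)
open import Data.Nat.Combinatorics using (_C_; nCn≡1; nCk≡nC[n∸k]; nCk≡n!/k![n-k]!; k![n∸k]!∣n!)
import Data.Nat.Coprimality as ℕ
open import Data.Nat.Divisibility as ℕ using (divides)
open import Data.Nat.DivMod as ℕ using (_/_; _%_; m/n*n≡m)
import Data.Nat.GCD as ℕ
open ℕ.Bézout using (+-; -+)
open import Data.Nat.ListAction using () renaming (product to productℕ)
open import Data.Nat.Primality as ℕ using (Prime)
import Data.Nat.Primality.Factorisation as ℕ
import Data.Nat.Properties as ℕ
open import Data.Product.Base using (_,_; proj₁; proj₂; ∃-syntax)
open import Data.Rational.Base as ℚ using (ℚ; mkℚ; 0ℚ; 1ℚ; ↥_; ↧_; ↧ₙ_)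
import Data.Rational.Properties as ℚ
open import Data.Rational.Unnormalised.Base as ℚᵘ using (mkℚᵘ; *≡*)
import Data.Rational.Unnormalised.Properties as ℚᵘ
open import Data.Sum.Base using (_⊎_; inj₁; inj₂)
open import Data.Vec.Base as Vec using (Vec; []; _∷_; zipWith; init; last; replicate)
import Data.Vec.Properties as Vec
open import Data.Vec.Relation.Unary.All as All using (All; []; _∷_)
open import Level using (0ℓ)
open import Relation.Binary.Definitions using (DecidableEquality)
open import Relation.Binary.PropositionalEquality as ≡ using (_≡_)
open import Relation.Nullary.Decidable using (Dec; yes; no; does; _because_; _⊎-dec_)
open import Relation.Nullary.Negation using (contradiction)
open import Relation.Nullary.Negation.Core using (¬_)
open import Relation.Nullary.Reflects using (ofʸ)

-- Adjoining a root of a monic polynomial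

-- Each coefficient c of `τ` stands before the automorphism whose exponent is inverse to c modulo
-- 22. So (1 - σ₋₁)τ differs from the Stickelberger element Σ c σ_c⁻¹ by 22 times an element of
-- ℤ[G]. As `π` has norm 23, this is where the Gauss sum modulo 23 comes from. The link enters as
-- two closed identities, `α≡fracᶻ` and `b≡ζ¹²J̄²`, decided on coordinates. Gauss sums are taken in
-- a group ring of the cyclic group of order 23. That ring has zero divisors, so G cannot simply be
-- cancelled; comparing coefficients of the generator, where G has coefficient 1, does the same job.
-- As α is not integral, the work is done on b = 23¹¹ α in ℤ[ζ₂₂], which multiplies each symmetric
-- function by a power of 23. For necessity that power is 1 modulo M; for sufficiency 23 is inverted
-- modulo q. The shape of r matters twice: r ≥ 2 makes 22^(r-1) even and divisible by 11, which
-- removes the sign of -23 and the root of unity ζ₂₂¹², and r even makes 22^r ≡ 1 modulo 23.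

pow : {A : Set} → Op₂ A → A → A → ℕ → A
pow _*_ 1# x zero    = 1#
pow _*_ 1# x (suc n) = x * pow _*_ 1# x n

-- The ring A[x]/(xⁿ⁺¹ - c(x)), with operations written as on `K`. It serves for ℤ[ζ₂₂], and again
-- over ℤ and over ℤ[ζ₂₂] for the group rings that hold the Gauss sums.
module Adjoin
  {A : Set} {_+_ _*_ : Op₂ A} { -_ : Op₁ A} {0# 1# : A}
  (isCommRing : IsCommutativeRing _≡_ _+_ _*_ -_ 0# 1#)
  {n : ℕ} (c : Vec A (suc n))
  where

  private
    module A = IsCommutativeRing isCommRing
    open ≡ using (refl; cong; cong₂)

  infix  9 ζ·_
  infixl 7 _⊗_
  infixr 7 _•_
  infixl 6 _⊕_

  V : Set
  V = Vec A (suc n)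

  _⊕_ : V → V → V
  _⊕_ = zipWith _+_

  ⊖_ : V → V
  ⊖_ = Vec.map -_

  _•_ : A → V → V
  a • x = Vec.map (a *_) x

  ι : A → V
  ι a = a ∷ replicate n 0#

  0V 1V : V
  0V = ι 0#
  1V = ι 1#

  ζ·_ : V → V
  ζ· x = (0# ∷ init x) ⊕ last x • c

  horner : ∀ {m} → Vec A m → V → V
  horner []       y = 0V
  horner (a ∷ as) y = a • y ⊕ ζ· horner as y

  _⊗_ : V → V → V
  x ⊗ y = horner x y

  open ≡.≡-Reasoning

  private
    ⊕-assoc : ∀ x y z → (x ⊕ y) ⊕ z ≡ x ⊕ (y ⊕ z)
    ⊕-assoc = Vec.zipWith-assoc A.+-assoc

    ⊕-comm : ∀ x y → x ⊕ y ≡ y ⊕ x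
    ⊕-comm = Vec.zipWith-comm A.+-comm

    ⊕-identityˡ : ∀ x → 0V ⊕ x ≡ x
    ⊕-identityˡ = Vec.zipWith-identityˡ A.+-identityˡ

    ⊕-identityʳ : ∀ x → x ⊕ 0V ≡ x
    ⊕-identityʳ = Vec.zipWith-identityʳ A.+-identityʳ

    ⊕-interchange : ∀ w x y z → (w ⊕ x) ⊕ (y ⊕ z) ≡ (w ⊕ y) ⊕ (x ⊕ z)
    ⊕-interchange w x y z = begin
      (w ⊕ x) ⊕ (y ⊕ z)  ≡⟨ ⊕-assoc w x (y ⊕ z) ⟩
      w ⊕ (x ⊕ (y ⊕ z))  ≡⟨ cong (w ⊕_) (⊕-assoc x y z) ⟨
      w ⊕ ((x ⊕ y) ⊕ z)  ≡⟨ cong (λ v → w ⊕ (v ⊕ z)) (⊕-comm x y) ⟩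
      w ⊕ ((y ⊕ x) ⊕ z)  ≡⟨ cong (w ⊕_) (⊕-assoc y x z) ⟩
      w ⊕ (y ⊕ (x ⊕ z))  ≡⟨ ⊕-assoc w y (x ⊕ z) ⟨
      (w ⊕ y) ⊕ (x ⊕ z)  ∎

    map-distribˡ : ∀ {m} a (x y : Vec A m) →
      Vec.map (a *_) (zipWith _+_ x y) ≡ zipWith _+_ (Vec.map (a *_) x) (Vec.map (a *_) y)
    map-distribˡ a []      []      = refl
    map-distribˡ a (x ∷ xs) (y ∷ ys) = cong₂ _∷_ (A.distribˡ a x y) (map-distribˡ a xs ys)

    map-distribʳ : ∀ {m} a b (x : Vec A m) →
      Vec.map ((a + b) *_) x ≡ zipWith _+_ (Vec.map (a *_) x) (Vec.map (b *_) x)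
    map-distribʳ a b []       = refl
    map-distribʳ a b (x ∷ xs) = cong₂ _∷_ (A.distribʳ x a b) (map-distribʳ a b xs)

    map-assoc : ∀ {m} a b (x : Vec A m) →
      Vec.map ((a * b) *_) x ≡ Vec.map (a *_) (Vec.map (b *_) x)
    map-assoc a b []       = refl
    map-assoc a b (x ∷ xs) = cong₂ _∷_ (A.*-assoc a b x) (map-assoc a b xs)

    map-zeroˡ : ∀ {m} (x : Vec A m) → Vec.map (0# *_) x ≡ replicate m 0#
    map-zeroˡ []       = refl
    map-zeroˡ (x ∷ xs) = cong₂ _∷_ (A.zeroˡ x) (map-zeroˡ xs)

    map-zeroʳ : ∀ a m → Vec.map (a *_) (replicate m 0#) ≡ replicate m 0#
    map-zeroʳ a zero    = refl
    map-zeroʳ a (suc m) = cong₂ _∷_ (A.zeroʳ a) (map-zeroʳ a m)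

    init-zipWith : ∀ {m} (x y : Vec A (suc m)) →
      init (zipWith _+_ x y) ≡ zipWith _+_ (init x) (init y)
    init-zipWith (x ∷ [])      (y ∷ [])      = refl
    init-zipWith (x ∷ xs@(_ ∷ _)) (y ∷ ys@(_ ∷ _)) = cong (_ ∷_) (init-zipWith xs ys)

    last-zipWith : ∀ {m} (x y : Vec A (suc m)) →
      last (zipWith _+_ x y) ≡ last x + last y
    last-zipWith (x ∷ [])      (y ∷ [])      = refl
    last-zipWith (x ∷ xs@(_ ∷ _)) (y ∷ ys@(_ ∷ _)) = last-zipWith xs ys

    init-map : ∀ {m} a (x : Vec A (suc m)) →
      init (Vec.map (a *_) x) ≡ Vec.map (a *_) (init x)
    init-map a (x ∷ [])      = refl
    init-map a (x ∷ xs@(_ ∷ _)) = cong (_ ∷_) (init-map a xs)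

    last-map : ∀ {m} a (x : Vec A (suc m)) → last (Vec.map (a *_) x) ≡ a * last x
    last-map a (x ∷ [])      = refl
    last-map a (x ∷ xs@(_ ∷ _)) = last-map a xs

    init-replicate : ∀ m → init (replicate (suc m) 0#) ≡ replicate m 0#
    init-replicate zero    = refl
    init-replicate (suc m) = cong (0# ∷_) (init-replicate m)

    last-replicate : ∀ m → last (replicate (suc m) 0#) ≡ 0#
    last-replicate zero    = refl
    last-replicate (suc m) = last-replicate m

  •-distribˡ : ∀ a x y → a • (x ⊕ y) ≡ a • x ⊕ a • y
  •-distribˡ = map-distribˡ

  •-distribʳ : ∀ a b x → (a + b) • x ≡ a • x ⊕ b • x
  •-distribʳ = map-distribʳ

  •-assoc : ∀ a b x → (a * b) • x ≡ a • (b • x)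
  •-assoc = map-assoc

  •-comm : ∀ a b x → a • (b • x) ≡ b • (a • x)
  •-comm a b x = begin
    a • (b • x)  ≡⟨ •-assoc a b x ⟨
    (a * b) • x  ≡⟨ cong (_• x) (A.*-comm a b) ⟩
    (b * a) • x  ≡⟨ •-assoc b a x ⟩
    b • (a • x)  ∎

  •-identity : ∀ x → 1# • x ≡ x
  •-identity x = ≡.trans (Vec.map-cong A.*-identityˡ x) (Vec.map-id x)

  •-zeroˡ : ∀ x → 0# • x ≡ 0V
  •-zeroˡ = map-zeroˡ

  •-zeroʳ : ∀ a → a • 0V ≡ 0V
  •-zeroʳ a = map-zeroʳ a (suc n)

  ζ·-homo-⊕ : ∀ x y → ζ· (x ⊕ y) ≡ ζ· x ⊕ ζ· y
  ζ·-homo-⊕ x y = begin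
    (0# ∷ init (x ⊕ y)) ⊕ last (x ⊕ y) • c
      ≡⟨ cong₂ _⊕_ (cong₂ _∷_ (≡.sym (A.+-identityˡ 0#)) (init-zipWith x y))
                   (≡.trans (cong (_• c) (last-zipWith x y)) (•-distribʳ (last x) (last y) c)) ⟩
    ((0# ∷ init x) ⊕ (0# ∷ init y)) ⊕ (last x • c ⊕ last y • c)
      ≡⟨ ⊕-interchange (0# ∷ init x) (0# ∷ init y) (last x • c) (last y • c) ⟩
    ζ· x ⊕ ζ· y ∎

  ζ·-homo-• : ∀ a x → ζ· (a • x) ≡ a • ζ· x
  ζ·-homo-• a x = begin
    (0# ∷ init (a • x)) ⊕ last (a • x) • c
      ≡⟨ cong₂ _⊕_ (cong₂ _∷_ (≡.sym (A.zeroʳ a)) (init-map a x))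
                   (≡.trans (cong (_• c) (last-map a x)) (•-assoc a (last x) c)) ⟩
    a • (0# ∷ init x) ⊕ a • (last x • c)
      ≡⟨ •-distribˡ a (0# ∷ init x) (last x • c) ⟨
    a • ζ· x ∎

  ζ·-zero : ζ· 0V ≡ 0V
  ζ·-zero = begin
    ζ· 0V         ≡⟨ cong ζ·_ (•-zeroˡ 0V) ⟨
    ζ· (0# • 0V)  ≡⟨ ζ·-homo-• 0# 0V ⟩
    0# • ζ· 0V    ≡⟨ •-zeroˡ (ζ· 0V) ⟩
    0V            ∎

  horner-⊕ʳ : ∀ {m} (v : Vec A m) x y → horner v (x ⊕ y) ≡ horner v x ⊕ horner v y
  horner-⊕ʳ []       x y = ≡.sym (⊕-identityˡ 0V)
  horner-⊕ʳ (a ∷ as) x y = begin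
    a • (x ⊕ y) ⊕ ζ· horner as (x ⊕ y)
      ≡⟨ cong₂ _⊕_ (•-distribˡ a x y) (≡.trans (cong ζ·_ (horner-⊕ʳ as x y)) (ζ·-homo-⊕ _ _)) ⟩
    (a • x ⊕ a • y) ⊕ (ζ· horner as x ⊕ ζ· horner as y)
      ≡⟨ ⊕-interchange (a • x) (a • y) _ _ ⟩
    horner (a ∷ as) x ⊕ horner (a ∷ as) y ∎

  horner-•ʳ : ∀ {m} (v : Vec A m) b x → horner v (b • x) ≡ b • horner v x
  horner-•ʳ []       b x = ≡.sym (•-zeroʳ b)
  horner-•ʳ (a ∷ as) b x = begin
    a • (b • x) ⊕ ζ· horner as (b • x)
      ≡⟨ cong₂ _⊕_ (•-comm a b x) (≡.trans (cong ζ·_ (horner-•ʳ as b x)) (ζ·-homo-• b _)) ⟩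
    b • (a • x) ⊕ b • ζ· horner as x
      ≡⟨ •-distribˡ b _ _ ⟨
    b • horner (a ∷ as) x ∎

  horner-ζ·ʳ : ∀ {m} (v : Vec A m) x → horner v (ζ· x) ≡ ζ· horner v x
  horner-ζ·ʳ []       x = ≡.sym ζ·-zero
  horner-ζ·ʳ (a ∷ as) x = begin
    a • ζ· x ⊕ ζ· horner as (ζ· x)
      ≡⟨ cong₂ _⊕_ (≡.sym (ζ·-homo-• a x)) (cong ζ·_ (horner-ζ·ʳ as x)) ⟩
    ζ· (a • x) ⊕ ζ· (ζ· horner as x)
      ≡⟨ ζ·-homo-⊕ _ _ ⟨
    ζ· horner (a ∷ as) x ∎

  horner-zeroʳ : ∀ {m} (v : Vec A m) → horner v 0V ≡ 0V
  horner-zeroʳ v = begin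
    horner v 0V         ≡⟨ cong (horner v) (•-zeroˡ 0V) ⟨
    horner v (0# • 0V)  ≡⟨ horner-•ʳ v 0# 0V ⟩
    0# • horner v 0V    ≡⟨ •-zeroˡ _ ⟩
    0V                  ∎

  -- Both sides apply polynomials in the linear operator `ζ·_`, and such polynomials commute.
  -- Applied to `1V` this yields commutativity, then associativity, of `_⊗_` without expanding a
  -- product.
  horner-swap : ∀ {m k} (v : Vec A m) (w : Vec A k) x →
    horner v (horner w x) ≡ horner w (horner v x)
  horner-swap []       w x = ≡.sym (horner-zeroʳ w)
  horner-swap (a ∷ as) w x = begin
    a • horner w x ⊕ ζ· horner as (horner w x)
      ≡⟨ cong₂ _⊕_ (≡.sym (horner-•ʳ w a x))
                   (≡.trans (cong ζ·_ (horner-swap as w x)) (≡.sym (horner-ζ·ʳ w _))) ⟩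
    horner w (a • x) ⊕ horner w (ζ· horner as x)
      ≡⟨ horner-⊕ʳ w _ _ ⟨
    horner w (horner (a ∷ as) x) ∎

  private
    pad : ∀ {m} k → Vec A m → Vec A k
    pad zero    _        = []
    pad (suc k) []       = 0# ∷ pad k []
    pad (suc k) (a ∷ as) = a ∷ pad k as

    pad-[] : ∀ k → pad k [] ≡ replicate k 0#
    pad-[] zero    = refl
    pad-[] (suc k) = cong (0# ∷_) (pad-[] k)

    pad-id : ∀ {m} (v : Vec A m) → pad m v ≡ v
    pad-id []       = refl
    pad-id (a ∷ as) = cong (a ∷_) (pad-id as)

    init-pad : ∀ {m} k (v : Vec A m) → init (pad (suc k) v) ≡ pad k v
    init-pad zero    []       = refl
    init-pad zero    (a ∷ as) = refl
    init-pad (suc k) []       = cong (0# ∷_) (init-pad k [])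
    init-pad (suc k) (a ∷ as) = cong (a ∷_) (init-pad k as)

    last-pad : ∀ {m k} (v : Vec A m) → m ℕ.≤ k → last (pad (suc k) v) ≡ 0#
    last-pad {k = zero}  []       _ = refl
    last-pad {k = suc k} []       _ = last-pad {k = k} [] ℕ.z≤n
    last-pad {k = suc k} (a ∷ as) (ℕ.s≤s m≤k) = last-pad as m≤k

    -- With at most n + 1 coefficients, `ζ·_` only meets vectors whose last entry is 0, so no
    -- reduction by `c` takes place.
    horner-1V : ∀ {m} (v : Vec A m) → m ℕ.≤ suc n → horner v 1V ≡ pad (suc n) v
    horner-1V []       _ = ≡.sym (pad-[] (suc n))
    horner-1V (a ∷ as) (ℕ.s≤s m≤n) = begin
      a • 1V ⊕ ζ· horner as 1V
        ≡⟨ cong₂ _⊕_ (cong₂ _∷_ (A.*-identityʳ a) (map-zeroʳ a n))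
                     (cong ζ·_ (horner-1V as (ℕ.m≤n⇒m≤1+n m≤n))) ⟩
      ι a ⊕ ζ· pad (suc n) as
        ≡⟨ cong (ι a ⊕_) (cong₂ _⊕_ (cong (0# ∷_) (init-pad n as))
             (≡.trans (cong (_• c) (last-pad as m≤n)) (•-zeroˡ c))) ⟩
      ι a ⊕ ((0# ∷ pad n as) ⊕ 0V)
        ≡⟨ cong (ι a ⊕_) (⊕-identityʳ _) ⟩
      ι a ⊕ (0# ∷ pad n as)
        ≡⟨ cong₂ _∷_ (A.+-identityʳ a) (Vec.zipWith-identityˡ A.+-identityˡ (pad n as)) ⟩
      a ∷ pad n as ∎

  ⊗-identityʳ : ∀ x → x ⊗ 1V ≡ x
  ⊗-identityʳ x = ≡.trans (horner-1V x ℕ.≤-refl) (pad-id x)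

  ⊗-comm : ∀ x y → x ⊗ y ≡ y ⊗ x
  ⊗-comm x y = begin
    x ⊗ y         ≡⟨ cong (x ⊗_) (⊗-identityʳ y) ⟨
    x ⊗ (y ⊗ 1V)  ≡⟨ horner-swap x y 1V ⟩
    y ⊗ (x ⊗ 1V)  ≡⟨ cong (y ⊗_) (⊗-identityʳ x) ⟩
    y ⊗ x         ∎

  ⊗-assoc : ∀ x y z → (x ⊗ y) ⊗ z ≡ x ⊗ (y ⊗ z)
  ⊗-assoc x y z = begin
    (x ⊗ y) ⊗ z  ≡⟨ ⊗-comm (x ⊗ y) z ⟩
    z ⊗ (x ⊗ y)  ≡⟨ horner-swap z x y ⟩
    x ⊗ (z ⊗ y)  ≡⟨ cong (x ⊗_) (⊗-comm z y) ⟩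
    x ⊗ (y ⊗ z)  ∎

  isCommutativeRing : IsCommutativeRing _≡_ _⊕_ _⊗_ ⊖_ 0V 1V
  isCommutativeRing = record
    { isRing = record
      { +-isAbelianGroup = record
        { isGroup = record
          { isMonoid = record
            { isSemigroup = record
              { isMagma = record { isEquivalence = ≡.isEquivalence ; ∙-cong = cong₂ _⊕_ }
              ; assoc   = ⊕-assoc
              }
            ; identity = ⊕-identityˡ , ⊕-identityʳ
            }
          ; inverse = Vec.zipWith-inverseˡ A.-‿inverseˡ , Vec.zipWith-inverseʳ A.-‿inverseʳ
          ; ⁻¹-cong = cong ⊖_
          }
        ; comm = ⊕-comm
        }
      ; *-cong     = cong₂ _⊗_
      ; *-assoc    = ⊗-assoc
      ; *-identity = (λ x → ≡.trans (⊗-comm 1V x) (⊗-identityʳ x)) , ⊗-identityʳ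
      ; distrib    = horner-⊕ʳ , λ x y z → begin
          (y ⊕ z) ⊗ x    ≡⟨ ⊗-comm (y ⊕ z) x ⟩
          x ⊗ (y ⊕ z)    ≡⟨ horner-⊕ʳ x y z ⟩
          x ⊗ y ⊕ x ⊗ z  ≡⟨ cong₂ _⊕_ (⊗-comm x y) (⊗-comm x z) ⟩
          y ⊗ x ⊕ z ⊗ x  ∎
      }
    ; *-comm = ⊗-comm
    }

  commutativeRing : CommutativeRing 0ℓ 0ℓ
  commutativeRing = record { isCommutativeRing = isCommutativeRing }

  private
    module V = IsCommutativeRing isCommutativeRing

  infixr 8 _^_
  _^_ : V → ℕ → V
  _^_ = pow _⊗_ 1V

  ι-homo-+ : ∀ a b → ι (a + b) ≡ ι a ⊕ ι b
  ι-homo-+ a b = cong (a + b ∷_) (≡.sym (Vec.zipWith-identityˡ A.+-identityˡ _))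

  •-1V : ∀ a → a • 1V ≡ ι a
  •-1V a = cong₂ _∷_ (A.*-identityʳ a) (map-zeroʳ a n)

  •-⊗ˡ : ∀ a x y → (a • x) ⊗ y ≡ a • (x ⊗ y)
  •-⊗ˡ a x y = begin
    (a • x) ⊗ y  ≡⟨ ⊗-comm (a • x) y ⟩
    y ⊗ (a • x)  ≡⟨ horner-•ʳ y a x ⟩
    a • (y ⊗ x)  ≡⟨ cong (a •_) (⊗-comm y x) ⟩
    a • (x ⊗ y)  ∎

  •-⊗ʳ : ∀ a x y → x ⊗ (a • y) ≡ a • (x ⊗ y)
  •-⊗ʳ a x y = horner-•ʳ x a y

  ι-⊗ : ∀ a x → ι a ⊗ x ≡ a • x
  ι-⊗ a x = begin
    ι a ⊗ x         ≡⟨ cong (_⊗ x) (•-1V a) ⟨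
    (a • 1V) ⊗ x    ≡⟨ •-⊗ˡ a 1V x ⟩
    a • (1V ⊗ x)    ≡⟨ cong (a •_) (V.*-identityˡ x) ⟩
    a • x           ∎

  ι-homo-* : ∀ a b → ι (a * b) ≡ ι a ⊗ ι b
  ι-homo-* a b = begin
    ι (a * b)       ≡⟨ •-1V (a * b) ⟨
    (a * b) • 1V    ≡⟨ •-assoc a b 1V ⟩
    a • (b • 1V)    ≡⟨ cong (a •_) (•-1V b) ⟩
    a • ι b         ≡⟨ ι-⊗ a (ι b) ⟨
    ι a ⊗ ι b       ∎

  ζ·-⊗ˡ : ∀ x y → ζ· x ⊗ y ≡ ζ· (x ⊗ y)
  ζ·-⊗ˡ x y = begin
    ζ· x ⊗ y    ≡⟨ ⊗-comm (ζ· x) y ⟩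
    y ⊗ ζ· x    ≡⟨ horner-ζ·ʳ y x ⟩
    ζ· (y ⊗ x)  ≡⟨ cong ζ·_ (⊗-comm y x) ⟩
    ζ· (x ⊗ y)  ∎

  gen : V
  gen = ζ· 1V

  gen-⊗ : ∀ x → gen ⊗ x ≡ ζ· x
  gen-⊗ x = ≡.trans (ζ·-⊗ˡ 1V x) (cong ζ·_ (V.*-identityˡ x))

  evalAt : ∀ {m} → V → Vec A m → V
  evalAt w []       = 0V
  evalAt w (a ∷ as) = ι a ⊕ w ⊗ evalAt w as

  evalAt-gen : ∀ x → evalAt gen x ≡ x
  evalAt-gen x = ≡.trans (evalAt-horner x) (⊗-identityʳ x)
    where
    evalAt-horner : ∀ {m} (v : Vec A m) → evalAt gen v ≡ horner v 1V
    evalAt-horner []       = refl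
    evalAt-horner (a ∷ as) = cong₂ _⊕_ (≡.sym (•-1V a))
      (≡.trans (gen-⊗ _) (cong ζ·_ (evalAt-horner as)))

  shift : ℕ → V → V
  shift zero    x = x
  shift (suc t) x = ζ· shift t x

  gen^-⊗ : ∀ t x → gen ^ t ⊗ x ≡ shift t x
  gen^-⊗ zero    x = V.*-identityˡ x
  gen^-⊗ (suc t) x = begin
    (gen ⊗ gen ^ t) ⊗ x  ≡⟨ ⊗-assoc gen (gen ^ t) x ⟩
    gen ⊗ (gen ^ t ⊗ x)  ≡⟨ cong (gen ⊗_) (gen^-⊗ t x) ⟩
    gen ⊗ shift t x      ≡⟨ gen-⊗ (shift t x) ⟩
    ζ· shift t x         ∎

  shiftEval : ∀ {m} → ℕ → Vec A m → V
  shiftEval t []       = 0V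
  shiftEval t (a ∷ as) = ι a ⊕ shift t (shiftEval t as)

  -- Evaluation at a power of `gen` needs shifts only, no products; this keeps the closed
  -- computations with Gauss sums cheap.
  evalAt-gen^ : ∀ {m} t (v : Vec A m) → evalAt (gen ^ t) v ≡ shiftEval t v
  evalAt-gen^ t []       = refl
  evalAt-gen^ t (a ∷ as) = cong (ι a ⊕_)
    (≡.trans (gen^-⊗ t _) (cong (shift t) (evalAt-gen^ t as)))

  evalAt-⊕ : ∀ {m} w (x y : Vec A m) → evalAt w (zipWith _+_ x y) ≡ evalAt w x ⊕ evalAt w y
  evalAt-⊕ w []       []       = ≡.sym (⊕-identityˡ 0V)
  evalAt-⊕ w (x ∷ xs) (y ∷ ys) = begin
    ι (x + y) ⊕ w ⊗ evalAt w (zipWith _+_ xs ys)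
      ≡⟨ cong₂ _⊕_ (ι-homo-+ x y)
           (≡.trans (cong (w ⊗_) (evalAt-⊕ w xs ys)) (V.distribˡ w _ _)) ⟩
    (ι x ⊕ ι y) ⊕ (w ⊗ evalAt w xs ⊕ w ⊗ evalAt w ys)
      ≡⟨ ⊕-interchange _ _ _ _ ⟩
    evalAt w (x ∷ xs) ⊕ evalAt w (y ∷ ys) ∎

  evalAt-• : ∀ {m} w a (x : Vec A m) → evalAt w (Vec.map (a *_) x) ≡ a • evalAt w x
  evalAt-• w a []       = ≡.sym (•-zeroʳ a)
  evalAt-• w a (x ∷ xs) = begin
    ι (a * x) ⊕ w ⊗ evalAt w (Vec.map (a *_) xs)
      ≡⟨ cong₂ _⊕_ (≡.trans (ι-homo-* a x) (ι-⊗ a (ι x)))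
           (≡.trans (cong (w ⊗_) (evalAt-• w a xs)) (•-⊗ʳ a w _)) ⟩
    a • ι x ⊕ a • (w ⊗ evalAt w xs)
      ≡⟨ •-distribˡ a _ _ ⟨
    a • evalAt w (x ∷ xs) ∎

  evalAt-0s : ∀ w m → evalAt w (replicate m 0#) ≡ 0V
  evalAt-0s w zero    = refl
  evalAt-0s w (suc m) =
    ≡.trans (⊕-identityˡ _) (≡.trans (cong (w ⊗_) (evalAt-0s w m)) (horner-zeroʳ w))

  evalAt-ι : ∀ w a → evalAt w (ι a) ≡ ι a
  evalAt-ι w a = begin
    ι a ⊕ w ⊗ evalAt w (replicate n 0#)  ≡⟨ cong (λ z → ι a ⊕ w ⊗ z) (evalAt-0s w n) ⟩
    ι a ⊕ w ⊗ 0V                         ≡⟨ cong (ι a ⊕_) (horner-zeroʳ w) ⟩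
    ι a ⊕ 0V                             ≡⟨ ⊕-identityʳ (ι a) ⟩
    ι a                                  ∎

  -- `ζ·_` splits off the last coefficient and returns it times `c`. If `w` is a root of xⁿ⁺¹ -
  -- c(x), this splitting turns that reduction into multiplication by `w`, so that x ↦ w is an
  -- endomorphism.
  evalAt-init-last : ∀ {m} w (x : Vec A (suc m)) →
    evalAt w (init x) ⊕ last x • w ^ m ≡ evalAt w x
  evalAt-init-last w (x ∷ [])         = begin
    0V ⊕ x • 1V    ≡⟨ ⊕-comm 0V (x • 1V) ⟩
    x • 1V ⊕ 0V    ≡⟨ cong₂ _⊕_ (•-1V x) (≡.sym (horner-zeroʳ w)) ⟩
    ι x ⊕ w ⊗ 0V   ∎
  evalAt-init-last {suc m} w (x ∷ xs@(_ ∷ _)) = begin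
    (ι x ⊕ w ⊗ evalAt w (init xs)) ⊕ last xs • (w ⊗ w ^ m)
      ≡⟨ ⊕-assoc _ _ _ ⟩
    ι x ⊕ (w ⊗ evalAt w (init xs) ⊕ last xs • (w ⊗ w ^ m))
      ≡⟨ cong (λ z → ι x ⊕ (w ⊗ evalAt w (init xs) ⊕ z)) (•-⊗ʳ (last xs) w (w ^ m)) ⟨
    ι x ⊕ (w ⊗ evalAt w (init xs) ⊕ w ⊗ (last xs • w ^ m))
      ≡⟨ cong (ι x ⊕_) (V.distribˡ w _ _) ⟨
    ι x ⊕ w ⊗ (evalAt w (init xs) ⊕ last xs • w ^ m)
      ≡⟨ cong (λ z → ι x ⊕ w ⊗ z) (evalAt-init-last w xs) ⟩
    ι x ⊕ w ⊗ evalAt w xs ∎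

  module Endo (w : V) (root : evalAt w c ≡ w ^ suc n) where

    evalAt-ζ· : ∀ x → evalAt w (ζ· x) ≡ w ⊗ evalAt w x
    evalAt-ζ· x = begin
      evalAt w ((0# ∷ init x) ⊕ last x • c)
        ≡⟨ evalAt-⊕ w (0# ∷ init x) (last x • c) ⟩
      (0V ⊕ w ⊗ evalAt w (init x)) ⊕ evalAt w (last x • c)
        ≡⟨ cong₂ _⊕_ (⊕-identityˡ _) (evalAt-• w (last x) c) ⟩
      w ⊗ evalAt w (init x) ⊕ last x • evalAt w c
        ≡⟨ cong (λ z → w ⊗ evalAt w (init x) ⊕ last x • z) root ⟩
      w ⊗ evalAt w (init x) ⊕ last x • (w ⊗ w ^ n)
        ≡⟨ cong (w ⊗ evalAt w (init x) ⊕_) (•-⊗ʳ (last x) w (w ^ n)) ⟨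
      w ⊗ evalAt w (init x) ⊕ w ⊗ (last x • w ^ n)
        ≡⟨ V.distribˡ w _ _ ⟨
      w ⊗ (evalAt w (init x) ⊕ last x • w ^ n)
        ≡⟨ cong (w ⊗_) (evalAt-init-last w x) ⟩
      w ⊗ evalAt w x ∎

    evalAt-⊗ : ∀ x y → evalAt w (x ⊗ y) ≡ evalAt w x ⊗ evalAt w y
    evalAt-⊗ x y = evalAt-horner x
      where
      evalAt-horner : ∀ {m} (v : Vec A m) → evalAt w (horner v y) ≡ evalAt w v ⊗ evalAt w y
      evalAt-horner []       = ≡.trans (evalAt-ι w 0#) (≡.sym (V.zeroˡ (evalAt w y)))
      evalAt-horner (a ∷ as) = begin
        evalAt w (a • y ⊕ ζ· horner as y)
          ≡⟨ evalAt-⊕ w (a • y) (ζ· horner as y) ⟩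
        evalAt w (a • y) ⊕ evalAt w (ζ· horner as y)
          ≡⟨ cong₂ _⊕_ (≡.trans (evalAt-• w a y) (≡.sym (ι-⊗ a _)))
               (≡.trans (evalAt-ζ· _) (cong (w ⊗_) (evalAt-horner as))) ⟩
        ι a ⊗ evalAt w y ⊕ w ⊗ (evalAt w as ⊗ evalAt w y)
          ≡⟨ cong (ι a ⊗ evalAt w y ⊕_) (⊗-assoc w _ _) ⟨
        ι a ⊗ evalAt w y ⊕ (w ⊗ evalAt w as) ⊗ evalAt w y
          ≡⟨ V.distribʳ (evalAt w y) (ι a) (w ⊗ evalAt w as) ⟨
        (ι a ⊕ w ⊗ evalAt w as) ⊗ evalAt w y ∎

    evalAt-evalAt : ∀ {m} u (v : Vec A m) → evalAt w (evalAt u v) ≡ evalAt (evalAt w u) v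
    evalAt-evalAt u []       = evalAt-ι w 0#
    evalAt-evalAt u (a ∷ as) = begin
      evalAt w (ι a ⊕ u ⊗ evalAt u as)
        ≡⟨ evalAt-⊕ w (ι a) (u ⊗ evalAt u as) ⟩
      evalAt w (ι a) ⊕ evalAt w (u ⊗ evalAt u as)
        ≡⟨ cong₂ _⊕_ (evalAt-ι w a)
             (≡.trans (evalAt-⊗ u (evalAt u as)) (cong (evalAt w u ⊗_) (evalAt-evalAt u as))) ⟩
      ι a ⊕ evalAt w u ⊗ evalAt (evalAt w u) as ∎

    -- The image of `u` is a parameter, so that both vectors can be given as literals and the
    -- equation between them checked by computation.
    compose : ∀ {m u v} → evalAt w u ≡ v → (x : Vec A m) → evalAt w (evalAt u x) ≡ evalAt v x
    compose refl x = evalAt-evalAt _ x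

    evalAt-^ : ∀ x k → evalAt w (x ^ k) ≡ evalAt w x ^ k
    evalAt-^ x zero    = evalAt-ι w 1#
    evalAt-^ x (suc k) = ≡.trans (evalAt-⊗ x (x ^ k)) (cong (evalAt w x ⊗_) (evalAt-^ x k))

-- Powers, Frobenius and quotients of commutative rings

-- The second argument only requires the Boolean of a closed decision to be evaluated, not its proof
-- part.
by : {P : Set} (P? : Dec P) → does P? ≡ true → P
by (true because ofʸ p) ≡.refl = p

prime∤! : ∀ {p} k → Prime p → k ℕ.< p → p ℕ.∤ k ℕ.!
prime∤! {p} zero    pr 0<p p∣1 = contradiction (ℕ.∣1⇒≡1 p∣1) (λ { ≡.refl → ℕ.¬prime[1] pr })
prime∤! {p} (suc k) pr k<p p∣  with ℕ.euclidsLemma (suc k) (k ℕ.!) pr p∣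
... | inj₁ p∣1+k = ℕ.>⇒∤ k<p p∣1+k
... | inj₂ p∣k!  = prime∤! k pr (ℕ.<-trans (ℕ.n<1+n k) k<p) p∣k!

prime∣C : ∀ {p} k → Prime p → 0 ℕ.< k → k ℕ.< p → p ℕ.∣ (p C k)
prime∣C {p@(suc p′)} k pr 0<k k<p with ℕ.euclidsLemma (p C k) (k ℕ.! ℕ.* (p ℕ.∸ k) ℕ.!) pr p∣
  where
  instance _ = k ℕ.!* (p ℕ.∸ k) !≢0
  k≤p = ℕ.<⇒≤ k<p
  p! : (p C k) ℕ.* (k ℕ.! ℕ.* (p ℕ.∸ k) ℕ.!) ≡ p ℕ.!
  p! = ≡.trans (≡.cong (ℕ._* (k ℕ.! ℕ.* (p ℕ.∸ k) ℕ.!)) (nCk≡n!/k![n-k]! k≤p))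
               (m/n*n≡m (k![n∸k]!∣n! k≤p))
  p∣ : p ℕ.∣ (p C k) ℕ.* (k ℕ.! ℕ.* (p ℕ.∸ k) ℕ.!)
  p∣ = ≡.subst (p ℕ.∣_) (≡.sym p!) (ℕ.m∣m*n (p′ ℕ.!))
... | inj₁ p∣C = p∣C
... | inj₂ p∣! with ℕ.euclidsLemma (k ℕ.!) ((p ℕ.∸ k) ℕ.!) pr p∣!
...   | inj₁ p∣k!   = contradiction p∣k! (prime∤! k pr k<p)
...   | inj₂ p∣p-k! = contradiction p∣p-k! (prime∤! (p ℕ.∸ k) pr (ℕ.∸-monoʳ-< 0<k (ℕ.<⇒≤ k<p)))

module Powers (R : CommutativeRing 0ℓ 0ℓ) where
  open CommutativeRing R
  open import Relation.Binary.Reasoning.Setoid setoid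
  import Algebra.Properties.Semiring.Exp semiring as Exp
  import Algebra.Properties.CommutativeSemiring.Exp commutativeSemiring as CExp
  open import Algebra.Properties.Semiring.Mult semiring using (_×_; ×-congʳ; ×-assocˡ; ×-assoc-*; ×-homo-1)
  open import Algebra.Properties.CommutativeSemiring.Binomial commutativeSemiring
    using (binomialTerm) renaming (theorem to binomial-theorem)
  open import Algebra.Properties.Semiring.Sum semiring using (sum; sum-cong-≋; sum-init-last; sum-replicate-zero)

  infixr 8 _^_
  _^_ : Carrier → ℕ → Carrier
  _^_ = pow _*_ 1#

  ^-stdlib : ∀ x k → x ^ k ≡ x Exp.^ k
  ^-stdlib x zero    = ≡.refl
  ^-stdlib x (suc k) = ≡.cong (x *_) (^-stdlib x k)

  ^-cong : ∀ {x y} k → x ≈ y → x ^ k ≈ y ^ k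
  ^-cong zero    x≈y = refl
  ^-cong (suc k) x≈y = *-cong x≈y (^-cong k x≈y)

  ^-homo-* : ∀ x j k → x ^ (j ℕ.+ k) ≈ x ^ j * x ^ k
  ^-homo-* x zero    k = sym (*-identityˡ _)
  ^-homo-* x (suc j) k = trans (*-congˡ (^-homo-* x j k)) (sym (*-assoc _ _ _))

  ^-assoc : ∀ x j k → (x ^ j) ^ k ≈ x ^ (j ℕ.* k)
  ^-assoc x j k rewrite ^-stdlib x j | ^-stdlib (x Exp.^ j) k | ^-stdlib x (j ℕ.* k) = Exp.^-assocʳ x j k

  ^-distrib-* : ∀ x y k → (x * y) ^ k ≈ x ^ k * y ^ k
  ^-distrib-* x y k rewrite ^-stdlib (x * y) k | ^-stdlib x k | ^-stdlib y k = CExp.^-distrib-* x y k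

  1^ : ∀ k → 1# ^ k ≈ 1#
  1^ zero    = refl
  1^ (suc k) = trans (*-identityˡ _) (1^ k)

  ^-root : ∀ x j k → x ^ j ≈ 1# → x ^ (j ℕ.* k) ≈ 1#
  ^-root x j k xʲ≈1 = trans (sym (^-assoc x j k)) (trans (^-cong k xʲ≈1) (1^ k))

  n×0 : ∀ n → n × 0# ≈ 0#
  n×0 zero    = refl
  n×0 (suc n) = trans (+-identityˡ _) (n×0 n)

  n×-zero : ∀ {p n} x → p × 1# ≈ 0# → p ℕ.∣ n → n × x ≈ 0#
  n×-zero {p} x p×1≈0 (divides q ≡.refl) = begin
    (q ℕ.* p) × x       ≈⟨ ×-assocˡ x q p ⟨
    q × (p × x)         ≈⟨ ×-congʳ q (×-congʳ p (*-identityˡ x)) ⟨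
    q × (p × (1# * x))  ≈⟨ ×-congʳ q (×-assoc-* p 1# x) ⟨
    q × ((p × 1#) * x)  ≈⟨ ×-congʳ q (trans (*-congʳ p×1≈0) (zeroˡ x)) ⟩
    q × 0#              ≈⟨ n×0 q ⟩
    0#                  ∎

  -- In the binomial expansion all terms but the outer two have a coefficient divisible by `p`.
  frobenius-+ : ∀ p → Prime p → p × 1# ≈ 0# → ∀ x y → (x + y) ^ p ≈ x ^ p + y ^ p
  frobenius-+ zero      pr = contradiction pr ℕ.¬prime[0]
  frobenius-+ p@(suc m) pr p×1≈0 x y = begin
    (x + y) ^ p                        ≡⟨ ^-stdlib (x + y) p ⟩
    (x + y) Exp.^ p                    ≈⟨ binomial-theorem p x y ⟩
    t Fin.zero + sum (λ i → t (Fin.suc i))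
      ≈⟨ +-congˡ (sum-init-last (λ i → t (Fin.suc i))) ⟩
    t Fin.zero + (sum (λ i → t (Fin.suc (inject₁ i))) + t (Fin.suc (fromℕ m)))
      ≈⟨ +-cong head (+-cong middle final) ⟩
    y ^ p + (0# + x ^ p)               ≈⟨ +-congˡ (+-identityˡ _) ⟩
    y ^ p + x ^ p                      ≈⟨ +-comm _ _ ⟩
    x ^ p + y ^ p                      ∎
    where
    t = binomialTerm x y p
    head : t Fin.zero ≈ y ^ p
    head = begin
      (p C 0) × (1# * y Exp.^ p)
        ≡⟨ ≡.cong (_× (1# * y Exp.^ p)) (≡.trans (nCk≡nC[n∸k] {0} {p} ℕ.z≤n) (nCn≡1 p)) ⟩
      1 × (1# * y Exp.^ p)        ≈⟨ ×-homo-1 _ ⟩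
      1# * y Exp.^ p              ≈⟨ *-identityˡ _ ⟩
      y Exp.^ p                   ≡⟨ ^-stdlib y p ⟨
      y ^ p                       ∎
    final′ : ∀ k → k ≡ m → (p C suc k) × (x Exp.^ suc k * y Exp.^ (m ℕ.∸ k)) ≈ x ^ p
    final′ k ≡.refl = begin
      (p C p) × (x Exp.^ p * y Exp.^ (m ℕ.∸ m))
        ≡⟨ ≡.cong₂ (λ i j → i × (x Exp.^ p * y Exp.^ j)) (nCn≡1 p) (ℕ.n∸n≡0 m) ⟩
      1 × (x Exp.^ p * 1#)  ≈⟨ trans (×-homo-1 _) (*-identityʳ _) ⟩
      x Exp.^ p             ≡⟨ ^-stdlib x p ⟨
      x ^ p                 ∎
    final : t (Fin.suc (fromℕ m)) ≈ x ^ p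
    final = final′ (toℕ (fromℕ m)) (Fin.toℕ-fromℕ m)
    middle : sum (λ i → t (Fin.suc (inject₁ i))) ≈ 0#
    middle = trans (sum-cong-≋ (λ i → n×-zero _ p×1≈0 (prime∣C (suc (toℕ (inject₁ i))) pr (ℕ.s≤s ℕ.z≤n)
        (ℕ.s≤s (≡.subst (ℕ._< m) (≡.sym (Fin.toℕ-inject₁ i)) (Fin.toℕ<n i))))))
      (sum-replicate-zero m)

  module Frobenius (p : ℕ) (pr : Prime p) (p×1≈0 : p × 1# ≈ 0#) where

    frobenius-+-^ : ∀ k x y → (x + y) ^ (p ℕ.^ k) ≈ x ^ (p ℕ.^ k) + y ^ (p ℕ.^ k)
    frobenius-+-^ zero    x y = trans (*-identityʳ _) (sym (+-cong (*-identityʳ _) (*-identityʳ _)))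
    frobenius-+-^ (suc k) x y = begin
      (x + y) ^ (p ℕ.* p ℕ.^ k)               ≈⟨ ^-assoc _ p _ ⟨
      ((x + y) ^ p) ^ (p ℕ.^ k)               ≈⟨ ^-cong (p ℕ.^ k) (frobenius-+ p pr p×1≈0 x y) ⟩
      (x ^ p + y ^ p) ^ (p ℕ.^ k)             ≈⟨ frobenius-+-^ k _ _ ⟩
      (x ^ p) ^ (p ℕ.^ k) + (y ^ p) ^ (p ℕ.^ k) ≈⟨ +-cong (^-assoc x p _) (^-assoc y p _) ⟩
      x ^ (p ℕ.* p ℕ.^ k) + y ^ (p ℕ.* p ℕ.^ k) ∎

-- R/(m) keeps the carrier and the operations of R and only coarsens the equality, so `lift` carries
-- every equation of R over.
module Quotient (R : CommutativeRing 0ℓ 0ℓ) (m : CommutativeRing.Carrier R) where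
  open CommutativeRing R
  open import Relation.Binary.Reasoning.Setoid setoid

  open import Algebra.Properties.Ring ring using (-‿+-comm; -‿distribʳ-*)
  open import Algebra.Solver.Ring.NaturalCoefficients.Default commutativeSemiring
    using (solve; _:=_; _:+_; _:*_)

  infix 4 _≈ₘ_
  record _≈ₘ_ (x y : Carrier) : Set where
    constructor congruent
    field
      factor   : Carrier
      equation : x ≈ y + m * factor

  lift : ∀ {x y} → x ≈ y → x ≈ₘ y
  lift x≈y = congruent 0# (trans x≈y (sym (trans (+-congˡ (zeroʳ m)) (+-identityʳ _))))

  private
    trans-lemma : ∀ x m y z → (x + m * y) + m * z ≈ x + m * (y + z)
    trans-lemma = solve 4 (λ x m y z → ((x :+ m :* y) :+ m :* z) := (x :+ m :* (y :+ z))) refl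
    +-lemma : ∀ x m y z w → (x + m * y) + (z + m * w) ≈ (x + z) + m * (y + w)
    +-lemma = solve 5 (λ x m y z w → ((x :+ m :* y) :+ (z :+ m :* w)) := ((x :+ z) :+ m :* (y :+ w))) refl
    *-lemma : ∀ x m y z w → (x + m * y) * (z + m * w) ≈ x * z + m * (x * w + y * (z + m * w))
    *-lemma = solve 5 (λ x m y z w → ((x :+ m :* y) :* (z :+ m :* w)) := (x :* z :+ m :* (x :* w :+ y :* (z :+ m :* w)))) refl
    sym-lemma : ∀ y z → y ≈ (y + m * z) + m * (- z)
    sym-lemma y z = sym (begin
      (y + m * z) + m * (- z)  ≈⟨ trans-lemma y m z (- z) ⟩
      y + m * (z + - z)        ≈⟨ +-congˡ (trans (*-congˡ (-‿inverseʳ z)) (zeroʳ m)) ⟩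
      y + 0#                   ≈⟨ +-identityʳ y ⟩
      y                        ∎)
    neg-lemma : ∀ x z → - (x + m * z) ≈ - x + m * (- z)
    neg-lemma x z = trans (sym (-‿+-comm x (m * z))) (+-congˡ (-‿distribʳ-* m z))

  commutativeRing : CommutativeRing 0ℓ 0ℓ
  commutativeRing = record
    { Carrier = Carrier ; _≈_ = _≈ₘ_ ; _+_ = _+_ ; _*_ = _*_ ; -_ = -_ ; 0# = 0# ; 1# = 1#
    ; isCommutativeRing = record
      { isRing = record
        { +-isAbelianGroup = record
          { isGroup = record
            { isMonoid = record
              { isSemigroup = record
                { isMagma = record
                  { isEquivalence = record
                    { refl  = lift refl
                    ; sym   = λ { {x} {y} (congruent z e) → congruent (- z) (trans (sym-lemma y z) (+-congʳ (sym e))) }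
                    ; trans = λ { (congruent z e) (congruent w f) → congruent (w + z) (trans e (trans (+-congʳ f) (trans-lemma _ m w z))) }
                    }
                  ; ∙-cong = λ { (congruent z e) (congruent w f) → congruent (z + w) (trans (+-cong e f) (+-lemma _ m z _ w)) }
                  }
                ; assoc = λ x y z → lift (+-assoc x y z)
                }
              ; identity = (λ x → lift (+-identityˡ x)) , λ x → lift (+-identityʳ x)
              }
            ; inverse = (λ x → lift (-‿inverseˡ x)) , λ x → lift (-‿inverseʳ x)
            ; ⁻¹-cong = λ { (congruent z e) → congruent (- z) (trans (-‿cong e) (neg-lemma _ z)) }
            }
          ; comm = λ x y → lift (+-comm x y)
          }
        ; *-cong     = λ { (congruent z e) (congruent w f) → congruent _ (trans (*-cong e f) (*-lemma _ m z _ w)) }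
        ; *-assoc    = λ x y z → lift (*-assoc x y z)
        ; *-identity = (λ x → lift (*-identityˡ x)) , λ x → lift (*-identityʳ x)
        ; distrib    = (λ x y z → lift (distribˡ x y z)) , λ x y z → lift (distribʳ x y z)
        }
      ; *-comm = λ x y → lift (*-comm x y)
      }
    }

  modulus≈0 : m ≈ₘ 0#
  modulus≈0 = congruent 1# (sym (trans (+-identityˡ _) (*-identityʳ m)))

-- Elementary symmetric functions and the period polynomial

open import Data.Product.Base using (_×_)

-- The bound `k` spares a hypothesis N ≠ 0: having infinite valuation falls under the first
-- alternative.
valuation : ∀ p N k → p ℕ.^ k ℕ.∣ N ⊎ (∃[ s ] ∃[ N′ ] s ℕ.< k × N ≡ p ℕ.^ s ℕ.* N′ × ¬ p ℕ.∣ N′)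
valuation p N zero = inj₁ (ℕ.1∣ N)
valuation p N (suc k) with valuation p N k
... | inj₂ (s , N′ , s<k , rest) = inj₂ (s , N′ , ℕ.m<n⇒m<1+n s<k , rest)
... | inj₁ (divides N′ N≡) with p ℕ.∣? N′
...   | yes (divides N″ N′≡) = inj₁ (divides N″ (begin
          N                          ≡⟨ N≡ ⟩
          N′ ℕ.* p ℕ.^ k             ≡⟨ ≡.cong (ℕ._* p ℕ.^ k) N′≡ ⟩
          N″ ℕ.* p ℕ.* p ℕ.^ k       ≡⟨ ℕ.*-assoc N″ p _ ⟩
          N″ ℕ.* (p ℕ.* p ℕ.^ k)     ∎))
        where open ≡.≡-Reasoning
...   | no p∤N′ = inj₂ (k , N′ , ℕ.n<1+n k , ≡.trans N≡ (ℕ.*-comm N′ _) , p∤N′)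

^-distribʳ-* : ∀ k m n → (m ℕ.* n) ℕ.^ k ≡ m ℕ.^ k ℕ.* n ℕ.^ k
^-distribʳ-* zero    m n = ≡.refl
^-distribʳ-* (suc k) m n = ≡.trans (≡.cong (m ℕ.* n ℕ.*_) (^-distribʳ-* k m n))
  (ℕ.[m*n]*[o*p]≡[m*o]*[n*p] m n (m ℕ.^ k) (n ℕ.^ k))

prime[11] : ℕ.Prime 11
prime[11] = by (ℕ.prime? 11) ≡.refl

module Symmetric (R : CommutativeRing 0ℓ 0ℓ) where
  open CommutativeRing R
  open Powers R
  open import Relation.Binary.Reasoning.Setoid setoid
  open import Algebra.Definitions.RawMonoid +-rawMonoid using (_×′_)
  open import Algebra.Solver.Ring.NaturalCoefficients.Default commutativeSemiring
    using (Polynomial; solve; _:=_; _:+_; _:*_; con)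

  esym : ℕ → List Carrier → Carrier
  esym zero    _        = 1#
  esym (suc j) []       = 0#
  esym (suc j) (x ∷ xs) = x * esym j xs + esym (suc j) xs

  esym-cong : ∀ j {xs ys} → Pointwise _≈_ xs ys → esym j xs ≈ esym j ys
  esym-cong zero    _          = refl
  esym-cong (suc j) []         = refl
  esym-cong (suc j) (e ∷ es) = +-cong (*-cong e (esym-cong j es)) (esym-cong (suc j) es)

  esym-↭ : ∀ j {xs ys} → xs ↭ ys → esym j xs ≈ esym j ys
  esym-↭ j       Perm.refl         = refl
  esym-↭ zero    (Perm.prep x p)   = refl
  esym-↭ (suc j) (Perm.prep x p)   = +-cong (*-congˡ (esym-↭ j p)) (esym-↭ (suc j) p)
  esym-↭ zero          (Perm.swap x y p) = refl
  esym-↭ (suc zero) {_ ∷ _ ∷ xs} {_ ∷ _ ∷ ys} (Perm.swap x y p) = begin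
    x * 1# + (y * 1# + esym 1 xs)  ≈⟨ +-congˡ (+-congˡ (esym-↭ 1 p)) ⟩
    x * 1# + (y * 1# + esym 1 ys)  ≈⟨ solve 3 (λ a b c → a :+ (b :+ c) := b :+ (a :+ c)) refl _ _ _ ⟩
    y * 1# + (x * 1# + esym 1 ys)  ∎
  esym-↭ (suc (suc j)) {_ ∷ _ ∷ xs} {_ ∷ _ ∷ ys} (Perm.swap x y p) = begin
    x * (y * e₀ xs + e₁ xs) + (y * e₁ xs + e₂ xs)
      ≈⟨ +-cong (*-congˡ (+-cong (*-congˡ (esym-↭ j p)) (esym-↭ (suc j) p)))
                (+-cong (*-congˡ (esym-↭ (suc j) p)) (esym-↭ (suc (suc j)) p)) ⟩
    x * (y * e₀ ys + e₁ ys) + (y * e₁ ys + e₂ ys)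
      ≈⟨ solve 5 (λ x y a b c → x :* (y :* a :+ b) :+ (y :* b :+ c) := y :* (x :* a :+ b) :+ (x :* b :+ c))
           refl x y _ _ _ ⟩
    y * (x * e₀ ys + e₁ ys) + (x * e₁ ys + e₂ ys) ∎
    where
    e₀ = esym j
    e₁ = esym (suc j)
    e₂ = esym (suc (suc j))
  esym-↭ j (Perm.trans p q) = trans (esym-↭ j p) (esym-↭ j q)

  esym-scale : ∀ d j xs → esym j (List.map (d *_) xs) ≈ d ^ j * esym j xs
  esym-scale d zero    xs       = sym (*-identityˡ 1#)
  esym-scale d (suc j) []       = sym (zeroʳ _)
  esym-scale d (suc j) (x ∷ xs) = begin
    (d * x) * esym j (List.map (d *_) xs) + esym (suc j) (List.map (d *_) xs)
      ≈⟨ +-cong (*-congˡ (esym-scale d j xs)) (esym-scale d (suc j) xs) ⟩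
    (d * x) * (d ^ j * esym j xs) + d ^ suc j * esym (suc j) xs
      ≈⟨ solve 5 (λ d x p e f → (d :* x) :* (p :* e) :+ (d :* p) :* f := (d :* p) :* (x :* e :+ f))
           refl d x _ _ _ ⟩
    d ^ suc j * (x * esym j xs + esym (suc j) xs) ∎

  esym-long : ∀ j xs → List.length xs ℕ.< j → esym j xs ≈ 0#
  esym-long (suc j) []       _           = refl
  esym-long (suc j) (x ∷ xs) (ℕ.s≤s l<j) = begin
    x * esym j xs + esym (suc j) xs
      ≈⟨ +-cong (*-congˡ (esym-long j xs l<j)) (esym-long (suc j) xs (ℕ.m<n⇒m<1+n l<j)) ⟩
    x * 0# + 0#  ≈⟨ trans (+-identityʳ _) (zeroʳ x) ⟩
    0#           ∎

  -- ψ = X⁵ + X⁴ - 4X³ - 3X² + 3X + 1 is the minimal polynomial of ζ₁₁ + ζ₁₁⁻¹,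
  -- and its coefficients up to sign are the prescribed values.
  record HasPeriodSymmetries (xs : List Carrier) : Set where
    field
      e₁ : esym 1 xs + 1# ≈ 0#
      e₂ : esym 2 xs + 4 ×′ 1# ≈ 0#
      e₃ : esym 3 xs ≈ 3 ×′ 1#
      e₄ : esym 4 xs ≈ 3 ×′ 1#
      e₅ : esym 5 xs + 1# ≈ 0#

  private
    -- ψ(t) = 0, with both sides moved so that no subtraction occurs.
    PeriodEquation : Carrier → Set
    PeriodEquation t = t ^ 5 + t ^ 4 + 3 ×′ 1# * t + 1# ≈ 4 ×′ 1# * t ^ 3 + 3 ×′ 1# * t ^ 2

    infixr 9 _:^_
    _:^_ : ∀ {n} → Polynomial n → ℕ → Polynomial n
    _:^_ = pow _:*_ (con 1)

  -- This is ∏ (t - xᵢ) = 0, which holds because t is one of the xᵢ, with the negative terms moved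
  -- to the right. Writing each eⱼ as t eⱼ₋₁ + eⱼ of the other four elements makes the two sides
  -- agree; e₅ of four elements is 0.
  vieta : ∀ {t x₂ x₃ x₄ x₅} → let xs = t ∷ x₂ ∷ x₃ ∷ x₄ ∷ x₅ ∷ [] in
    t ^ 5 + esym 2 xs * t ^ 3 + esym 4 xs * t ≈ esym 1 xs * t ^ 4 + esym 3 xs * t ^ 2 + esym 5 xs
  vieta {t} {x₂} {x₃} {x₄} {x₅} = trans
    (solve 5 (λ t e₁ e₂ e₃ e₄ →
         (t :^ 5 :+ (t :* e₁ :+ e₂) :* t :^ 3 :+ (t :* e₃ :+ e₄) :* t)
      := ((t :* con 1 :+ e₁) :* t :^ 4 :+ (t :* e₂ :+ e₃) :* t :^ 2 :+ t :* e₄))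
      refl t (esym 1 xs) (esym 2 xs) (esym 3 xs) (esym 4 xs))
    (+-congˡ (sym (trans (+-congˡ (esym-long 5 xs ℕ.≤-refl)) (+-identityʳ _))))
    where xs = x₂ ∷ x₃ ∷ x₄ ∷ x₅ ∷ []

  periodEquation : ∀ {t x₂ x₃ x₄ x₅} →
    HasPeriodSymmetries (t ∷ x₂ ∷ x₃ ∷ x₄ ∷ x₅ ∷ []) → PeriodEquation t
  periodEquation {t} {x₂} {x₃} {x₄} {x₅} h = begin
    t ^ 5 + t ^ 4 + 3 ×′ 1# * t + 1#
      -- The zero multiple of t³ is there to be replaced by e₂ + 4: the value -4 enters without a
      -- subtraction.
      ≈⟨ solve 2 (λ a b → a := a :+ b :* con 0) refl _ (t ^ 3) ⟩
    t ^ 5 + t ^ 4 + 3 ×′ 1# * t + 1# + t ^ 3 * 0#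
      ≈⟨ +-cong (+-congʳ (+-congˡ (*-congʳ e₄))) (*-congˡ e₂) ⟨
    t ^ 5 + t ^ 4 + E 4 * t + 1# + t ^ 3 * (E 2 + 4 ×′ 1#)
      ≈⟨ solve 3 (λ t e₂ e₄ → t :^ 5 :+ t :^ 4 :+ e₄ :* t :+ con 1 :+ t :^ 3 :* (e₂ :+ con 4)
           := (t :^ 5 :+ e₂ :* t :^ 3 :+ e₄ :* t) :+ (t :^ 4 :+ con 1 :+ con 4 :* t :^ 3)) refl t _ _ ⟩
    (t ^ 5 + E 2 * t ^ 3 + E 4 * t) + (t ^ 4 + 1# + 4 ×′ 1# * t ^ 3)
      ≈⟨ +-congʳ vieta ⟩
    (E 1 * t ^ 4 + E 3 * t ^ 2 + E 5) + (t ^ 4 + 1# + 4 ×′ 1# * t ^ 3)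
      ≈⟨ solve 4 (λ t e₁ e₃ e₅ → (e₁ :* t :^ 4 :+ e₃ :* t :^ 2 :+ e₅) :+ (t :^ 4 :+ con 1 :+ con 4 :* t :^ 3)
           := (e₁ :+ con 1) :* t :^ 4 :+ (e₅ :+ con 1) :+ (con 4 :* t :^ 3 :+ e₃ :* t :^ 2)) refl t _ _ _ ⟩
    (E 1 + 1#) * t ^ 4 + (E 5 + 1#) + (4 ×′ 1# * t ^ 3 + E 3 * t ^ 2)
      ≈⟨ +-cong (+-cong (*-congʳ e₁) e₅) (+-congˡ (*-congʳ e₃)) ⟩
    0# * t ^ 4 + 0# + (4 ×′ 1# * t ^ 3 + 3 ×′ 1# * t ^ 2)
      ≈⟨ solve 2 (λ a b → con 0 :* a :+ con 0 :+ b := b) refl _ _ ⟩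
    4 ×′ 1# * t ^ 3 + 3 ×′ 1# * t ^ 2 ∎
    where
    open HasPeriodSymmetries h
    E = λ j → esym j (t ∷ x₂ ∷ x₃ ∷ x₄ ∷ x₅ ∷ [])

  Φ₁₁ : Carrier → Carrier
  Φ₁₁ b = 1# + b + b ^ 2 + b ^ 3 + b ^ 4 + b ^ 5 + b ^ 6 + b ^ 7 + b ^ 8 + b ^ 9 + b ^ 10

  private
    :Φ₁₁ : ∀ {n} → Polynomial n → Polynomial n
    :Φ₁₁ b = con 1 :+ b :+ b :^ 2 :+ b :^ 3 :+ b :^ 4 :+ b :^ 5 :+ b :^ 6 :+ b :^ 7 :+ b :^ 8 :+ b :^ 9 :+ b :^ 10

    +-cancel-zero : ∀ x y → x ≈ x + y → y ≈ 0#
    +-cancel-zero x y x≈x+y = begin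
      y              ≈⟨ +-identityˡ y ⟨
      0# + y         ≈⟨ +-congʳ (-‿inverseˡ x) ⟨
      (- x + x) + y  ≈⟨ +-assoc _ _ _ ⟩
      - x + (x + y)  ≈⟨ +-congˡ x≈x+y ⟨
      - x + x        ≈⟨ -‿inverseˡ x ⟩
      0#             ∎

  -- b⁵ ψ(b + b⁻¹) = Φ₁₁(b)
  period⇒Φ₁₁ : ∀ b b′ → b * b′ ≈ 1# → PeriodEquation (b + b′) → Φ₁₁ b ≈ 0#
  period⇒Φ₁₁ b b′ bb′≈1 eq = +-cancel-zero (r s) (Φ₁₁ b) (begin
    r s                      ≈⟨ r-cong s≈bt ⟩
    r (b * t)                ≈⟨ solve 2 (λ b t → :r b (b :* t) := b :^ 5 :* (con 4 :* t :^ 3 :+ con 3 :* t :^ 2)) refl b t ⟩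
    b ^ 5 * (4 ×′ 1# * t ^ 3 + 3 ×′ 1# * t ^ 2)        ≈⟨ *-congˡ eq ⟨
    b ^ 5 * (t ^ 5 + t ^ 4 + 3 ×′ 1# * t + 1#)
      ≈⟨ solve 2 (λ b t → b :^ 5 :* (t :^ 5 :+ t :^ 4 :+ con 3 :* t :+ con 1) := :l b (b :* t)) refl b t ⟩
    l (b * t)                ≈⟨ l-cong s≈bt ⟨
    l s                      ≈⟨ solve 1 (λ b → :l b (b :* b :+ con 1) := :r b (b :* b :+ con 1) :+ :Φ₁₁ b) refl b ⟩
    r s + Φ₁₁ b              ∎)
    where
    t = b + b′
    s = b * b + 1#
    s≈bt : s ≈ b * t
    s≈bt = trans (+-congˡ (sym bb′≈1)) (sym (distribˡ b b b′))
    -- The two sides of `PeriodEquation` times b⁵, written in s = b t. Replacing s by b² + 1 leaves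
    -- a polynomial identity in `b` alone.
    l r : Carrier → Carrier
    l s = s ^ 5 + b * s ^ 4 + 3 ×′ 1# * b ^ 4 * s + b ^ 5
    r s = 4 ×′ 1# * b ^ 2 * s ^ 3 + 3 ×′ 1# * b ^ 3 * s ^ 2
    :l :r : ∀ {n} → Polynomial n → Polynomial n → Polynomial n
    :l b s = s :^ 5 :+ b :* s :^ 4 :+ con 3 :* b :^ 4 :* s :+ b :^ 5
    :r b s = con 4 :* b :^ 2 :* s :^ 3 :+ con 3 :* b :^ 3 :* s :^ 2
    l-cong : ∀ {x y} → x ≈ y → l x ≈ l y
    l-cong e = +-congʳ (+-cong (+-cong (^-cong 5 e) (*-congˡ (^-cong 4 e))) (*-congˡ e))
    r-cong : ∀ {x y} → x ≈ y → r x ≈ r y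
    r-cong e = +-cong (*-congˡ (^-cong 3 e)) (*-congˡ (^-cong 2 e))

  Φ₁₁-root-^11 : ∀ b → Φ₁₁ b ≈ 0# → b ^ 11 ≈ 1#
  Φ₁₁-root-^11 b Φ≈0 = begin
    b ^ 11           ≈⟨ +-identityʳ _ ⟨
    b ^ 11 + 0#      ≈⟨ +-congˡ Φ≈0 ⟨
    b ^ 11 + Φ₁₁ b   ≈⟨ solve 1 (λ b → b :^ 11 :+ :Φ₁₁ b := b :* :Φ₁₁ b :+ con 1) refl b ⟩
    b * Φ₁₁ b + 1#   ≈⟨ +-congʳ (trans (*-congˡ Φ≈0) (zeroʳ b)) ⟩
    0# + 1#          ≈⟨ +-identityˡ 1# ⟩
    1#               ∎

  Φ₁₁-1 : ∀ b → b ≈ 1# → Φ₁₁ b ≈ 11 ×′ 1#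
  Φ₁₁-1 b b≈1 = begin
    Φ₁₁ b      ≈⟨ +-cong (+-cong (+-cong (+-cong (+-cong (+-cong (+-cong (+-cong (+-cong (+-congˡ b≈1)
                    (1s 2)) (1s 3)) (1s 4)) (1s 5)) (1s 6)) (1s 7)) (1s 8)) (1s 9)) (1s 10) ⟩
    11 ×′ 1#   ∎
    where
    1s : ∀ k → b ^ k ≈ 1#
    1s k = trans (^-cong k b≈1) (1^ k)

  coprime-orders : ∀ b j k → ℕ.Coprime j k → b ^ j ≈ 1# → b ^ k ≈ 1# → b ≈ 1#
  coprime-orders b j k jk bʲ≈1 bᵏ≈1 = case (ℕ.coprime-Bézout jk)
    where
    bezout : ∀ {j k} x y → b ^ j ≈ 1# → b ^ k ≈ 1# → 1 ℕ.+ y ℕ.* k ≡ x ℕ.* j → b ≈ 1#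
    bezout {j} {k} x y bʲ≈1 bᵏ≈1 eq = begin
      b                     ≈⟨ *-identityʳ b ⟨
      b * 1#                ≈⟨ *-congˡ (^-root b k y bᵏ≈1) ⟨
      b ^ (1 ℕ.+ k ℕ.* y)   ≡⟨ ≡.cong (b ^_) (≡.trans (≡.cong suc (ℕ.*-comm k y)) (≡.trans eq (ℕ.*-comm x j))) ⟩
      b ^ (j ℕ.* x)         ≈⟨ ^-root b j x bʲ≈1 ⟩
      1#                    ∎
    case : ℕ.Bézout.Identity 1 j k → b ≈ 1#
    case (+- x y eq) = bezout x y bʲ≈1 bᵏ≈1 eq
    case (-+ x y eq) = bezout y x bᵏ≈1 bʲ≈1 eq

  -- The order of a has 11-adic valuation exactly k + 1, because a^(22^k) has order 11.
  11^∣exponent : ∀ a a′ k N {x₂ x₃ x₄ x₅} → ¬ 11 ×′ 1# ≈ 0# → a * a′ ≈ 1# → a ^ N ≈ 1# →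
    HasPeriodSymmetries (a ^ (22 ℕ.^ k) + a′ ^ (22 ℕ.^ k) ∷ x₂ ∷ x₃ ∷ x₄ ∷ x₅ ∷ []) →
    11 ℕ.^ suc k ℕ.∣ N
  11^∣exponent a a′ k N 11≉0 aa′≈1 aᴺ≈1 h with valuation 11 N (suc k)
  ... | inj₁ d = d
  ... | inj₂ (s , N′ , ℕ.s≤s s≤k , N≡ , 11∤N′) = contradiction 11≈0 11≉0
    where
    b = a ^ (22 ℕ.^ k)
    Φ≈0 : Φ₁₁ b ≈ 0#
    Φ≈0 = period⇒Φ₁₁ b (a′ ^ (22 ℕ.^ k))
      (trans (sym (^-distrib-* a a′ (22 ℕ.^ k))) (trans (^-cong (22 ℕ.^ k) aa′≈1) (1^ (22 ℕ.^ k))))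
      (periodEquation h)
    -- If 11 divides N only s ≤ k times, then N divides 22ᵏ N′ and b^N′ = 1. With b¹¹ = 1 and 11 ∤
    -- N′ this forces b = 1, against Φ₁₁(1) = 11 ≠ 0.
    exponent : 22 ℕ.^ k ℕ.* N′ ≡ N ℕ.* (2 ℕ.^ s ℕ.* 22 ℕ.^ (k ℕ.∸ s))
    exponent = ≡.trans (≡.cong (ℕ._* N′) (≡.trans (≡.cong (22 ℕ.^_) (≡.sym (ℕ.m+[n∸m]≡n s≤k)))
        (≡.trans (ℕ.^-distribˡ-+-* 22 s (k ℕ.∸ s)) (≡.cong (ℕ._* 22 ℕ.^ (k ℕ.∸ s)) (^-distribʳ-* s 11 2)))))
      (≡.trans (rearrange (11 ℕ.^ s) (2 ℕ.^ s) (22 ℕ.^ (k ℕ.∸ s)) N′)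
        (≡.cong (ℕ._* (2 ℕ.^ s ℕ.* 22 ℕ.^ (k ℕ.∸ s))) (≡.sym N≡)))
      where
      open import Data.Nat.Solver using (module +-*-Solver)
      open +-*-Solver using () renaming (solve to solveℕ; _:=_ to _:≡_; _:*_ to _:×_)
      rearrange : ∀ a b c d → a ℕ.* b ℕ.* c ℕ.* d ≡ a ℕ.* d ℕ.* (b ℕ.* c)
      rearrange = solveℕ 4 (λ a b c d → a :× b :× c :× d :≡ a :× d :× (b :× c)) ≡.refl
    b^N′≈1 : b ^ N′ ≈ 1#
    b^N′≈1 = begin
      b ^ N′                                        ≈⟨ ^-assoc a (22 ℕ.^ k) N′ ⟩
      a ^ (22 ℕ.^ k ℕ.* N′)                         ≡⟨ ≡.cong (a ^_) exponent ⟩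
      a ^ (N ℕ.* (2 ℕ.^ s ℕ.* 22 ℕ.^ (k ℕ.∸ s)))    ≈⟨ ^-root a N _ aᴺ≈1 ⟩
      1#                                            ∎
    coprime : ℕ.Coprime 11 N′
    coprime (d∣11 , d∣N′) with ℕ.prime⇒irreducible prime[11] d∣11
    ... | inj₁ d≡1    = d≡1
    ... | inj₂ ≡.refl = contradiction d∣N′ 11∤N′
    11≈0 : 11 ×′ 1# ≈ 0#
    11≈0 = trans (sym (Φ₁₁-1 b (coprime-orders b 11 N′ coprime (Φ₁₁-root-^11 b Φ≈0) b^N′≈1))) Φ≈0

-- Gauss sums

module Modulo (R : CommutativeRing 0ℓ 0ℓ) (n : ℕ) where
  private
    module R = CommutativeRing R
    open import Algebra.Definitions.RawMonoid R.+-rawMonoid using () renaming (_×_ to _·_)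

  modulus : R.Carrier
  modulus = n · R.1#

  open Quotient R modulus public

  private
    module Q = CommutativeRing commutativeRing
    open import Algebra.Definitions.RawMonoid Q.+-rawMonoid using () renaming (_×_ to _·′_)

    ·′≡· : ∀ k x → k ·′ x ≡ k · x
    ·′≡· zero    x = ≡.refl
    ·′≡· (suc k) x = ≡.cong (x R.+_) (·′≡· k x)

  n×1≈0 : n ·′ Q.1# Q.≈ Q.0#
  n×1≈0 = ≡.subst (Q._≈ Q.0#) (≡.sym (·′≡· n R.1#)) modulus≈0

module SymmetricModulo (R : CommutativeRing 0ℓ 0ℓ) (n : ℕ) where
  private
    module Q where
      open Modulo R n public using (commutativeRing)
      open Symmetric commutativeRing public using (esym)
    open Symmetric R using (esym)

  -- The two rings share their operations, but calls stuck on a variable are compared by their ring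
  -- parameter, so an induction is needed.
  esym-modulo : ∀ j xs → Q.esym j xs ≡ esym j xs
  esym-modulo zero    xs       = ≡.refl
  esym-modulo (suc j) []       = ≡.refl
  esym-modulo (suc j) (x ∷ xs) =
    ≡.cong₂ (λ u v → CommutativeRing._+_ R (CommutativeRing._*_ R x u) v) (esym-modulo j xs) (esym-modulo (suc j) xs)

module AdjoinModulo
  {A : Set} {_+_ _*_ : Op₂ A} { -_ : Op₁ A} {0# 1# : A}
  (isCommRing : IsCommutativeRing _≡_ _+_ _*_ -_ 0# 1#)
  {n : ℕ} (c : Vec A (suc n)) (p : ℕ)
  where

  open Adjoin isCommRing c

  base : CommutativeRing 0ℓ 0ℓ
  base = record { isCommutativeRing = isCommRing }

  module B = Modulo base p
  open Modulo commutativeRing p using (_≈ₘ_; congruent; n×1≈0; lift) renaming (commutativeRing to quotient; modulus to modulusV) public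
  module Q = CommutativeRing quotient
  open Powers quotient hiding (_^_)

  modulusV≡ι : modulusV ≡ ι B.modulus
  modulusV≡ι = multiple p
    where
    module R = CommutativeRing commutativeRing
    module A = CommutativeRing base
    open import Algebra.Definitions.RawMonoid R.+-rawMonoid using () renaming (_×_ to _·ⱽ_)
    open import Algebra.Definitions.RawMonoid A.+-rawMonoid using () renaming (_×_ to _·_)
    multiple : ∀ k → k ·ⱽ 1V ≡ ι (k · 1#)
    multiple zero    = ≡.refl
    multiple (suc k) = ≡.trans (≡.cong (1V ⊕_) (multiple k)) (≡.sym (ι-homo-+ 1# (k · 1#)))

  ≈ₘ-lookup : ∀ {x y} (i : Fin (suc n)) → x ≈ₘ y → Vec.lookup x i B.≈ₘ Vec.lookup y i
  ≈ₘ-lookup {x} {y} i (congruent z e) = B.congruent (Vec.lookup z i) (begin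
    Vec.lookup x i                                   ≡⟨ ≡.cong (λ v → Vec.lookup v i) e ⟩
    Vec.lookup (y ⊕ modulusV ⊗ z) i                  ≡⟨ ≡.cong (λ v → Vec.lookup (y ⊕ v) i)
                                                          (≡.trans (≡.cong (_⊗ z) modulusV≡ι) (ι-⊗ B.modulus z)) ⟩
    Vec.lookup (y ⊕ B.modulus • z) i                 ≡⟨ Vec.lookup-zipWith _+_ i y (B.modulus • z) ⟩
    Vec.lookup y i + Vec.lookup (B.modulus • z) i    ≡⟨ ≡.cong (Vec.lookup y i +_) (Vec.lookup-map i (B.modulus *_) z) ⟩
    Vec.lookup y i + (B.modulus * Vec.lookup z i)    ∎)
    where open ≡.≡-Reasoning

  ι-≈ₘ : ∀ {x y} → x B.≈ₘ y → ι x ≈ₘ ι y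
  ι-≈ₘ {x} {y} (B.congruent z e) = congruent (ι z) (begin
    ι x                        ≡⟨ ≡.cong ι e ⟩
    ι (y + (B.modulus * z))    ≡⟨ ι-homo-+ y (B.modulus * z) ⟩
    ι y ⊕ ι (B.modulus * z)    ≡⟨ ≡.cong (ι y ⊕_) (ι-homo-* B.modulus z) ⟩
    ι y ⊕ ι B.modulus ⊗ ι z    ≡⟨ ≡.cong (λ m → ι y ⊕ m ⊗ ι z) modulusV≡ι ⟨
    ι y ⊕ modulusV ⊗ ι z       ∎)
    where open ≡.≡-Reasoning

  module _ (w : V) (root : evalAt w c ≡ w ^ suc n) where
    open Endo w root

    evalAt-≈ₘ : ∀ {x y} → x ≈ₘ y → evalAt w x ≈ₘ evalAt w y
    evalAt-≈ₘ {x} {y} (congruent z e) = congruent (evalAt w z) (begin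
      evalAt w x                                    ≡⟨ ≡.cong (evalAt w) e ⟩
      evalAt w (y ⊕ modulusV ⊗ z)                   ≡⟨ evalAt-⊕ w y (modulusV ⊗ z) ⟩
      evalAt w y ⊕ evalAt w (modulusV ⊗ z)          ≡⟨ ≡.cong (evalAt w y ⊕_) (evalAt-⊗ modulusV z) ⟩
      evalAt w y ⊕ evalAt w modulusV ⊗ evalAt w z   ≡⟨ ≡.cong (λ m → evalAt w y ⊕ m ⊗ evalAt w z) fixed ⟩
      evalAt w y ⊕ modulusV ⊗ evalAt w z            ∎)
      where
      open ≡.≡-Reasoning
      fixed : evalAt w modulusV ≡ modulusV
      fixed = ≡.trans (≡.cong (evalAt w) modulusV≡ι) (≡.trans (evalAt-ι w B.modulus) (≡.sym modulusV≡ι))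

  ι-^ : ∀ a k → ι a ^ k ≡ ι (pow _*_ 1# a k)
  ι-^ a zero    = ≡.refl
  ι-^ a (suc k) = ≡.trans (≡.cong (ι a ⊗_) (ι-^ a k)) (≡.sym (ι-homo-* a _))

  module _ (pr : Prime p) where
    open Frobenius p pr n×1≈0 public
    open import Relation.Binary.Reasoning.Setoid Q.setoid

    0^ : ∀ k → 0 ℕ.< k → 0V ^ k ≈ₘ 0V
    0^ (suc k) _ = Q.zeroˡ (0V ^ k)

    0<p^ : ∀ k → 0 ℕ.< p ℕ.^ k
    0<p^ k = ℕ.m^n>0 p {{ℕ.prime⇒nonZero pr}} k

    -- The power map is additive modulo `p` and fixes the coefficients, so it acts on the argument
    -- alone. It is used with k = 1 for Gauss sums and with k = 10 for integral coefficients.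
    evalAt-frobenius : ∀ k w {m} {v : Vec A m} → All (λ a → ι a ^ (p ℕ.^ k) ≈ₘ ι a) v →
      evalAt w v ^ (p ℕ.^ k) ≈ₘ evalAt (w ^ (p ℕ.^ k)) v
    evalAt-frobenius k w []       = 0^ (p ℕ.^ k) (0<p^ k)
    evalAt-frobenius k w {v = a ∷ as} (e ∷ es) = begin
      (ι a ⊕ w ⊗ evalAt w as) ^ P          ≈⟨ frobenius-+-^ k (ι a) (w ⊗ evalAt w as) ⟩
      ι a ^ P ⊕ (w ⊗ evalAt w as) ^ P      ≈⟨ Q.+-cong e (^-distrib-* w (evalAt w as) P) ⟩
      ι a ⊕ w ^ P ⊗ evalAt w as ^ P        ≈⟨ Q.+-congˡ {ι a} (Q.*-congˡ {w ^ P} (evalAt-frobenius k w es)) ⟩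
      ι a ⊕ w ^ P ⊗ evalAt (w ^ P) as      ∎
      where P = p ℕ.^ k

-- Powers of a Gauss sum modulo a prime

module GaussSum
  {A : Set} {_+_ _*_ : Op₂ A} { -_ : Op₁ A} {0# 1# : A}
  (isCommRing : IsCommutativeRing _≡_ _+_ _*_ -_ 0# 1#)
  {n : ℕ} (c : Vec A (suc n))
  where

  private
    module A where
      open IsCommutativeRing isCommRing public
      ring : CommutativeRing 0ℓ 0ℓ
      ring = record { isCommutativeRing = isCommRing }
      open Powers ring public

  open Adjoin isCommRing c public

  private
    module V = Powers commutativeRing

  -- Gᵖ = Gᵈᵏ⁺¹ = Jᵏ G, while Frobenius applied to the fixed coefficients gives Gᵖ = ω G modulo p;
  -- the coefficient of G equal to 1 then yields the claim.
  gaussSum-power : ∀ G J ω (i : Fin (suc n)) d e s t →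
    gen ^ s ≡ 1V → All (λ a → a A.^ suc e ≡ a) G → Vec.lookup G i ≡ 1# →
    G ^ suc d ≡ J • G → evalAt (gen ^ t) G ≡ ω • G →
    ∀ p k l m → Prime p → p ≡ suc (d ℕ.* k) → p ≡ suc (e ℕ.* l) → p ≡ t ℕ.+ s ℕ.* m →
    Modulo._≈ₘ_ A.ring p (J A.^ k) ω
  gaussSum-power G J ω i d e s t genˢ≡1 values G₁≡1 Gᵈ⁺¹≡JG Gᵗ≡ωG p k l m pr p≡dk p≡el p≡sm =
    ≡.subst₂ M.B._≈ₘ_ (coefficient (J A.^ k)) (coefficient ω) (M.≈ₘ-lookup i JᵏG≈ωG)
    where
    module M = AdjoinModulo isCommRing c p
    open M using (_≈ₘ_; module Q)

    -- The form aᵉ⁺¹ = a, unlike aᵉ = 1, also covers the coefficient 0 of a Gauss sum.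
    fixed : ∀ {a} → a A.^ suc e ≡ a → a A.^ p ≡ a
    fixed {a} aᵉ = ≡.trans (≡.cong (a A.^_) p≡el) (iterate l)
      where
      iterate : ∀ l → a A.^ suc (e ℕ.* l) ≡ a
      iterate zero    = ≡.trans (≡.cong (λ j → a A.^ suc j) (ℕ.*-zeroʳ e)) (A.*-identityʳ a)
      iterate (suc l) = begin
        a A.^ suc (e ℕ.* suc l)           ≡⟨ ≡.cong (λ j → a A.^ suc j) (≡.trans (ℕ.*-suc e l) (ℕ.+-comm e (e ℕ.* l))) ⟩
        a A.^ (suc (e ℕ.* l) ℕ.+ e)      ≡⟨ A.^-homo-* a (suc (e ℕ.* l)) e ⟩
        (a A.^ suc (e ℕ.* l)) * (a A.^ e)  ≡⟨ ≡.cong (_* (a A.^ e)) (iterate l) ⟩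
        a A.^ suc e                           ≡⟨ aᵉ ⟩
        a                                  ∎
        where open ≡.≡-Reasoning

    genᵖ : gen ^ p ≡ gen ^ t
    genᵖ = begin
      gen ^ p                      ≡⟨ ≡.cong (gen ^_) p≡sm ⟩
      gen ^ (t ℕ.+ s ℕ.* m)       ≡⟨ V.^-homo-* gen t (s ℕ.* m) ⟩
      gen ^ t ⊗ gen ^ (s ℕ.* m)   ≡⟨ ≡.cong (gen ^ t ⊗_) (V.^-root gen s m genˢ≡1) ⟩
      gen ^ t ⊗ 1V                 ≡⟨ ⊗-identityʳ (gen ^ t) ⟩
      gen ^ t                      ∎
      where open ≡.≡-Reasoning

    Gᵖ≈ωG : G ^ p ≈ₘ ω • G
    Gᵖ≈ωG = begin
      G ^ p                          ≡⟨ ≡.cong₂ _^_ (≡.sym (evalAt-gen G)) (≡.sym (ℕ.*-identityʳ p)) ⟩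
      evalAt gen G ^ (p ℕ.^ 1)       ≈⟨ M.evalAt-frobenius pr 1 gen (All.map fixed′ values) ⟩
      evalAt (gen ^ (p ℕ.^ 1)) G     ≡⟨ ≡.cong (λ w → evalAt w G) (≡.trans (≡.cong (gen ^_) (ℕ.*-identityʳ p)) genᵖ) ⟩
      evalAt (gen ^ t) G             ≡⟨ Gᵗ≡ωG ⟩
      ω • G                          ∎
      where
      open import Relation.Binary.Reasoning.Setoid Q.setoid
      fixed′ : ∀ {a} → a A.^ suc e ≡ a → ι a ^ (p ℕ.^ 1) ≈ₘ ι a
      fixed′ {a} aᵉ = Q.reflexive (≡.trans (≡.cong (ι a ^_) (ℕ.*-identityʳ p)) (≡.trans (M.ι-^ a p) (≡.cong ι (fixed aᵉ))))

    Gᵖ≡JᵏG : G ^ p ≡ (J A.^ k) • G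
    Gᵖ≡JᵏG = ≡.trans (≡.cong (G ^_) p≡dk) (iterate k)
      where
      open ≡.≡-Reasoning
      iterate : ∀ k → G ^ suc (d ℕ.* k) ≡ (J A.^ k) • G
      iterate zero    = begin
        G ^ suc (d ℕ.* 0)  ≡⟨ ≡.cong (λ j → G ^ suc j) (ℕ.*-zeroʳ d) ⟩
        G ⊗ 1V             ≡⟨ ⊗-identityʳ G ⟩
        G                  ≡⟨ •-identity G ⟨
        1# • G             ∎
      iterate (suc k) = begin
        G ^ suc (d ℕ.* suc k)             ≡⟨ ≡.cong (λ j → G ^ j) (≡.cong suc (≡.trans (ℕ.*-suc d k) (ℕ.+-comm d (d ℕ.* k)))) ⟩
        G ^ (suc (d ℕ.* k) ℕ.+ d)         ≡⟨ V.^-homo-* G (suc (d ℕ.* k)) d ⟩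
        G ^ suc (d ℕ.* k) ⊗ G ^ d         ≡⟨ ≡.cong (_⊗ G ^ d) (iterate k) ⟩
        ((J A.^ k) • G) ⊗ G ^ d           ≡⟨ •-⊗ˡ (J A.^ k) G (G ^ d) ⟩
        (J A.^ k) • G ^ suc d             ≡⟨ ≡.cong ((J A.^ k) •_) Gᵈ⁺¹≡JG ⟩
        (J A.^ k) • (J • G)               ≡⟨ •-assoc (J A.^ k) J G ⟨
        ((J A.^ k) * J) • G               ≡⟨ ≡.cong (_• G) (A.*-comm (J A.^ k) J) ⟩
        (J A.^ suc k) • G                 ∎

    JᵏG≈ωG : (J A.^ k) • G ≈ₘ ω • G
    JᵏG≈ωG = Q.trans (Q.reflexive (≡.sym Gᵖ≡JᵏG)) Gᵖ≈ωG

    coefficient : ∀ a → Vec.lookup (a • G) i ≡ a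
    coefficient a = ≡.trans (Vec.lookup-map i (a *_) G)
      (≡.trans (≡.cong (a *_) G₁≡1) (A.*-identityʳ a))

  private
    square : V → V
    square x = x ⊗ x

    power[3*2^_] : ℕ → V → V
    power[3*2^ zero  ] x = x ⊗ (x ⊗ x)
    power[3*2^ suc j ] x = square (power[3*2^ j ] x)

    -- The exponents d + 1 in use are 3 and 12, so one cubing followed by j squarings computes the
    -- power.
    power[3*2^]-correct : ∀ j x → power[3*2^ j ] x ≡ x ^ (3 ℕ.* 2 ℕ.^ j)
    power[3*2^]-correct zero    x = ≡.cong (λ y → x ⊗ (x ⊗ y)) (≡.sym (⊗-identityʳ x))
    power[3*2^]-correct (suc j) x = begin
      square (power[3*2^ j ] x)                            ≡⟨ ≡.cong square (power[3*2^]-correct j x) ⟩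
      x ^ (3 ℕ.* 2 ℕ.^ j) ⊗ x ^ (3 ℕ.* 2 ℕ.^ j)            ≡⟨ V.^-homo-* x (3 ℕ.* 2 ℕ.^ j) (3 ℕ.* 2 ℕ.^ j) ⟨
      x ^ (3 ℕ.* 2 ℕ.^ j ℕ.+ 3 ℕ.* 2 ℕ.^ j)                ≡⟨ ≡.cong (x ^_) (double (2 ℕ.^ j)) ⟩
      x ^ (3 ℕ.* (2 ℕ.* 2 ℕ.^ j))                          ∎
      where
      open ≡.≡-Reasoning
      open import Data.Nat.Solver using (module +-*-Solver)
      open +-*-Solver
      double : ∀ n → 3 ℕ.* n ℕ.+ 3 ℕ.* n ≡ 3 ℕ.* (2 ℕ.* n)
      double = solve 1 (λ n → con 3 :* n :+ con 3 :* n := con 3 :* (con 2 :* n)) ≡.refl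

  -- The hypotheses as Boolean computations: each is evaluated in a single run, whereas
  -- unfolding both sides of an equation between closed elements of V loses all sharing.
  module Decided (_≟_ : DecidableEquality A) (G : V) (J ω : A) (i : Fin (suc n)) (d e s t j : ℕ) where

    _≟ⱽ_ : DecidableEquality V
    _≟ⱽ_ = Vec.≡-dec _≟_

    gaussSum-power-by-computation :
      does (shift s 1V ≟ⱽ 1V) ≡ true →
      does (All.all? (λ a → (a A.^ suc e) ≟ a) G) ≡ true →
      does (Vec.lookup G i ≟ 1#) ≡ true →
      suc d ≡ 3 ℕ.* 2 ℕ.^ j →
      does (power[3*2^ j ] G ≟ⱽ (J • G)) ≡ true →
      does (shiftEval t G ≟ⱽ (ω • G)) ≡ true →
      ∀ p k l m → Prime p → p ≡ suc (d ℕ.* k) → p ≡ suc (e ℕ.* l) → p ≡ t ℕ.+ s ℕ.* m →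
      Modulo._≈ₘ_ A.ring p (J A.^ k) ω
    gaussSum-power-by-computation c₁ c₂ c₃ 1+d≡ c₄ c₅ = gaussSum-power G J ω i d e s t
      (≡.trans (≡.sym (⊗-identityʳ (gen ^ s))) (≡.trans (gen^-⊗ s 1V) (by (shift s 1V ≟ⱽ 1V) c₁)))
      (by (All.all? (λ a → (a A.^ suc e) ≟ a) G) c₂)
      (by (Vec.lookup G i ≟ 1#) c₃)
      (≡.trans (≡.cong (G ^_) 1+d≡) (≡.trans (≡.sym (power[3*2^]-correct j G)) (by (power[3*2^ j ] G ≟ⱽ (J • G)) c₄)))
      (≡.trans (evalAt-gen^ t G) (by (shiftEval t G ≟ⱽ (ω • G)) c₅))

-- Numerical data

open import Data.Integer.Base as ℤ using (ℤ; +_; -[1+_])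

ζ¹⁰ᶻ : Vec ℤ 10
ζ¹⁰ᶻ = -[1+ 0 ] ∷ + 1 ∷ -[1+ 0 ] ∷ + 1 ∷ -[1+ 0 ] ∷ + 1 ∷ -[1+ 0 ] ∷ + 1 ∷ -[1+ 0 ] ∷ + 1 ∷ []

module Z = Adjoin ℤ.+-*-isCommutativeRing ζ¹⁰ᶻ

-- The relation y²³ = 1, for the group ring of the cyclic group of order 23.
X²³ : ∀ {A : Set} → A → A → Vec A 23
X²³ 0# 1# = 1# ∷ replicate 22 0#

module GZ = GaussSum Z.isCommutativeRing (X²³ Z.0V Z.1V)
module Gℤ = GaussSum ℤ.+-*-isCommutativeRing (X²³ (+ 0) (+ 1))

infix 4 _≟ᶻ_
_≟ᶻ_ : DecidableEquality Z.V
_≟ᶻ_ = Vec.≡-dec ℤ._≟_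

byᶻ : ∀ {x y} → does (x ≟ᶻ y) ≡ true → x ≡ y
byᶻ {x} {y} = by (x ≟ᶻ y)

ζ^ : ℕ → Z.V
ζ^ k = Z.gen Z.^ k

-- Discrete logarithms of 1, …, 22 modulo 23 to the base 5.
indices : Vec ℕ 22
indices = 0 ∷ 2 ∷ 16 ∷ 4 ∷ 1 ∷ 18 ∷ 19 ∷ 6 ∷ 10 ∷ 3 ∷ 9 ∷ 20 ∷ 14 ∷ 21 ∷ 17 ∷ 8 ∷ 7 ∷ 12 ∷ 15 ∷ 5 ∷ 13 ∷ 11 ∷ []

-- The Gauss sum of the character of order 11 sending 5 to ζ₁₁ = ζ₂₂².
chars : GZ.V
chars = Z.0V ∷ Vec.map (λ k → ζ^ (2 ℕ.* k)) indices

-- The quadratic Gauss sum; its square is - 23 up to the sum of all powers of the generator.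
legendre : Gℤ.V
legendre = + 0 ∷ Vec.map (λ k → -[1+ 0 ] ℤ.^ k) indices

infix 4 _≈ℤ_[_] _≈ᶻ_[_]

_≈ℤ_[_] : ℤ → ℤ → ℕ → Set
x ≈ℤ y [ p ] = Modulo._≈ₘ_ ℤ.+-*-commutativeRing p x y

_≈ᶻ_[_] : Z.V → Z.V → ℕ → Set
x ≈ᶻ y [ p ] = Modulo._≈ₘ_ Z.commutativeRing p x y

-- The value is 1 because 2 ≡ 5² is a square modulo 23: squaring the generator permutes the terms of
-- the Gauss sum without changing a sign.
gauss₂ : ∀ p k l m → ℕ.Prime p → p ≡ suc (2 ℕ.* k) → p ≡ suc (22 ℕ.* l) → p ≡ 2 ℕ.+ 23 ℕ.* m →
  pow ℤ._*_ (+ 1) -[1+ 22 ] k ≈ℤ + 1 [ p ]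
gauss₂ = Gℤ.Decided.gaussSum-power-by-computation ℤ._≟_ legendre -[1+ 22 ] (+ 1) (Fin.suc Fin.zero) 2 22 23 2 0
  ≡.refl ≡.refl ≡.refl ≡.refl ≡.refl ≡.refl

-- Written out, because comparing unevaluated powers during conversion is too slow.
ζ³ ζ⁴ ζ⁵ ζ⁷ ζ⁹ ζ¹² ζ¹⁸ ζ²¹ ζ¹⁵ ζ¹⁹ : Z.V
ζ³ = + 0 ∷ + 0 ∷ + 0 ∷ + 1 ∷ + 0 ∷ + 0 ∷ + 0 ∷ + 0 ∷ + 0 ∷ + 0 ∷ []
ζ⁴ = + 0 ∷ + 0 ∷ + 0 ∷ + 0 ∷ + 1 ∷ + 0 ∷ + 0 ∷ + 0 ∷ + 0 ∷ + 0 ∷ []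
ζ⁵ = + 0 ∷ + 0 ∷ + 0 ∷ + 0 ∷ + 0 ∷ + 1 ∷ + 0 ∷ + 0 ∷ + 0 ∷ + 0 ∷ []
ζ⁷ = + 0 ∷ + 0 ∷ + 0 ∷ + 0 ∷ + 0 ∷ + 0 ∷ + 0 ∷ + 1 ∷ + 0 ∷ + 0 ∷ []
ζ⁹ = + 0 ∷ + 0 ∷ + 0 ∷ + 0 ∷ + 0 ∷ + 0 ∷ + 0 ∷ + 0 ∷ + 0 ∷ + 1 ∷ []
ζ¹² = + 0 ∷ -[1+ 0 ] ∷ + 0 ∷ + 0 ∷ + 0 ∷ + 0 ∷ + 0 ∷ + 0 ∷ + 0 ∷ + 0 ∷ []
ζ¹⁸ = + 0 ∷ + 0 ∷ + 0 ∷ + 0 ∷ + 0 ∷ + 0 ∷ + 0 ∷ -[1+ 0 ] ∷ + 0 ∷ + 0 ∷ []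
ζ²¹ = + 1 ∷ -[1+ 0 ] ∷ + 1 ∷ -[1+ 0 ] ∷ + 1 ∷ -[1+ 0 ] ∷ + 1 ∷ -[1+ 0 ] ∷ + 1 ∷ -[1+ 0 ] ∷ []
ζ¹⁵ = + 0 ∷ + 0 ∷ + 0 ∷ + 0 ∷ -[1+ 0 ] ∷ + 0 ∷ + 0 ∷ + 0 ∷ + 0 ∷ + 0 ∷ []
ζ¹⁹ = + 0 ∷ + 0 ∷ + 0 ∷ + 0 ∷ + 0 ∷ + 0 ∷ + 0 ∷ + 0 ∷ -[1+ 0 ] ∷ + 0 ∷ []

-- The coordinates of 23¹¹ α.
bᶻ : Z.V
bᶻ = -[1+ 893927033370887 ] ∷ + 505269262774693 ∷ -[1+ 444483171933096 ] ∷ + 343258179583121 ∷ -[1+ 261185659539595 ] ∷ + 761297574904449 ∷ -[1+ 579178937869894 ] ∷ + 844135701185304 ∷ -[1+ 902963297458672 ] ∷ + 651783749092432 ∷ []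

bar : Z.V → Z.V
bar = Z.evalAt ζ²¹

abstract
  -- The coordinates of the eleventh power of the Gauss sum, up to the sum of all powers of
  -- the generator, which that Gauss sum annihilates.
  J : Z.V
  J = + 6910166 ∷ -[1+ 17250804 ] ∷ + 2390344 ∷ -[1+ 318273 ] ∷ -[1+ 16327354 ] ∷ -[1+ 6383189 ] ∷ -[1+ 3754266 ] ∷ + 3232581 ∷ + 15095751 ∷ + 1940510 ∷ []

  -- Here χ(2) = χ(5)² = ζ₂₂⁴, and squaring the generator multiplies the Gauss sum by χ̄(2) = ζ₂₂¹⁸.
  -- The coefficients are 0 or 11th roots of unity, hence fixed by the 23rd power.
  gauss₁₁ : ∀ p k l m → ℕ.Prime p → p ≡ suc (11 ℕ.* k) → p ≡ suc (22 ℕ.* l) → p ≡ 2 ℕ.+ 23 ℕ.* m →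
    J Z.^ k ≈ᶻ ζ¹⁸ [ p ]
  gauss₁₁ = GZ.Decided.gaussSum-power-by-computation _≟ᶻ_ chars J ζ¹⁸ (Fin.suc Fin.zero) 11 22 23 2 2
    ≡.refl ≡.refl ≡.refl ≡.refl ≡.refl ≡.refl

  -- An opaque copy of `bᶻ`, so that powers of b stay folded outside this block; it is accessible
  -- through the equations below.
  b : Z.V
  b = bᶻ

  b≡bᶻ : b ≡ bᶻ
  b≡bᶻ = ≡.refl

  -- As J J̄ = 23¹¹, the square of J̄ is 23²²/J². The factor ζ₂₂¹² is an 11th root of unity.
  b≡ζ¹²J̄² : b ≡ ζ¹² Z.⊗ (bar J Z.⊗ bar J)
  b≡ζ¹²J̄² = byᶻ ≡.refl

  b⊗b̄ : b Z.⊗ bar b ≡ Z.ι (+ (23 ℕ.^ 22))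
  b⊗b̄ = byᶻ ≡.refl

-- Galois action on ℤ[ζ₂₂]

module EndoSymmetric
  {A : Set} {_+_ _*_ : Op₂ A} { -_ : Op₁ A} {0# 1# : A}
  (isCommRing : IsCommutativeRing _≡_ _+_ _*_ -_ 0# 1#)
  {n : ℕ} (c : Vec A (suc n))
  where

  open Adjoin isCommRing c
  open Symmetric commutativeRing using (esym)

  evalAt-esym : ∀ w → evalAt w c ≡ w ^ suc n →
    ∀ j xs → evalAt w (esym j xs) ≡ esym j (List.map (evalAt w) xs)
  evalAt-esym w root zero    xs       = evalAt-ι w 1#
  evalAt-esym w root (suc j) []       = evalAt-ι w 0#
  evalAt-esym w root (suc j) (x ∷ xs) = ≡.trans (evalAt-⊕ w (x ⊗ esym j xs) (esym (suc j) xs))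
    (≡.cong₂ _⊕_
      (≡.trans (Endo.evalAt-⊗ w root x (esym j xs)) (≡.cong (evalAt w x ⊗_) (evalAt-esym w root j xs)))
      (evalAt-esym w root (suc j) xs))

open EndoSymmetric ℤ.+-*-isCommutativeRing ζ¹⁰ᶻ using (evalAt-esym)

module Zᵖ = Powers Z.commutativeRing
module Zˢ = Symmetric Z.commutativeRing

module σ₃ = Z.Endo ζ³ (byᶻ ≡.refl)
module σ₅ = Z.Endo ζ⁵ (byᶻ ≡.refl)
module σ₇ = Z.Endo ζ⁷ (byᶻ ≡.refl)
module σ₉ = Z.Endo ζ⁹ (byᶻ ≡.refl)
module σ₂₁ = Z.Endo ζ²¹ (byᶻ ≡.refl)

ζ¹³ ζ¹⁷ : Z.V
ζ¹³ = + 0 ∷ + 0 ∷ -[1+ 0 ] ∷ + 0 ∷ + 0 ∷ + 0 ∷ + 0 ∷ + 0 ∷ + 0 ∷ + 0 ∷ []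
ζ¹⁷ = + 0 ∷ + 0 ∷ + 0 ∷ + 0 ∷ + 0 ∷ + 0 ∷ -[1+ 0 ] ∷ + 0 ∷ + 0 ∷ + 0 ∷ []

conjugates : Z.V → List Z.V
conjugates t = t ∷ Z.evalAt ζ³ t ∷ Z.evalAt ζ⁵ t ∷ Z.evalAt ζ⁷ t ∷ Z.evalAt ζ⁹ t ∷ []

bar-involutive : ∀ x → bar (bar x) ≡ x
bar-involutive x = ≡.trans (σ₂₁.compose {u = ζ²¹} {Z.gen} (byᶻ ≡.refl) x) (Z.evalAt-gen x)

module _ (t : Z.V) (real : bar t ≡ t) where

  private
    -- Multiplication by 3 permutes 1, 3, 9, 5, 7 cyclically modulo 22 and up to sign. The exponents
    -- 15 ≡ -7 and 21 ≡ -1 are folded back because t is real.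
    σ₃-conjugates : List.map (Z.evalAt ζ³) (conjugates t) ≡
      Z.evalAt ζ³ t ∷ Z.evalAt ζ⁹ t ∷ Z.evalAt ζ⁷ t ∷ t ∷ Z.evalAt ζ⁵ t ∷ []
    σ₃-conjugates = ≡.cong (Z.evalAt ζ³ t ∷_)
      (≡.cong₂ _∷_ (σ₃.compose {u = ζ³} {ζ⁹} (byᶻ ≡.refl) t)
      (≡.cong₂ _∷_ (≡.trans (σ₃.compose {u = ζ⁵} {ζ¹⁵} (byᶻ ≡.refl) t)
                     (≡.trans (≡.sym (σ₇.compose {u = ζ²¹} {ζ¹⁵} (byᶻ ≡.refl) t)) (≡.cong (Z.evalAt ζ⁷) real)))
      (≡.cong₂ _∷_ (≡.trans (σ₃.compose {u = ζ⁷} {ζ²¹} (byᶻ ≡.refl) t) real)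
      (≡.cong (_∷ []) (σ₃.compose {u = ζ⁹} {ζ⁵} (byᶻ ≡.refl) t)))))

    -- The automorphisms commute, so conjugation can be moved inside, onto t itself.
    bar-conjugates : List.map bar (conjugates t) ≡ conjugates t
    bar-conjugates = ≡.cong₂ _∷_ real
      (≡.cong₂ _∷_ (≡.trans (σ₂₁.compose {u = ζ³} {ζ¹⁹} (byᶻ ≡.refl) t)
                     (≡.trans (≡.sym (σ₃.compose {u = ζ²¹} {ζ¹⁹} (byᶻ ≡.refl) t)) (≡.cong (Z.evalAt ζ³) real)))
      (≡.cong₂ _∷_ (≡.trans (σ₂₁.compose {u = ζ⁵} {ζ¹⁷} (byᶻ ≡.refl) t)
                     (≡.trans (≡.sym (σ₅.compose {u = ζ²¹} {ζ¹⁷} (byᶻ ≡.refl) t)) (≡.cong (Z.evalAt ζ⁵) real)))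
      (≡.cong₂ _∷_ (≡.trans (σ₂₁.compose {u = ζ⁷} {ζ¹⁵} (byᶻ ≡.refl) t)
                     (≡.trans (≡.sym (σ₇.compose {u = ζ²¹} {ζ¹⁵} (byᶻ ≡.refl) t)) (≡.cong (Z.evalAt ζ⁷) real)))
      (≡.cong (_∷ []) (≡.trans (σ₂₁.compose {u = ζ⁹} {ζ¹³} (byᶻ ≡.refl) t)
                     (≡.trans (≡.sym (σ₉.compose {u = ζ²¹} {ζ¹³} (byᶻ ≡.refl) t)) (≡.cong (Z.evalAt ζ⁹) real)))))))

    cycle : ∀ {A : Set} (a b c d e : A) → b ∷ e ∷ d ∷ a ∷ c ∷ [] ↭ a ∷ b ∷ c ∷ d ∷ e ∷ []
    cycle a b c d e =
      Perm.trans (Perm.prep b (Perm.prep e (Perm.swap d a Perm.refl)))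
      (Perm.trans (Perm.prep b (Perm.swap e a Perm.refl))
      (Perm.trans (Perm.swap b a Perm.refl)
      (Perm.prep a (Perm.prep b
        (Perm.trans (Perm.prep e (Perm.swap d c Perm.refl))
        (Perm.trans (Perm.swap e c Perm.refl) (Perm.prep c (Perm.swap e d Perm.refl))))))))

  σ₃-esym : ∀ j → Z.evalAt ζ³ (Zˢ.esym j (conjugates t)) ≡ Zˢ.esym j (conjugates t)
  σ₃-esym j = ≡.trans (evalAt-esym ζ³ (byᶻ ≡.refl) j (conjugates t))
    (≡.trans (≡.cong (Zˢ.esym j) σ₃-conjugates)
      (Zˢ.esym-↭ j (cycle t (Z.evalAt ζ³ t) (Z.evalAt ζ⁵ t) (Z.evalAt ζ⁷ t) (Z.evalAt ζ⁹ t))))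

  bar-esym : ∀ j → bar (Zˢ.esym j (conjugates t)) ≡ Zˢ.esym j (conjugates t)
  bar-esym j = ≡.trans (evalAt-esym ζ²¹ (byᶻ ≡.refl) j (conjugates t)) (≡.cong (Zˢ.esym j) bar-conjugates)

-- Elements fixed by the Galois group are rational

module GenInduction
  {A : Set} {_+_ _*_ : Op₂ A} { -_ : Op₁ A} {0# 1# : A}
  (isCommRing : IsCommutativeRing _≡_ _+_ _*_ -_ 0# 1#)
  {n : ℕ} (c : Vec A (suc n))
  where

  open Adjoin isCommRing c
  private module V = IsCommutativeRing isCommutativeRing
  open ≡.≡-Reasoning

  gen-induction : (P : V → Set) → (∀ {x y} → P x → P y → P (x ⊕ y)) → (∀ a {x} → P x → P (a • x)) →
    (∀ (i : Fin (suc n)) → P (gen ^ toℕ i)) → ∀ x → P x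
  gen-induction P P⊕ P• Pgen x = ≡.subst P
    (≡.trans (V.*-identityˡ (evalAt gen x)) (evalAt-gen x)) (from 0 x ℕ.≤-refl)
    where
    from : ∀ {m} i (v : Vec A m) → i ℕ.+ m ℕ.≤ suc n → P (gen ^ i ⊗ evalAt gen v)
    from i []       _ = ≡.subst P (≡.trans (•-zeroˡ 1V) (≡.sym (V.zeroʳ (gen ^ i)))) (P• 0# (Pgen Fin.zero))
    from i (a ∷ as) i+m≤ = ≡.subst P (≡.sym split)
      (P⊕ (P• a (≡.subst (λ j → P (gen ^ j)) (Fin.toℕ-fromℕ< i<) (Pgen (Fin.fromℕ< i<))))
          (from (suc i) as i+m≤′))
      where
      i+m≤′ = ≡.subst (ℕ._≤ suc n) (ℕ.+-suc i _) i+m≤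
      i< = ℕ.≤-trans (ℕ.s≤s (ℕ.m≤m+n i _)) i+m≤′
      split : gen ^ i ⊗ evalAt gen (a ∷ as) ≡ a • gen ^ i ⊕ gen ^ suc i ⊗ evalAt gen as
      split = begin
        gen ^ i ⊗ (ι a ⊕ gen ⊗ evalAt gen as)
          ≡⟨ V.distribˡ (gen ^ i) (ι a) (gen ⊗ evalAt gen as) ⟩
        gen ^ i ⊗ ι a ⊕ gen ^ i ⊗ (gen ⊗ evalAt gen as)
          ≡⟨ ≡.cong₂ _⊕_ (≡.trans (V.*-comm (gen ^ i) (ι a)) (ι-⊗ a (gen ^ i)))
               (≡.trans (≡.sym (V.*-assoc (gen ^ i) gen (evalAt gen as)))
                 (≡.cong (_⊗ evalAt gen as) (V.*-comm (gen ^ i) gen))) ⟩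
        a • gen ^ i ⊕ gen ^ suc i ⊗ evalAt gen as ∎

open GenInduction ℤ.+-*-isCommutativeRing ζ¹⁰ᶻ using (gen-induction)

module _ where
  open Z using (V; _⊕_; _⊗_; _•_; ι; gen; evalAt)

  Rational : V → Set
  Rational x = Vec.tail x ≡ replicate 9 (+ 0)

  rational-⊕ : ∀ {x y} → Rational x → Rational y → Rational (x ⊕ y)
  rational-⊕ {_ ∷ xs} {_ ∷ ys} x∈ y∈ = ≡.cong₂ (zipWith ℤ._+_) x∈ y∈

  rational-• : ∀ a {x} → Rational x → Rational (a • x)
  rational-• a {_ ∷ xs} x∈ = ≡.trans (≡.cong (Vec.map (a ℤ.*_)) x∈)
    (≡.trans (Vec.map-replicate (a ℤ.*_) (+ 0) 9) (≡.cong (replicate 9) (ℤ.*-zeroʳ a)))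

  -- The sum of σ₃ⁱ(x) over i < 5, nested as in Horner's rule so that one step lemma applied four
  -- times proves each property. Since 3 has order 5 modulo 22 and -1 is not a power of 3, `trace`
  -- runs over all ten automorphisms.
  orbitSum : V → V
  orbitSum x = x ⊕ σ (x ⊕ σ (x ⊕ σ (x ⊕ σ x)))
    where σ = evalAt ζ³

  trace : V → V
  trace x = orbitSum x ⊕ orbitSum (bar x)

  private
    interchange : ∀ w x y z → (w ⊕ x) ⊕ (y ⊕ z) ≡ (w ⊕ y) ⊕ (x ⊕ z)
    interchange = solve 4 (λ w x y z → (w :+ x) :+ (y :+ z) := (w :+ y) :+ (x :+ z)) ≡.refl
      where
      open import Algebra.Bundles using (CommutativeRing)
      open import Algebra.Solver.Ring.NaturalCoefficients.Default
        (CommutativeRing.commutativeSemiring Z.commutativeRing) using (solve; _:=_; _:+_)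

    step-⊕ : ∀ x y {u v w} → u ≡ v ⊕ w → (x ⊕ y) ⊕ evalAt ζ³ u ≡ (x ⊕ evalAt ζ³ v) ⊕ (y ⊕ evalAt ζ³ w)
    step-⊕ x y {v = v} {w} ≡.refl = ≡.trans (≡.cong ((x ⊕ y) ⊕_) (Z.evalAt-⊕ ζ³ v w))
      (interchange x y (evalAt ζ³ v) (evalAt ζ³ w))

    step-• : ∀ a x {u v} → u ≡ a • v → (a • x) ⊕ evalAt ζ³ u ≡ a • (x ⊕ evalAt ζ³ v)
    step-• a x {v = v} ≡.refl = ≡.trans (≡.cong ((a • x) ⊕_) (Z.evalAt-• ζ³ a v))
      (≡.sym (Z.•-distribˡ a x (evalAt ζ³ v)))

  orbitSum-⊕ : ∀ x y → orbitSum (x ⊕ y) ≡ orbitSum x ⊕ orbitSum y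
  orbitSum-⊕ x y = step-⊕ x y (step-⊕ x y (step-⊕ x y (step-⊕ x y {v = x} {y} ≡.refl)))

  orbitSum-• : ∀ a x → orbitSum (a • x) ≡ a • orbitSum x
  orbitSum-• a x = step-• a x (step-• a x (step-• a x (step-• a x {v = x} ≡.refl)))

  trace-⊕ : ∀ x y → trace (x ⊕ y) ≡ trace x ⊕ trace y
  trace-⊕ x y = ≡.trans
    (≡.cong₂ _⊕_ (orbitSum-⊕ x y) (≡.trans (≡.cong orbitSum (Z.evalAt-⊕ ζ²¹ x y)) (orbitSum-⊕ (bar x) (bar y))))
    (interchange (orbitSum x) (orbitSum y) (orbitSum (bar x)) (orbitSum (bar y)))

  trace-• : ∀ a x → trace (a • x) ≡ a • trace x
  trace-• a x = ≡.trans
    (≡.cong₂ _⊕_ (orbitSum-• a x) (≡.trans (≡.cong orbitSum (Z.evalAt-• ζ²¹ a x)) (orbitSum-• a (bar x))))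
    (≡.sym (Z.•-distribˡ a (orbitSum x) (orbitSum (bar x))))

  -- By linearity the ten powers of `gen` forming the basis suffice, and for them the claim is a
  -- closed computation.
  rational-trace : ∀ x → Rational (trace x)
  rational-trace = gen-induction (λ x → Rational (trace x))
    (λ {x} {y} x∈ y∈ → ≡.subst Rational (≡.sym (trace-⊕ x y)) (rational-⊕ {trace x} {trace y} x∈ y∈))
    (λ a {x} x∈ → ≡.subst Rational (≡.sym (trace-• a x)) (rational-• a {trace x} x∈))
    (by (Fin.all? λ i → Vec.≡-dec ℤ._≟_ (Vec.tail (trace (gen Z.^ toℕ i))) (replicate 9 (+ 0))) ≡.refl)

  -- The trace of an invariant x is 10 x, and 10 can be cancelled in ℤ. The symmetric functions are
  -- thereby rational, as `_≡ᴷ_[mod_]` demands.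
  fixed⇒rational : ∀ x → evalAt ζ³ x ≡ x → bar x ≡ x → x ≡ ι (Vec.head x)
  fixed⇒rational x@(x₀ ∷ xs) σx≡x barx≡x = ≡.cong (x₀ ∷_) (cancel xs
    (≡.subst Rational trace≡10• (rational-trace x)))
    where
    open ≡.≡-Reasoning
    cancel : ∀ {m} (v : Vec ℤ m) → Vec.map (+ 10 ℤ.*_) v ≡ replicate m (+ 0) → v ≡ replicate m (+ 0)
    cancel []      _ = ≡.refl
    cancel (z ∷ v) e = ≡.cong₂ _∷_
      (ℤ.*-cancelˡ-≡ (+ 10) z (+ 0) (≡.cong Vec.head e)) (cancel v (≡.cong Vec.tail e))
    suc-• : ∀ k → + (suc k) • x ≡ x ⊕ + k • x
    suc-• k = ≡.trans (Z.•-distribʳ (+ 1) (+ k) x) (≡.cong (_⊕ + k • x) (Z.•-identity x))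
    step : ∀ k {y} → y ≡ + k • x → x ⊕ evalAt ζ³ y ≡ + (suc k) • x
    step k ≡.refl = ≡.trans (≡.cong (x ⊕_) (≡.trans (Z.evalAt-• ζ³ (+ k) x) (≡.cong (+ k •_) σx≡x)))
      (≡.sym (suc-• k))
    orbitSum≡5• : orbitSum x ≡ + 5 • x
    orbitSum≡5• = step 4 (step 3 (step 2 (step 1 (≡.sym (Z.•-identity x)))))
    trace≡10• : trace x ≡ + 10 • x
    trace≡10• = begin
      orbitSum x ⊕ orbitSum (bar x)  ≡⟨ ≡.cong (λ y → orbitSum x ⊕ orbitSum y) barx≡x ⟩
      orbitSum x ⊕ orbitSum x        ≡⟨ ≡.cong₂ _⊕_ orbitSum≡5• orbitSum≡5• ⟩
      + 5 • x ⊕ + 5 • x              ≡⟨ Z.•-distribʳ (+ 5) (+ 5) x ⟨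
      + 10 • x                       ∎

-- Necessity

module ℤᵖ = Powers ℤ.+-*-commutativeRing

t : ℕ → Z.V
t k = b Z.^ (22 ℕ.^ k) Z.⊕ bar b Z.^ (22 ℕ.^ k)

23¹¹ : ℤ
23¹¹ = + (23 ℕ.^ 11)

-- The denominator cleared at level k: `t k` is `D k` times `K.α₁ k`.
D : ℕ → ℤ
D k = 23¹¹ ℤᵖ.^ (22 ℕ.^ k)

bar-t : ∀ k → bar (t k) ≡ t k
bar-t k = begin
  bar (b Z.^ N Z.⊕ bar b Z.^ N)          ≡⟨ Z.evalAt-⊕ ζ²¹ (b Z.^ N) (bar b Z.^ N) ⟩
  bar (b Z.^ N) Z.⊕ bar (bar b Z.^ N)    ≡⟨ ≡.cong₂ Z._⊕_ (σ₂₁.evalAt-^ b N)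
                                             (≡.trans (σ₂₁.evalAt-^ (bar b) N) (≡.cong (Z._^ N) (bar-involutive b))) ⟩
  bar b Z.^ N Z.⊕ b Z.^ N                ≡⟨ +-comm (bar b Z.^ N) (b Z.^ N) ⟩
  b Z.^ N Z.⊕ bar b Z.^ N                ∎
  where
  open ≡.≡-Reasoning
  open CommutativeRing Z.commutativeRing using (+-comm)
  N = 22 ℕ.^ k

value : Fin 5 → ℤ
value i = Vec.lookup (-[1+ 0 ] ∷ -[1+ 3 ] ∷ + 3 ∷ + 3 ∷ -[1+ 0 ] ∷ []) i

-- The j-th symmetric function is homogeneous of degree j, so clearing denominators multiplies the
-- prescribed value by the j-th power of `D k`.
SymmetriesModulo : ℕ → ℕ → Set
SymmetriesModulo p k = ∀ (i : Fin 5) → let j = suc (toℕ i) in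
  Zˢ.esym j (conjugates (t k)) ≈ᶻ Z.ι ((D k ℤᵖ.^ j) ℤ.* value i) [ p ]

-- This is ζ₂₂⁴ + ζ₂₂¹⁸ = ζ₁₁² + ζ₁₁⁻², a conjugate of ζ₁₁ + ζ₁₁⁻¹.
period : Z.V
period = + 0 ∷ + 0 ∷ + 0 ∷ + 0 ∷ + 1 ∷ + 0 ∷ + 0 ∷ -[1+ 0 ] ∷ + 0 ∷ + 0 ∷ []

esym-period : ∀ (i : Fin 5) → Zˢ.esym (suc (toℕ i)) (conjugates period) ≡ Z.ι (value i)
esym-period = by (Fin.all? λ i → Zˢ.esym (suc (toℕ i)) (conjugates period) ≟ᶻ Z.ι (value i)) ≡.refl

-- Here k = r - 2 and N = 22^(r-1), so p - 1 = 22 N: the results on Gauss sums apply with (p - 1)/11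
-- = 2 N and (p - 1)/2 = 11 N.
module Forward (p k m : ℕ) (pr : Prime p)
  (p≡22^ : p ≡ suc (22 ℕ.^ suc (suc k))) (p≡2 : p ≡ 2 ℕ.+ 23 ℕ.* m) where

  private
    N : ℕ
    N = 22 ℕ.^ suc k
    module M = AdjoinModulo ℤ.+-*-isCommutativeRing ζ¹⁰ᶻ p
    open M using (_≈ₘ_)
    module Q = CommutativeRing M.quotient
    module Qᵖ = Powers M.quotient
    module B = CommutativeRing M.B.commutativeRing
    module Bᵖ = Powers M.B.commutativeRing

  J^≈ : J Z.^ (2 ℕ.* N) ≈ᶻ ζ¹⁸ [ p ]
  J^≈ = gauss₁₁ p (2 ℕ.* N) N m pr (≡.trans p≡22^ (≡.cong suc (ℕ.*-assoc 11 2 N))) p≡22^ p≡2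

  private
    bar-≈ : ∀ {x y z} → bar y ≡ z → x ≈ₘ y → bar x ≈ₘ z
    bar-≈ {x} {y} ≡.refl = M.evalAt-≈ₘ ζ²¹ (byᶻ ≡.refl) {x} {y}

    ⊕-≈ : ∀ {x y u v w} → u Z.⊕ v ≡ w → x ≈ₘ u → y ≈ₘ v → x Z.⊕ y ≈ₘ w
    ⊕-≈ ≡.refl = Q.+-cong

    conjugates-≈ : ∀ {x y} → x ≈ₘ y → Pointwise _≈ₘ_ (conjugates x) (conjugates y)
    conjugates-≈ {x} {y} x≈y = x≈y
      ∷ M.evalAt-≈ₘ ζ³ (byᶻ ≡.refl) {x} {y} x≈y
      ∷ M.evalAt-≈ₘ ζ⁵ (byᶻ ≡.refl) {x} {y} x≈y
      ∷ M.evalAt-≈ₘ ζ⁷ (byᶻ ≡.refl) {x} {y} x≈y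
      ∷ M.evalAt-≈ₘ ζ⁹ (byᶻ ≡.refl) {x} {y} x≈y ∷ []

  -- Conjugating `J^≈` turns χ̄(2) into χ(2), and ζ₂₂¹² disappears because 11 divides N.
  b^≈ζ⁴ : b Z.^ N ≈ₘ ζ⁴
  b^≈ζ⁴ = Q.trans (M.lift equation) (bar-≈ {J Z.^ (2 ℕ.* N)} {ζ¹⁸} {ζ⁴} (byᶻ ≡.refl) J^≈)
    where
    open ≡.≡-Reasoning
    ζ¹²-root : ζ¹² Z.^ N ≡ Z.1V
    ζ¹²-root = ≡.trans (≡.cong (ζ¹² Z.^_) (ℕ.*-assoc 11 2 (22 ℕ.^ k))) (Zᵖ.^-root ζ¹² 11 (2 ℕ.* 22 ℕ.^ k) (byᶻ ≡.refl))
    square-power : ∀ x → (x Z.⊗ x) Z.^ N ≡ x Z.^ (2 ℕ.* N)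
    square-power x = ≡.trans (≡.cong (λ y → (x Z.⊗ y) Z.^ N) (≡.sym (Z.⊗-identityʳ x))) (Zᵖ.^-assoc x 2 N)
    equation : b Z.^ N ≡ bar (J Z.^ (2 ℕ.* N))
    equation = begin
      b Z.^ N                                    ≡⟨ ≡.cong (Z._^ N) b≡ζ¹²J̄² ⟩
      (ζ¹² Z.⊗ (bar J Z.⊗ bar J)) Z.^ N          ≡⟨ Zᵖ.^-distrib-* ζ¹² (bar J Z.⊗ bar J) N ⟩
      ζ¹² Z.^ N Z.⊗ (bar J Z.⊗ bar J) Z.^ N      ≡⟨ ≡.cong₂ Z._⊗_ ζ¹²-root (square-power (bar J)) ⟩
      Z.1V Z.⊗ bar J Z.^ (2 ℕ.* N)               ≡⟨ CommutativeRing.*-identityˡ Z.commutativeRing (bar J Z.^ (2 ℕ.* N)) ⟩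
      bar J Z.^ (2 ℕ.* N)                        ≡⟨ σ₂₁.evalAt-^ J (2 ℕ.* N) ⟨
      bar (J Z.^ (2 ℕ.* N))                      ∎

  bar-b^≈ζ¹⁸ : bar b Z.^ N ≈ₘ ζ¹⁸
  bar-b^≈ζ¹⁸ = Q.trans (M.lift (≡.sym (σ₂₁.evalAt-^ b N))) (bar-≈ {b Z.^ N} {ζ⁴} {ζ¹⁸} (byᶻ ≡.refl) b^≈ζ⁴)

  t≈period : t (suc k) ≈ₘ period
  t≈period = ⊕-≈ {b Z.^ N} {bar b Z.^ N} {ζ⁴} {ζ¹⁸} {period} (byᶻ ≡.refl) b^≈ζ⁴ bar-b^≈ζ¹⁸

  -- By `gauss₂`, (-23)^(11 N) is 1 modulo p. As N = 2 h is even, the sign drops out and 23^(11 N)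
  -- remains.
  D≈1 : D (suc k) B.≈ + 1
  D≈1 = B.trans (M.B.lift (≡.sym equation)) (gauss₂ p (11 ℕ.* N) N m pr (≡.trans p≡22^ (≡.cong suc (ℕ.*-assoc 2 11 N))) p≡22^ p≡2)
    where
    open ≡.≡-Reasoning
    h = 11 ℕ.* 22 ℕ.^ k
    N≡2h : N ≡ 2 ℕ.* h
    N≡2h = ℕ.*-assoc 2 11 (22 ℕ.^ k)
    equation : -[1+ 22 ] ℤᵖ.^ (11 ℕ.* N) ≡ D (suc k)
    equation = begin
      -[1+ 22 ] ℤᵖ.^ (11 ℕ.* N)                 ≡⟨ ℤᵖ.^-assoc -[1+ 22 ] 11 N ⟨
      (-[1+ 22 ] ℤᵖ.^ 11) ℤᵖ.^ N                ≡⟨ ≡.cong ((-[1+ 22 ] ℤᵖ.^ 11) ℤᵖ.^_) N≡2h ⟩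
      (-[1+ 22 ] ℤᵖ.^ 11) ℤᵖ.^ (2 ℕ.* h)        ≡⟨ ℤᵖ.^-assoc (-[1+ 22 ] ℤᵖ.^ 11) 2 h ⟨
      ((-[1+ 22 ] ℤᵖ.^ 11) ℤᵖ.^ 2) ℤᵖ.^ h       ≡⟨⟩
      (23¹¹ ℤᵖ.^ 2) ℤᵖ.^ h             ≡⟨ ℤᵖ.^-assoc 23¹¹ 2 h ⟩
      23¹¹ ℤᵖ.^ (2 ℕ.* h)              ≡⟨ ≡.cong (23¹¹ ℤᵖ.^_) N≡2h ⟨
      23¹¹ ℤᵖ.^ N                      ∎

  forward : SymmetriesModulo p (suc k)
  forward i = Q.trans (M.lift (≡.sym (esym-modulo j (conjugates (t (suc k))))))
    (Q.trans (esym-cong j (conjugates-≈ {t (suc k)} {period} t≈period))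
    (Q.trans (M.lift (≡.trans (esym-modulo j (conjugates period)) (esym-period i)))
    (M.ι-≈ₘ (B.sym value≈))))
    where
    j = suc (toℕ i)
    open SymmetricModulo Z.commutativeRing p using (esym-modulo)
    open Symmetric M.quotient using (esym-cong)
    value≈ : (D (suc k) ℤᵖ.^ j) ℤ.* value i B.≈ value i
    value≈ = B.trans (B.*-congʳ {value i} (B.trans (Bᵖ.^-cong j D≈1) (Bᵖ.1^ j))) (B.*-identityˡ (value i))

-- Sufficiency

modulus-ℤ : ∀ n → Modulo.modulus ℤ.+-*-commutativeRing n ≡ + n
modulus-ℤ zero    = ≡.refl
modulus-ℤ (suc n) = ≡.cong (ℤ.suc) (modulus-ℤ n)

module _ (power : ℕ → ℕ) (power-% : ∀ x → power x ≡ power (x % 22))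
  (table : ∀ (i : Fin 22) → 2 ℕ.∣ toℕ i ⊎ 11 ℕ.∣ toℕ i ⊎ power (toℕ i) ≡ 1) where

  power≡1 : ∀ x → ¬ 2 ℕ.∣ x → ¬ 11 ℕ.∣ x → power x ≡ 1
  power≡1 x 2∤x 11∤x = ≡.trans (power-% x) (residue (Fin.fromℕ< (ℕ.m%n<n x 22)) (Fin.toℕ-fromℕ< (ℕ.m%n<n x 22)))
    where
    divisor : ∀ d → d ℕ.∣ 22 → d ℕ.∣ x % 22 → d ℕ.∣ x
    divisor d d∣22 d∣x% = ≡.subst (d ℕ.∣_) (≡.sym (ℕ.m≡m%n+[m/n]*n x 22))
      (ℕ.∣m∣n⇒∣m+n d∣x% (ℕ.∣n⇒∣m*n (x / 22) d∣22))
    residue : ∀ (i : Fin 22) → toℕ i ≡ x % 22 → power (x % 22) ≡ 1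
    residue i i≡ with table i
    ... | inj₁ 2∣i          = contradiction (divisor 2 (divides 11 ≡.refl) (≡.subst (2 ℕ.∣_) i≡ 2∣i)) 2∤x
    ... | inj₂ (inj₁ 11∣i)  = contradiction (divisor 11 (divides 2 ≡.refl) (≡.subst (11 ℕ.∣_) i≡ 11∣i)) 11∤x
    ... | inj₂ (inj₂ e)     = ≡.subst (λ j → power j ≡ 1) i≡ e

^-% : ∀ k x → x ℕ.^ k % 22 ≡ (x % 22) ℕ.^ k % 22
^-% zero    x = ≡.refl
^-% (suc k) x = begin
  x ℕ.* x ℕ.^ k % 22                              ≡⟨ ℕ.%-distribˡ-* x (x ℕ.^ k) 22 ⟩
  (x % 22) ℕ.* (x ℕ.^ k % 22) % 22                ≡⟨ ≡.cong (λ y → (x % 22) ℕ.* y % 22) (^-% k x) ⟩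
  (x % 22) ℕ.* ((x % 22) ℕ.^ k % 22) % 22         ≡⟨ ≡.cong (λ y → y ℕ.* ((x % 22) ℕ.^ k % 22) % 22) (ℕ.m%n%n≡m%n x 22) ⟨
  (x % 22 % 22) ℕ.* ((x % 22) ℕ.^ k % 22) % 22    ≡⟨ ℕ.%-distribˡ-* (x % 22) ((x % 22) ℕ.^ k) 22 ⟨
  (x % 22) ℕ.* (x % 22) ℕ.^ k % 22                ∎
  where open ≡.≡-Reasoning

-- The units modulo 22 form a group of order 10; the residues are checked one by one. Consequently
-- the q¹⁰-th power fixes ζ₂₂.
q^10%22 : ∀ q → ¬ 2 ℕ.∣ q → ¬ 11 ℕ.∣ q → q ℕ.^ 10 % 22 ≡ 1
q^10%22 = power≡1 (λ x → x ℕ.^ 10 % 22) (^-% 10)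
  (by (Fin.all? λ i → (2 ℕ.∣? toℕ i) ⊎-dec ((11 ℕ.∣? toℕ i) ⊎-dec (toℕ i ℕ.^ 10 % 22 ℕ.≟ 1))) ≡.refl)

^-periodic : ∀ x s l n → x Z.^ s ≡ Z.1V → n ≡ suc (s ℕ.* l) → x Z.^ n ≡ x
^-periodic x s l n xˢ≡1 ≡.refl = ≡.trans (≡.cong (x Z.⊗_) (Zᵖ.^-root x s l xˢ≡1)) (Z.⊗-identityʳ x)

module Reverse (q k : ℕ) (pr : Prime q) (2∤q : ¬ 2 ℕ.∣ q) (11∤q : ¬ 11 ℕ.∣ q)
  (e : ℤ) (e·23≈1 : + 23 ℤ.* e ≈ℤ + 1 [ q ]) (symmetries : SymmetriesModulo q k) where

  private
    N : ℕ
    N = 22 ℕ.^ k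
    module M = AdjoinModulo ℤ.+-*-isCommutativeRing ζ¹⁰ᶻ q
    open M using (_≈ₘ_)
    module Q = CommutativeRing M.quotient
    module Qᵖ = Powers M.quotient
    module B = CommutativeRing M.B.commutativeRing
    module Bᵖ = Powers M.B.commutativeRing
    open import Algebra.Definitions.RawMonoid Q.+-rawMonoid using (_×′_)
    open Symmetric M.quotient using (esym; esym-cong; esym-scale; HasPeriodSymmetries; 11^∣exponent)
    open SymmetricModulo Z.commutativeRing q using (esym-modulo)
    P : ℕ
    P = q ℕ.^ 10

  private
    ×′1≡ι : ∀ n → n ×′ Q.1# ≡ Z.ι (+ n)
    ×′1≡ι zero          = ≡.refl
    ×′1≡ι (suc zero)    = ≡.refl
    ×′1≡ι (suc (suc n)) = ≡.trans (≡.cong (Z._⊕ Z.1V) (×′1≡ι (suc n)))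
      (≡.trans (≡.sym (Z.ι-homo-+ (+ suc n) (+ 1))) (≡.cong (λ m → Z.ι (+ m)) (ℕ.+-comm (suc n) 1)))

    ι≈0⇒∣ : ∀ {n} → Z.ι (+ n) ≈ₘ Z.0V → q ℕ.∣ n
    ι≈0⇒∣ {n} ι≈0 = divides ℤ.∣ z ∣ (begin
      n                                ≡⟨ ≡.cong ℤ.∣_∣ equation ⟩
      ℤ.∣ + 0 ℤ.+ M.B.modulus ℤ.* z ∣  ≡⟨ ≡.cong ℤ.∣_∣ (ℤ.+-identityˡ (M.B.modulus ℤ.* z)) ⟩
      ℤ.∣ M.B.modulus ℤ.* z ∣          ≡⟨ ≡.cong (λ m → ℤ.∣ m ℤ.* z ∣) (modulus-ℤ q) ⟩
      ℤ.∣ + q ℤ.* z ∣                  ≡⟨ ℤ.abs-* (+ q) z ⟩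
      q ℕ.* ℤ.∣ z ∣                    ≡⟨ ℕ.*-comm q ℤ.∣ z ∣ ⟩
      ℤ.∣ z ∣ ℕ.* q                    ∎)
      where
      open ≡.≡-Reasoning
      open M.B._≈ₘ_ (M.≈ₘ-lookup Fin.zero ι≈0) renaming (factor to z)

  11≉0 : ¬ 11 ×′ Q.1# ≈ₘ Q.0#
  11≉0 11≈0 = case (ℕ.prime⇒irreducible prime[11] (ι≈0⇒∣ {11} (≡.subst (_≈ₘ Z.0V) (×′1≡ι 11) 11≈0)))
    where
    case : q ≡ 1 ⊎ q ≡ 11 → _
    case (inj₁ ≡.refl) = ℕ.¬prime[1] pr
    case (inj₂ ≡.refl) = 11∤q ℕ.∣-refl

  private
    -- An inverse of 23¹¹ modulo q, so that f b represents α there.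
    f : ℤ
    f = e ℤᵖ.^ 11

    f23¹¹≈1 : f ℤ.* 23¹¹ B.≈ + 1
    f23¹¹≈1 = B.trans {j = (+ 23 ℤ.* e) ℤᵖ.^ 11} (M.B.lift (begin
      f ℤ.* 23¹¹                  ≡⟨ ℤ.*-comm f 23¹¹ ⟩
      (+ 23) ℤᵖ.^ 11 ℤ.* e ℤᵖ.^ 11  ≡⟨ ℤᵖ.^-distrib-* (+ 23) e 11 ⟨
      (+ 23 ℤ.* e) ℤᵖ.^ 11        ∎))
      (B.trans (Bᵖ.^-cong 11 e·23≈1) (Bᵖ.1^ 11))
      where open ≡.≡-Reasoning

    E : ℤ
    E = f ℤᵖ.^ N

    ED≈1 : E ℤ.* D k B.≈ + 1
    ED≈1 = B.trans (M.B.lift (≡.sym (ℤᵖ.^-distrib-* f 23¹¹ N))) (B.trans (Bᵖ.^-cong N f23¹¹≈1) (Bᵖ.1^ N))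

  -- Fermat's little theorem iterated ten times, by induction on n from the additivity of the power
  -- map.
  fermat-+ : ∀ n → Z.ι (+ n) Z.^ P ≈ₘ Z.ι (+ n)
  fermat-+ zero    = M.0^ pr P (M.0<p^ pr 10)
  fermat-+ (suc n) = Q.trans (M.frobenius-+-^ pr 10 Z.1V (Z.ι (+ n))) (Q.+-cong (Qᵖ.1^ P) (fermat-+ n))

  fermat : ∀ z → Z.ι z Z.^ P ≈ₘ Z.ι z
  fermat (+ n)     = fermat-+ n
  fermat -[1+ n ]  = +-cancelˡ (Z.ι (+ suc n)) (Z.ι -[1+ n ] Z.^ P) (Z.ι -[1+ n ]) (begin
    Z.ι (+ suc n) Z.⊕ Z.ι -[1+ n ] Z.^ P          ≈⟨ Q.+-congʳ {Z.ι -[1+ n ] Z.^ P} (fermat-+ (suc n)) ⟨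
    Z.ι (+ suc n) Z.^ P Z.⊕ Z.ι -[1+ n ] Z.^ P    ≈⟨ M.frobenius-+-^ pr 10 (Z.ι (+ suc n)) (Z.ι -[1+ n ]) ⟨
    (Z.ι (+ suc n) Z.⊕ Z.ι -[1+ n ]) Z.^ P        ≡⟨ ≡.cong (Z._^ P) opposite ⟩
    Z.0V Z.^ P                                    ≈⟨ M.0^ pr P (M.0<p^ pr 10) ⟩
    Z.0V                                          ≡⟨ opposite ⟨
    Z.ι (+ suc n) Z.⊕ Z.ι -[1+ n ]                ∎)
    where
    open import Relation.Binary.Reasoning.Setoid Q.setoid
    open import Algebra.Properties.Group Q.+-group using () renaming (∙-cancelˡ to +-cancelˡ)
    opposite : Z.ι (+ suc n) Z.⊕ Z.ι -[1+ n ] ≡ Z.0V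
    opposite = ≡.trans (≡.sym (Z.ι-homo-+ (+ suc n) -[1+ n ])) (≡.cong Z.ι (ℤ.+-inverseʳ (+ suc n)))

  -- u stands for ι f; as a variable it keeps products from being unfolded.
  module Scaled (u : Z.V) (u≡ιf : u ≡ Z.ι f) where

    a a′ : Z.V
    a  = u Z.⊗ b
    a′ = u Z.⊗ bar b

    -- This is α ᾱ = 1 modulo q: by `b⊗b̄` the product is (f · 23¹¹)².
    aa′≈1 : a Z.⊗ a′ ≈ₘ Z.1V
    aa′≈1 = Q.trans (M.lift (begin
      (u Z.⊗ b) Z.⊗ (u Z.⊗ bar b)              ≡⟨ interchange u b u (bar b) ⟩
      (u Z.⊗ u) Z.⊗ (b Z.⊗ bar b)              ≡⟨ ≡.cong₂ Z._⊗_ (≡.trans (≡.cong₂ Z._⊗_ u≡ιf u≡ιf) (≡.sym (Z.ι-homo-* f f))) b⊗b̄ ⟩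
      Z.ι (f ℤ.* f) Z.⊗ Z.ι (23¹¹ ℤ.* 23¹¹)    ≡⟨ Z.ι-homo-* (f ℤ.* f) (23¹¹ ℤ.* 23¹¹) ⟨
      Z.ι ((f ℤ.* f) ℤ.* (23¹¹ ℤ.* 23¹¹))      ≡⟨ ≡.cong Z.ι (interchangeℤ f f 23¹¹ 23¹¹) ⟩
      Z.ι ((f ℤ.* 23¹¹) ℤ.* (f ℤ.* 23¹¹))      ∎))
      (M.ι-≈ₘ (B.*-cong f23¹¹≈1 f23¹¹≈1))
      where
      open ≡.≡-Reasoning
      open import Algebra.Properties.CommutativeSemigroup (CommutativeRing.*-commutativeSemigroup Z.commutativeRing)
        using (interchange)
      open import Algebra.Properties.CommutativeSemigroup ℤ.*-commutativeSemigroup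
        using () renaming (interchange to interchangeℤ)

    s : Z.V
    s = u Z.^ N

    s^≡ι : ∀ j → s Z.^ j ≡ Z.ι (E ℤᵖ.^ j)
    s^≡ι j = ≡.trans (≡.cong (Z._^ j) (≡.trans (≡.cong (Z._^ N) u≡ιf) (M.ι-^ f N))) (M.ι-^ E j)

    scaled-t : a Z.^ N Z.⊕ a′ Z.^ N ≡ s Z.⊗ t k
    scaled-t = ≡.trans (≡.cong₂ Z._⊕_ (Zᵖ.^-distrib-* u b N) (Zᵖ.^-distrib-* u (bar b) N))
      (≡.sym (CommutativeRing.distribˡ Z.commutativeRing s (b Z.^ N) (bar b Z.^ N)))

    others scaled : List Z.V
    others = s Z.⊗ Z.evalAt ζ³ (t k) ∷ s Z.⊗ Z.evalAt ζ⁵ (t k) ∷ s Z.⊗ Z.evalAt ζ⁷ (t k) ∷ s Z.⊗ Z.evalAt ζ⁹ (t k) ∷ []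
    scaled = a Z.^ N Z.⊕ a′ Z.^ N ∷ others

    scaled≡ : scaled ≡ List.map (s Z.⊗_) (conjugates (t k))
    scaled≡ = ≡.cong (_∷ others) scaled-t

    esym-scaled : ∀ (i : Fin 5) → esym (suc (toℕ i)) scaled ≈ₘ Z.ι (value i)
    esym-scaled i = Q.trans (M.lift (≡.cong (esym j) scaled≡))
      (Q.trans (esym-scale s j (conjugates (t k)))
      (Q.trans (Q.*-cong {s Z.^ j} {Z.ι (E ℤᵖ.^ j)} (M.lift (s^≡ι j))
        (Q.trans (M.lift (esym-modulo j (conjugates (t k)))) (symmetries i)))
      (Q.trans (M.lift (≡.sym (Z.ι-homo-* (E ℤᵖ.^ j) (D k ℤᵖ.^ j ℤ.* value i))))
      (M.ι-≈ₘ value≈))))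
      where
      j = suc (toℕ i)
      value≈ : E ℤᵖ.^ j ℤ.* (D k ℤᵖ.^ j ℤ.* value i) B.≈ value i
      value≈ = B.trans {j = (E ℤ.* D k) ℤᵖ.^ j ℤ.* value i}
        (M.B.lift (≡.trans (≡.sym (ℤ.*-assoc (E ℤᵖ.^ j) (D k ℤᵖ.^ j) (value i)))
          (≡.cong (ℤ._* value i) (≡.sym (ℤᵖ.^-distrib-* E (D k) j)))))
        (B.trans (B.*-congʳ {value i} (B.trans (Bᵖ.^-cong j ED≈1) (Bᵖ.1^ j))) (B.*-identityˡ (value i)))

    periodSymmetries : HasPeriodSymmetries scaled
    periodSymmetries = record
      -- The sums -1 + 1 and -4 + 4 on the right-hand sides compute to 0.
      { e₁ = Q.+-congʳ {Q.1#} (esym-scaled Fin.zero)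
      ; e₂ = Q.+-congʳ {4 ×′ Q.1#} (esym-scaled (Fin.suc Fin.zero))
      ; e₃ = esym-scaled (Fin.suc (Fin.suc Fin.zero))
      ; e₄ = esym-scaled (Fin.suc (Fin.suc (Fin.suc Fin.zero)))
      ; e₅ = Q.+-congʳ {Q.1#} (esym-scaled (Fin.suc (Fin.suc (Fin.suc (Fin.suc Fin.zero)))))
      }

    -- The coefficients are fixed by Fermat and ζ₂₂ because q¹⁰ ≡ 1 modulo 22, so the tenth power of
    -- Frobenius is the identity.
    a^P≈a : a Z.^ P ≈ₘ a
    a^P≈a = Q.trans (M.lift (≡.cong (Z._^ P) (≡.sym (Z.evalAt-gen a))))
      (Q.trans (M.evalAt-frobenius pr 10 Z.gen (All.universal fermat a))
        (M.lift (≡.trans (≡.cong (λ w → Z.evalAt w a) gen^P) (Z.evalAt-gen a))))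
      where
      gen^P : Z.gen Z.^ P ≡ Z.gen
      gen^P = ^-periodic Z.gen 22 (P / 22) P (byᶻ ≡.refl) (≡.trans (ℕ.m≡m%n+[m/n]*n P 22)
        (≡.cong₂ ℕ._+_ (q^10%22 q 2∤q 11∤q) (ℕ.*-comm (P / 22) 22)))

    11^k∣P-1 : 11 ℕ.^ suc k ℕ.∣ P ℕ.∸ 1
    11^k∣P-1 = 11^∣exponent a a′ k (P ℕ.∸ 1) 11≉0 aa′≈1 a^[P-1]≈1 periodSymmetries
      where
      P≡ : P ≡ suc (P ℕ.∸ 1)
      P≡ = ≡.sym (ℕ.m+[n∸m]≡n (M.0<p^ pr 10))
      a^[P-1]≈1 : a Z.^ (P ℕ.∸ 1) ≈ₘ Z.1V
      a^[P-1]≈1 = begin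
        -- The quotient need not be a domain, so a is cancelled from a^P = a by its inverse a′.
        a Z.^ (P ℕ.∸ 1)                        ≈⟨ Q.*-identityˡ (a Z.^ (P ℕ.∸ 1)) ⟨
        Z.1V Z.⊗ a Z.^ (P ℕ.∸ 1)               ≈⟨ Q.*-congʳ {a Z.^ (P ℕ.∸ 1)} aa′≈1 ⟨
        (a Z.⊗ a′) Z.⊗ a Z.^ (P ℕ.∸ 1)         ≈⟨ Q.*-congʳ {a Z.^ (P ℕ.∸ 1)} (Q.*-comm a a′) ⟩
        (a′ Z.⊗ a) Z.⊗ a Z.^ (P ℕ.∸ 1)         ≈⟨ Q.*-assoc a′ a (a Z.^ (P ℕ.∸ 1)) ⟩
        a′ Z.⊗ a Z.^ suc (P ℕ.∸ 1)             ≡⟨ ≡.cong (λ j → a′ Z.⊗ a Z.^ j) P≡ ⟨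
        a′ Z.⊗ a Z.^ P                         ≈⟨ Q.*-congˡ {a′} a^P≈a ⟩
        a′ Z.⊗ a                               ≈⟨ Q.*-comm a′ a ⟩
        a Z.⊗ a′                               ≈⟨ aa′≈1 ⟩
        Z.1V                                   ∎
        where open import Relation.Binary.Reasoning.Setoid Q.setoid

  reverse : 11 ℕ.^ suc k ℕ.∣ P ℕ.∸ 1
  reverse = Scaled.11^k∣P-1 (Z.ι f) ≡.refl

-- From ℤ[ζ₂₂] to ℚ(ζ₂₂)

open import Defs using (K; ζ¹⁰; ζ₂₂; 0K; 1K; Gal; σ; choose; elemSym; S; _≡ᴷ_[mod_])
import Defs as K

module ℚᵖ = Powers ℚ.+-*-commutativeRing

fromℤ : ℤ → ℚ
fromℤ z = z ℚ./ 1

toℚᵘ-fromℤ : ∀ z → ℚ.toℚᵘ (fromℤ z) ℚᵘ.≃ mkℚᵘ z 0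
toℚᵘ-fromℤ z = ℚ.toℚᵘ-fromℚᵘ (mkℚᵘ z 0)

fromℤ-homo-+ : ∀ x y → fromℤ (x ℤ.+ y) ≡ fromℤ x ℚ.+ fromℤ y
fromℤ-homo-+ x y = ℚ.toℚᵘ-injective (begin
  ℚ.toℚᵘ (fromℤ (x ℤ.+ y))                      ≈⟨ toℚᵘ-fromℤ (x ℤ.+ y) ⟩
  mkℚᵘ (x ℤ.+ y) 0                              ≈⟨ *≡* (≡.cong (ℤ._* + 1) (≡.cong₂ ℤ._+_ (≡.sym (ℤ.*-identityʳ x)) (≡.sym (ℤ.*-identityʳ y)))) ⟩
  mkℚᵘ x 0 ℚᵘ.+ mkℚᵘ y 0                        ≈⟨ ℚᵘ.+-cong (toℚᵘ-fromℤ x) (toℚᵘ-fromℤ y) ⟨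
  ℚ.toℚᵘ (fromℤ x) ℚᵘ.+ ℚ.toℚᵘ (fromℤ y)        ≈⟨ ℚ.toℚᵘ-homo-+ (fromℤ x) (fromℤ y) ⟨
  ℚ.toℚᵘ (fromℤ x ℚ.+ fromℤ y)                  ∎)
  where open import Relation.Binary.Reasoning.Setoid ℚᵘ.≃-setoid

fromℤ-homo-* : ∀ x y → fromℤ (x ℤ.* y) ≡ fromℤ x ℚ.* fromℤ y
fromℤ-homo-* x y = ℚ.toℚᵘ-injective (begin
  ℚ.toℚᵘ (fromℤ (x ℤ.* y))                      ≈⟨ toℚᵘ-fromℤ (x ℤ.* y) ⟩
  mkℚᵘ x 0 ℚᵘ.* mkℚᵘ y 0                        ≈⟨ ℚᵘ.*-cong (toℚᵘ-fromℤ x) (toℚᵘ-fromℤ y) ⟨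
  ℚ.toℚᵘ (fromℤ x) ℚᵘ.* ℚ.toℚᵘ (fromℤ y)        ≈⟨ ℚ.toℚᵘ-homo-* (fromℤ x) (fromℤ y) ⟨
  ℚ.toℚᵘ (fromℤ x ℚ.* fromℤ y)                  ∎)
  where open import Relation.Binary.Reasoning.Setoid ℚᵘ.≃-setoid

fromℤ-homo-^ : ∀ x k → fromℤ (x ℤᵖ.^ k) ≡ fromℤ x ℚᵖ.^ k
fromℤ-homo-^ x zero    = ≡.refl
fromℤ-homo-^ x (suc k) = ≡.trans (fromℤ-homo-* x (x ℤᵖ.^ k)) (≡.cong (fromℤ x ℚ.*_) (fromℤ-homo-^ x k))

private
  interchange : ∀ a b c d → (a ℚ.* b) ℚ.* (c ℚ.* d) ≡ (a ℚ.* c) ℚ.* (b ℚ.* d)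
  interchange = Algebra.Properties.CommutativeSemigroup.interchange (CommutativeRing.*-commutativeSemigroup ℚ.+-*-commutativeRing)
    where import Algebra.Properties.CommutativeSemigroup

scale : ℚ → ℤ → ℚ
scale d z = d ℚ.* fromℤ z

scale-+ : ∀ d x y → scale d x ℚ.+ scale d y ≡ scale d (x ℤ.+ y)
scale-+ d x y = ≡.trans (≡.sym (ℚ.*-distribˡ-+ d (fromℤ x) (fromℤ y))) (≡.cong (d ℚ.*_) (≡.sym (fromℤ-homo-+ x y)))

scale-* : ∀ d e x y → scale d x ℚ.* scale e y ≡ scale (d ℚ.* e) (x ℤ.* y)
scale-* d e x y = ≡.trans (interchange d (fromℤ x) e (fromℤ y)) (≡.cong ((d ℚ.* e) ℚ.*_) (≡.sym (fromℤ-homo-* x y)))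

scale-0 : ∀ d → scale d (+ 0) ≡ 0ℚ
scale-0 = ℚ.*-zeroʳ

-- The elements concerned are a rational scalar times an integral vector. The lemmas on `frac` move
-- the arithmetic of `K` into ℤ[ζ₂₂], while the scalar alone collects the denominators.
frac : ∀ {m} → ℚ → Vec ℤ m → Vec ℚ m
frac d = Vec.map (scale d)

frac-0s : ∀ d m → replicate m 0ℚ ≡ frac d (replicate m (+ 0))
frac-0s d m = ≡.sym (≡.trans (Vec.map-replicate (scale d) (+ 0) m) (≡.cong (replicate m) (scale-0 d)))

frac-zipWith : ∀ {m} d (v w : Vec ℤ m) → zipWith ℚ._+_ (frac d v) (frac d w) ≡ frac d (zipWith ℤ._+_ v w)
frac-zipWith d []       []       = ≡.refl
frac-zipWith d (x ∷ xs) (y ∷ ys) = ≡.cong₂ _∷_ (scale-+ d x y) (frac-zipWith d xs ys)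

frac-+ : ∀ d (v w : Z.V) → frac d v K.+ frac d w ≡ frac d (v Z.⊕ w)
frac-+ = frac-zipWith

frac-map : ∀ {m} d e a (v : Vec ℤ m) → Vec.map (scale d a ℚ.*_) (frac e v) ≡ frac (d ℚ.* e) (Vec.map (a ℤ.*_) v)
frac-map d e a []       = ≡.refl
frac-map d e a (x ∷ xs) = ≡.cong₂ _∷_ (scale-* d e a x) (frac-map d e a xs)

frac-• : ∀ d e a (v : Z.V) → scale d a K.• frac e v ≡ frac (d ℚ.* e) (a Z.• v)
frac-• d e = frac-map d e

frac-ι : ∀ d n → K.ι (scale d n) ≡ frac d (Z.ι n)
frac-ι d n = ≡.cong (scale d n ∷_) (frac-0s d 9)

frac-init : ∀ {m} d (v : Vec ℤ (suc m)) → init (frac d v) ≡ frac d (init v)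
frac-init d (x ∷ [])         = ≡.refl
frac-init d (x ∷ xs@(_ ∷ _)) = ≡.cong (_ ∷_) (frac-init d xs)

frac-last : ∀ {m} d (v : Vec ℤ (suc m)) → last (frac d v) ≡ scale d (last v)
frac-last d (x ∷ [])         = ≡.refl
frac-last d (x ∷ xs@(_ ∷ _)) = frac-last d xs

ζ¹⁰≡frac : ζ¹⁰ ≡ frac 1ℚ ζ¹⁰ᶻ
ζ¹⁰≡frac = ≡.refl

frac-ζ· : ∀ d (v : Z.V) → K.ζ· frac d v ≡ frac d (Z.ζ· v)
frac-ζ· d v = begin
  zipWith ℚ._+_ (0ℚ ∷ init (frac d v)) (last (frac d v) K.• ζ¹⁰)
    ≡⟨ ≡.cong₂ (zipWith ℚ._+_) (≡.cong₂ _∷_ (≡.sym (scale-0 d)) (frac-init d v))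
         (≡.trans (≡.cong₂ K._•_ (frac-last d v) ζ¹⁰≡frac) (≡.trans (frac-• d 1ℚ (last v) ζ¹⁰ᶻ)
           (≡.cong (λ e → frac e (last v Z.• ζ¹⁰ᶻ)) (ℚ.*-identityʳ d)))) ⟩
  zipWith ℚ._+_ (frac d (+ 0 ∷ init v)) (frac d (last v Z.• ζ¹⁰ᶻ))
    ≡⟨ frac-zipWith d (+ 0 ∷ init v) (last v Z.• ζ¹⁰ᶻ) ⟩
  frac d (Z.ζ· v) ∎
  where open ≡.≡-Reasoning

private
  horner : ∀ {m} → Vec ℚ m → K → K
  horner []       y = 0K
  horner (a ∷ as) y = a K.• y K.+ K.ζ· horner as y

  module _ (y : K) where
    top : ∀ a {u v} → u ≡ v → a K.• y K.+ u ≡ a K.• y K.+ v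
    top a = ≡.cong (a K.• y K.+_)

    under : ∀ a {u v} → u ≡ v → K.ζ· (a K.• y K.+ u) ≡ K.ζ· (a K.• y K.+ v)
    under a = ≡.cong (λ u → K.ζ· (a K.• y K.+ u))

  -- The local function in the definition of _*_ has no name outside Defs. It is reached by
  -- unification one level at a time; comparing all levels at once takes exponential time.
  *≡horner : ∀ x y → x K.* y ≡ horner x y
  *≡horner (a₀ ∷ a₁ ∷ a₂ ∷ a₃ ∷ a₄ ∷ a₅ ∷ a₆ ∷ a₇ ∷ a₈ ∷ a₉ ∷ []) y =
    top y a₀ (under y a₁ (under y a₂ (under y a₃ (under y a₄ (under y a₅ (under y a₆
      (under y a₇ (under y a₈ (under y a₉ ≡.refl)))))))))

  horner-frac : ∀ {m} d e (v : Vec ℤ m) (w : Z.V) → horner (frac d v) (frac e w) ≡ frac (d ℚ.* e) (Z.horner v w)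
  horner-frac d e []       w = frac-0s (d ℚ.* e) 10
  horner-frac d e (a ∷ as) w = begin
    scale d a K.• frac e w K.+ K.ζ· horner (frac d as) (frac e w)
      ≡⟨ ≡.cong₂ K._+_ (frac-• d e a w)
           (≡.trans (≡.cong K.ζ·_ (horner-frac d e as w)) (frac-ζ· (d ℚ.* e) (Z.horner as w))) ⟩
    frac (d ℚ.* e) (a Z.• w) K.+ frac (d ℚ.* e) (Z.ζ· Z.horner as w)
      ≡⟨ frac-+ (d ℚ.* e) (a Z.• w) (Z.ζ· Z.horner as w) ⟩
    frac (d ℚ.* e) (Z.horner (a ∷ as) w) ∎
    where open ≡.≡-Reasoning

frac-* : ∀ d e (v w : Z.V) → frac d v K.* frac e w ≡ frac (d ℚ.* e) (v Z.⊗ w)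
frac-* d e v w = ≡.trans (*≡horner (frac d v) (frac e w)) (horner-frac d e v w)

1K≡frac : 1K ≡ frac 1ℚ Z.1V
1K≡frac = ≡.refl

frac-^ : ∀ d (v : Z.V) k → frac d v K.^ k ≡ frac (d ℚᵖ.^ k) (v Z.^ k)
frac-^ d v zero    = 1K≡frac
frac-^ d v (suc k) = ≡.trans (≡.cong (frac d v K.*_) (frac-^ d v k)) (frac-* d (d ℚᵖ.^ k) v (v Z.^ k))

frac-evalAt : ∀ {m} d (w : Z.V) (v : Vec ℤ m) → K.evalAt (frac 1ℚ w) (frac d v) ≡ frac d (Z.evalAt w v)
frac-evalAt d w []       = frac-0s d 10
frac-evalAt d w (a ∷ as) = begin
  K.ι (scale d a) K.+ frac 1ℚ w K.* K.evalAt (frac 1ℚ w) (frac d as)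
    ≡⟨ ≡.cong₂ K._+_ (frac-ι d a) (≡.trans (≡.cong (frac 1ℚ w K.*_) (frac-evalAt d w as))
         (≡.trans (frac-* 1ℚ d w (Z.evalAt w as)) (≡.cong (λ e → frac e (w Z.⊗ Z.evalAt w as)) (ℚ.*-identityˡ d)))) ⟩
  frac d (Z.ι a) K.+ frac d (w Z.⊗ Z.evalAt w as)
    ≡⟨ frac-+ d (Z.ι a) (w Z.⊗ Z.evalAt w as) ⟩
  frac d (Z.evalAt w (a ∷ as)) ∎
  where open ≡.≡-Reasoning

ζ₂₂≡frac : ζ₂₂ ≡ frac 1ℚ Z.gen
ζ₂₂≡frac = ≡.trans (≡.cong K.ζ·_ 1K≡frac) (frac-ζ· 1ℚ Z.1V)

frac-1^ : ∀ v k → frac 1ℚ v K.^ k ≡ frac 1ℚ (v Z.^ k)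
frac-1^ v k = ≡.trans (frac-^ 1ℚ v k) (≡.cong (λ d → frac d (v Z.^ k)) (ℚᵖ.1^ k))

-- The power of ζ₂₂ is passed as `w`, so that it can be one of the literal vectors.
frac-σ : ∀ d s {w} v → Z.gen Z.^ (Gal.exponent s ℤ.%ℕ 22) ≡ w → s K.⟨ frac d v ⟩ ≡ frac d (Z.evalAt w v)
frac-σ d s v ≡.refl = ≡.trans
  (≡.cong (λ z → K.evalAt z (frac d v)) (≡.trans (≡.cong (K._^ c) ζ₂₂≡frac) (frac-1^ Z.gen c)))
  (frac-evalAt d (Z.gen Z.^ c) v)
  where c = Gal.exponent s ℤ.%ℕ 22

private
  productᶻ sumᶻ : List Z.V → Z.V
  productᶻ = List.foldr Z._⊗_ Z.1V
  sumᶻ     = List.foldr Z._⊕_ Z.0V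

choose-map : ∀ {A B : Set} (f : A → B) j xs → choose j (List.map f xs) ≡ List.map (List.map f) (choose j xs)
choose-map f zero    xs       = ≡.refl
choose-map f (suc j) []       = ≡.refl
choose-map f (suc j) (x ∷ xs) = begin
  List.map (f x ∷_) (choose j (List.map f xs)) List.++ choose (suc j) (List.map f xs)
    ≡⟨ ≡.cong₂ (λ u v → List.map (f x ∷_) u List.++ v) (choose-map f j xs) (choose-map f (suc j) xs) ⟩
  List.map (f x ∷_) (List.map (List.map f) (choose j xs)) List.++ List.map (List.map f) (choose (suc j) xs)
    ≡⟨ ≡.cong (List._++ List.map (List.map f) (choose (suc j) xs))
         (≡.trans (≡.sym (List.map-∘ (choose j xs))) (List.map-∘ (choose j xs))) ⟩
  List.map (List.map f) (List.map (x ∷_) (choose j xs)) List.++ List.map (List.map f) (choose (suc j) xs)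
    ≡⟨ List.map-++ (List.map f) (List.map (x ∷_) (choose j xs)) (choose (suc j) xs) ⟨
  List.map (List.map f) (choose (suc j) (x ∷ xs)) ∎
  where open ≡.≡-Reasoning

-- It ensures that all products summed in `frac-sum` carry the same scalar dʲ.
choose-length : ∀ {A : Set} j (xs : List A) → ListAll.All (λ ys → List.length ys ≡ j) (choose j xs)
choose-length zero    xs       = ≡.refl ∷ []
choose-length (suc j) []       = []
choose-length (suc j) (x ∷ xs) = ListAll.++⁺ (ListAll.map⁺ (ListAll.map (≡.cong suc) (choose-length j xs))) (choose-length (suc j) xs)

frac-product : ∀ d ys → K.product (List.map (frac d) ys) ≡ frac (d ℚᵖ.^ List.length ys) (productᶻ ys)
frac-product d []       = 1K≡frac
frac-product d (y ∷ ys) = ≡.trans (≡.cong (frac d y K.*_) (frac-product d ys))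
  (frac-* d (d ℚᵖ.^ List.length ys) y (productᶻ ys))

frac-sum : ∀ d j {ls} → ListAll.All (λ ys → List.length ys ≡ j) ls →
  K.sum (List.map K.product (List.map (List.map (frac d)) ls)) ≡ frac (d ℚᵖ.^ j) (sumᶻ (List.map productᶻ ls))
frac-sum d j []                              = frac-0s (d ℚᵖ.^ j) 10
frac-sum d j {l ∷ ls} (≡.refl ∷ ps) = ≡.trans
  (≡.cong₂ K._+_ (frac-product d l) (frac-sum d j ps))
  (frac-+ (d ℚᵖ.^ j) (productᶻ l) (sumᶻ (List.map productᶻ ls)))

-- Whether or not the first entry is picked gives the two summands in the recursion of `esym`.
sum-choose : ∀ j xs → sumᶻ (List.map productᶻ (choose j xs)) ≡ Zˢ.esym j xs
sum-choose zero    xs       = R.+-identityʳ Z.1V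
  where module R = CommutativeRing Z.commutativeRing
sum-choose (suc j) []       = ≡.refl
sum-choose (suc j) (x ∷ xs) = begin
  sumᶻ (List.map productᶻ (List.map (x ∷_) (choose j xs) List.++ choose (suc j) xs))
    ≡⟨ ≡.cong sumᶻ (List.map-++ productᶻ (List.map (x ∷_) (choose j xs)) (choose (suc j) xs)) ⟩
  sumᶻ (List.map productᶻ (List.map (x ∷_) (choose j xs)) List.++ List.map productᶻ (choose (suc j) xs))
    ≡⟨ sum-prepend (choose j xs) (List.map productᶻ (choose (suc j) xs)) ⟩
  x Z.⊗ sumᶻ (List.map productᶻ (choose j xs)) Z.⊕ sumᶻ (List.map productᶻ (choose (suc j) xs))
    ≡⟨ ≡.cong₂ (λ u v → x Z.⊗ u Z.⊕ v) (sum-choose j xs) (sum-choose (suc j) xs) ⟩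
  x Z.⊗ Zˢ.esym j xs Z.⊕ Zˢ.esym (suc j) xs ∎
  where
  open ≡.≡-Reasoning
  module R = CommutativeRing Z.commutativeRing
  sum-prepend : ∀ ls ms → sumᶻ (List.map productᶻ (List.map (x ∷_) ls) List.++ ms) ≡
    x Z.⊗ sumᶻ (List.map productᶻ ls) Z.⊕ sumᶻ ms
  sum-prepend []       ms = ≡.sym (≡.trans (≡.cong (Z._⊕ sumᶻ ms) (R.zeroʳ x)) (R.+-identityˡ (sumᶻ ms)))
  sum-prepend (l ∷ ls) ms = begin
    x Z.⊗ productᶻ l Z.⊕ sumᶻ (List.map productᶻ (List.map (x ∷_) ls) List.++ ms)
      ≡⟨ ≡.cong (x Z.⊗ productᶻ l Z.⊕_) (sum-prepend ls ms) ⟩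
    x Z.⊗ productᶻ l Z.⊕ (x Z.⊗ sumᶻ (List.map productᶻ ls) Z.⊕ sumᶻ ms)
      ≡⟨ R.+-assoc (x Z.⊗ productᶻ l) (x Z.⊗ sumᶻ (List.map productᶻ ls)) (sumᶻ ms) ⟨
    (x Z.⊗ productᶻ l Z.⊕ x Z.⊗ sumᶻ (List.map productᶻ ls)) Z.⊕ sumᶻ ms
      ≡⟨ ≡.cong (Z._⊕ sumᶻ ms) (R.distribˡ x (productᶻ l) (sumᶻ (List.map productᶻ ls))) ⟨
    x Z.⊗ sumᶻ (List.map productᶻ (l ∷ ls)) Z.⊕ sumᶻ ms ∎

frac-elemSym : ∀ d j xs → elemSym j (List.map (frac d) xs) ≡ frac (d ℚᵖ.^ j) (Zˢ.esym j xs)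
frac-elemSym d j xs = begin
  K.sum (List.map K.product (choose j (List.map (frac d) xs)))
    ≡⟨ ≡.cong (λ ls → K.sum (List.map K.product ls)) (choose-map (frac d) j xs) ⟩
  K.sum (List.map K.product (List.map (List.map (frac d)) (choose j xs)))
    ≡⟨ frac-sum d j (choose-length j xs) ⟩
  frac (d ℚᵖ.^ j) (sumᶻ (List.map productᶻ (choose j xs)))
    ≡⟨ ≡.cong (frac (d ℚᵖ.^ j)) (sum-choose j xs) ⟩
  frac (d ℚᵖ.^ j) (Zˢ.esym j xs) ∎
  where open ≡.≡-Reasoning

frac-bar : ∀ d v → K.bar (frac d v) ≡ frac d (bar v)
frac-bar d v = frac-σ d (σ (ℤ.- + 1)) {ζ²¹} v (byᶻ ≡.refl)

byᴷ : ∀ {x y : K} → does (Vec.≡-dec ℚ._≟_ x y) ≡ true → x ≡ y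
byᴷ {x} {y} = by (Vec.≡-dec ℚ._≟_ x y)

abstract
  δ : ℚ
  δ = + 1 ℚ./ (23 ℕ.^ 11)

  δ-unit : δ ℚ.* fromℤ 23¹¹ ≡ 1ℚ
  δ-unit = by (δ ℚ.* fromℤ 23¹¹ ℚ.≟ 1ℚ) ≡.refl

  -- The one evaluation of `K.α` itself, with its inverse and its exponent `τ`, by rational
  -- arithmetic on ten coordinates.
  α≡fracᶻ : K.α ≡ frac δ bᶻ
  α≡fracᶻ = byᴷ ≡.refl

α≡frac : K.α ≡ frac δ b
α≡frac = ≡.trans α≡fracᶻ (≡.cong (frac δ) (≡.sym b≡bᶻ))

-- A variable `x` stands for `K.α`, which thus stays folded.
frac-α₁ : ∀ x d v N → x ≡ frac d v → x K.^ N K.+ K.bar x K.^ N ≡ frac (d ℚᵖ.^ N) (v Z.^ N Z.⊕ bar v Z.^ N)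
frac-α₁ _ d v N ≡.refl = ≡.trans
  (≡.cong₂ K._+_ (frac-^ d v N) (≡.trans (≡.cong (K._^ N) (frac-bar d v)) (frac-^ d (bar v) N)))
  (frac-+ (d ℚᵖ.^ N) (v Z.^ N) (bar v Z.^ N))

frac-αs : ∀ x d v → x ≡ frac d v →
  x ∷ List.map (K._⟨ x ⟩) (σ (+ 3) ∷ σ (+ 5) ∷ σ (+ 7) ∷ σ (+ 9) ∷ []) ≡ List.map (frac d) (conjugates v)
frac-αs _ d v ≡.refl = ≡.cong (frac d v ∷_)
  (≡.cong₂ _∷_ (frac-σ d (σ (+ 3)) {ζ³} v (byᶻ ≡.refl))
  (≡.cong₂ _∷_ (frac-σ d (σ (+ 5)) {ζ⁵} v (byᶻ ≡.refl))
  (≡.cong₂ _∷_ (frac-σ d (σ (+ 7)) {ζ⁷} v (byᶻ ≡.refl))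
  (≡.cong (_∷ []) (frac-σ d (σ (+ 9)) {ζ⁹} v (byᶻ ≡.refl))))))

δ^ : ℕ → ℚ
δ^ k = δ ℚᵖ.^ (22 ℕ.^ k)

S≡frac : ∀ k j → K.S k j ≡ frac (δ^ k ℚᵖ.^ j) (Zˢ.esym j (conjugates (t k)))
S≡frac k j = ≡.trans
  (≡.cong (elemSym j) (frac-αs (K.α₁ k) (δ^ k) (t k) (frac-α₁ K.α δ b (22 ℕ.^ k) α≡frac)))
  (frac-elemSym (δ^ k) j (conjugates (t k)))

δ^-unit : ∀ k j → δ^ k ℚᵖ.^ j ℚ.* fromℤ (D k ℤᵖ.^ j) ≡ 1ℚ
δ^-unit k j = begin
  δ^ k ℚᵖ.^ j ℚ.* fromℤ (D k ℤᵖ.^ j)    ≡⟨ ≡.cong (δ^ k ℚᵖ.^ j ℚ.*_) (fromℤ-homo-^ (D k) j) ⟩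
  δ^ k ℚᵖ.^ j ℚ.* fromℤ (D k) ℚᵖ.^ j    ≡⟨ ℚᵖ.^-distrib-* (δ^ k) (fromℤ (D k)) j ⟨
  (δ^ k ℚ.* fromℤ (D k)) ℚᵖ.^ j         ≡⟨ ≡.cong (λ x → (δ^ k ℚ.* x) ℚᵖ.^ j) (fromℤ-homo-^ 23¹¹ (22 ℕ.^ k)) ⟩
  (δ^ k ℚ.* fromℤ 23¹¹ ℚᵖ.^ (22 ℕ.^ k)) ℚᵖ.^ j
    ≡⟨ ≡.cong (ℚᵖ._^ j) (ℚᵖ.^-distrib-* δ (fromℤ 23¹¹) (22 ℕ.^ k)) ⟨
  ((δ ℚ.* fromℤ 23¹¹) ℚᵖ.^ (22 ℕ.^ k)) ℚᵖ.^ j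
    ≡⟨ ≡.cong (λ x → (x ℚᵖ.^ (22 ℕ.^ k)) ℚᵖ.^ j) δ-unit ⟩
  (1ℚ ℚᵖ.^ (22 ℕ.^ k)) ℚᵖ.^ j           ≡⟨ ≡.cong (ℚᵖ._^ j) (ℚᵖ.1^ (22 ℕ.^ k)) ⟩
  1ℚ ℚᵖ.^ j                             ≡⟨ ℚᵖ.1^ j ⟩
  1ℚ                                    ∎
  where open ≡.≡-Reasoning

-- Congruences in ℚ(ζ₂₂) and congruences of integers

fromℤ-injective : ∀ {x y} → fromℤ x ≡ fromℤ y → x ≡ y
fromℤ-injective {x} {y} e with ℚᵘ.≃-trans (ℚᵘ.≃-sym (toℚᵘ-fromℤ x)) (ℚᵘ.≃-trans (ℚᵘ.≃-reflexive (≡.cong ℚ.toℚᵘ e)) (toℚᵘ-fromℤ y))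
... | *≡* eq = ≡.trans (≡.sym (ℤ.*-identityʳ x)) (≡.trans eq (ℤ.*-identityʳ y))

*-fromℤ : ∀ y E z → y ℚ.* fromℤ E ≡ fromℤ z → (↥ y) ℤ.* E ≡ z ℤ.* (↧ y)
*-fromℤ y@(mkℚ n d-1 _) E z e with ℚᵘ.≃-trans (ℚᵘ.≃-sym (ℚᵘ.≃-trans (ℚ.toℚᵘ-homo-* y (fromℤ E)) (ℚᵘ.*-congˡ {ℚ.toℚᵘ y} (toℚᵘ-fromℤ E))))
    (ℚᵘ.≃-trans (ℚᵘ.≃-reflexive (≡.cong ℚ.toℚᵘ e)) (toℚᵘ-fromℤ z))
... | *≡* eq = ≡.trans (≡.sym (ℤ.*-identityʳ (n ℤ.* E)))
  (≡.trans eq (≡.cong (λ d → z ℤ.* + suc d) (ℕ.*-identityʳ d-1)))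

*-denominator : ∀ z → z ℚ.* fromℤ (↧ z) ≡ fromℤ (↥ z)
*-denominator z@(mkℚ n d-1 _) = ℚ.toℚᵘ-injective (begin
  ℚ.toℚᵘ (z ℚ.* fromℤ (↧ z))              ≈⟨ ℚ.toℚᵘ-homo-* z (fromℤ (↧ z)) ⟩
  ℚ.toℚᵘ z ℚᵘ.* ℚ.toℚᵘ (fromℤ (↧ z))      ≈⟨ ℚᵘ.*-congˡ {ℚ.toℚᵘ z} (toℚᵘ-fromℤ (↧ z)) ⟩
  mkℚᵘ n d-1 ℚᵘ.* mkℚᵘ (+ suc d-1) 0      ≈⟨ *≡* (≡.trans (ℤ.*-identityʳ (n ℤ.* + suc d-1)) (≡.cong (λ d → n ℤ.* + suc d) (≡.sym (ℕ.*-identityʳ d-1)))) ⟩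
  mkℚᵘ n 0                                ≈⟨ toℚᵘ-fromℤ n ⟨
  ℚ.toℚᵘ (fromℤ n)                        ∎)
  where open import Relation.Binary.Reasoning.Setoid ℚᵘ.≃-setoid

-- Lowest terms: the denominator divides numerator times E and is coprime to the numerator.
denominator-∣ : ∀ y E z → y ℚ.* fromℤ E ≡ fromℤ z → ↧ₙ y ℕ.∣ ℤ.∣ E ∣
denominator-∣ y@(mkℚ n d-1 c) E z e = ℕ.coprime-divisor (ℕ.sym (ℕ.recompute c))
  (divides ℤ.∣ z ∣ (≡.trans (≡.sym (ℤ.abs-* n E)) (≡.trans (≡.cong ℤ.∣_∣ (*-fromℤ y E z e)) (ℤ.abs-* z (+ suc d-1)))))

module Rearrange {a ℓ} (R : CommutativeSemiring a ℓ) where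
  open CommutativeSemiring R
  open import Algebra.Solver.Ring.NaturalCoefficients.Default R using (solve; _:=_; _:+_; _:*_)

  rearrange : ∀ c m y e d → (c + m * y) * e * d ≈ e * c * d + m * (y * d * e)
  rearrange = solve 5 (λ c m y e d → (c :+ m :* y) :* e :* d := e :* c :* d :+ m :* (y :* d :* e)) refl

open Rearrange (CommutativeRing.commutativeSemiring ℚ.+-*-commutativeRing) using (rearrange)

euclid : ∀ {p m n} → Prime p → p ℕ.∣ m ℕ.* n → ¬ p ℕ.∣ n → p ℕ.∣ m
euclid {m = m} {n} pr p∣mn p∤n with ℕ.euclidsLemma m n pr p∣mn
... | inj₁ p∣m = p∣m
... | inj₂ p∣n = contradiction p∣n p∤n

difference⇒congruent : ∀ x y q → q ℕ.∣ ℤ.∣ x ℤ.- y ∣ → ∃[ z ] x ≡ y ℤ.+ + q ℤ.* z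
difference⇒congruent x y q q∣ with Signed.∣ᵤ⇒∣ {+ q} {x ℤ.- y} q∣
... | Signed.divides z eq = z , (begin
  x                        ≡⟨ ℤ.+-identityʳ x ⟨
  x ℤ.+ + 0                ≡⟨ ≡.cong (λ u → x ℤ.+ u) (ℤ.+-inverseˡ y) ⟨
  x ℤ.+ (ℤ.- y ℤ.+ y)      ≡⟨ ℤ.+-assoc x (ℤ.- y) y ⟨
  (x ℤ.- y) ℤ.+ y          ≡⟨ ≡.cong (ℤ._+ y) eq ⟩
  z ℤ.* + q ℤ.+ y          ≡⟨ ℤ.+-comm (z ℤ.* + q) y ⟩
  y ℤ.+ z ℤ.* + q          ≡⟨ ≡.cong (λ u → y ℤ.+ u) (ℤ.*-comm z (+ q)) ⟩
  y ℤ.+ + q ℤ.* z          ∎)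
  where open ≡.≡-Reasoning

module Bridge (e : ℚ) (E : ℤ) (eE≡1 : e ℚ.* fromℤ E ≡ 1ℚ) where

  private
    scale-E : ∀ z → scale e z ℚ.* fromℤ E ≡ fromℤ z
    scale-E z = begin
      (e ℚ.* fromℤ z) ℚ.* fromℤ E  ≡⟨ ℚ.*-assoc e (fromℤ z) (fromℤ E) ⟩
      e ℚ.* (fromℤ z ℚ.* fromℤ E)  ≡⟨ ≡.cong (e ℚ.*_) (ℚ.*-comm (fromℤ z) (fromℤ E)) ⟩
      e ℚ.* (fromℤ E ℚ.* fromℤ z)  ≡⟨ ℚ.*-assoc e (fromℤ E) (fromℤ z) ⟨
      (e ℚ.* fromℤ E) ℚ.* fromℤ z  ≡⟨ ≡.cong (ℚ._* fromℤ z) eE≡1 ⟩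
      1ℚ ℚ.* fromℤ z               ≡⟨ ℚ.*-identityˡ (fromℤ z) ⟩
      fromℤ z                      ∎
      where open ≡.≡-Reasoning

    scale-E* : ∀ c → scale e (E ℤ.* c) ≡ fromℤ c
    scale-E* c = begin
      e ℚ.* fromℤ (E ℤ.* c)        ≡⟨ ≡.cong (e ℚ.*_) (fromℤ-homo-* E c) ⟩
      e ℚ.* (fromℤ E ℚ.* fromℤ c)  ≡⟨ ℚ.*-assoc e (fromℤ E) (fromℤ c) ⟨
      (e ℚ.* fromℤ E) ℚ.* fromℤ c  ≡⟨ ≡.cong (ℚ._* fromℤ c) eE≡1 ⟩
      1ℚ ℚ.* fromℤ c               ≡⟨ ℚ.*-identityˡ (fromℤ c) ⟩
      fromℤ c                      ∎
      where open ≡.≡-Reasoning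

    cancel : ∀ x y → (x ℚ.+ y) ℚ.- x ≡ y
    cancel x y = ≡.trans (≡.cong (ℚ._- x) (ℚ.+-comm x y)) (≡.trans (ℚ.+-assoc y x (ℚ.- x))
      (≡.trans (≡.cong (y ℚ.+_) (ℚ.+-inverseʳ x)) (ℚ.+-identityʳ y)))

    move : ∀ x y z → x ℚ.- y ≡ z → x ≡ y ℚ.+ z
    move x y z ≡.refl = ≡.sym (≡.trans (≡.cong (y ℚ.+_) (ℚ.+-comm x (ℚ.- y)))
      (≡.trans (≡.sym (ℚ.+-assoc y (ℚ.- y) x)) (≡.trans (≡.cong (ℚ._+ x) (ℚ.+-inverseʳ y)) (ℚ.+-identityˡ x))))

  -- Since e = 1/E, dividing n = E c + M z by E gives c + M (z/E). The denominator of z/E divides E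
  -- and so is prime to M.
  congruent⇒≡ᴷ : ∀ {x} n c z M → ℕ.Coprime ℤ.∣ E ∣ M → n ≡ E ℤ.* c ℤ.+ + M ℤ.* z →
    x ≡ frac e (Z.ι n) → x ≡ᴷ c [mod M ]
  congruent⇒≡ᴷ n c z M coprime n≡ x≡ = scale e n , ≡.trans x≡ (≡.sym (frac-ι e n)) , scale e z ,
    (λ (d∣↧ , d∣M) → coprime (ℕ.∣-trans d∣↧ (denominator-∣ (scale e z) E z (scale-E z)) , d∣M)) , (begin
      scale e n ℚ.- fromℤ c
        ≡⟨ ≡.cong (λ m → scale e m ℚ.- fromℤ c) n≡ ⟩
      scale e (E ℤ.* c ℤ.+ + M ℤ.* z) ℚ.- fromℤ c
        ≡⟨ ≡.cong (ℚ._- fromℤ c) (≡.sym (scale-+ e (E ℤ.* c) (+ M ℤ.* z))) ⟩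
      (scale e (E ℤ.* c) ℚ.+ scale e (+ M ℤ.* z)) ℚ.- fromℤ c
        ≡⟨ ≡.cong (λ y → (y ℚ.+ scale e (+ M ℤ.* z)) ℚ.- fromℤ c) (scale-E* c) ⟩
      (fromℤ c ℚ.+ scale e (+ M ℤ.* z)) ℚ.- fromℤ c
        ≡⟨ cancel (fromℤ c) (scale e (+ M ℤ.* z)) ⟩
      e ℚ.* fromℤ (+ M ℤ.* z)
        ≡⟨ ≡.cong (e ℚ.*_) (fromℤ-homo-* (+ M) z) ⟩
      e ℚ.* (fromℤ (+ M) ℚ.* fromℤ z)
        ≡⟨ ℚ.*-assoc e (fromℤ (+ M)) (fromℤ z) ⟨
      (e ℚ.* fromℤ (+ M)) ℚ.* fromℤ z
        ≡⟨ ≡.cong (ℚ._* fromℤ z) (ℚ.*-comm e (fromℤ (+ M))) ⟩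
      (fromℤ (+ M) ℚ.* e) ℚ.* fromℤ z
        ≡⟨ ℚ.*-assoc (fromℤ (+ M)) e (fromℤ z) ⟩
      fromℤ (+ M) ℚ.* scale e z ∎)
    where open ≡.≡-Reasoning

  -- Multiplying by E and by the denominator d of y shows that q divides (n - E c) d. As d is prime
  -- to M, the prime q does not divide d.
  ≡ᴷ⇒congruent : ∀ {x} v c M q → Prime q → q ℕ.∣ M → x ≡ frac e v → x ≡ᴷ c [mod M ] →
    ∃[ n ] v ≡ Z.ι n × ∃[ z ] n ≡ E ℤ.* c ℤ.+ + q ℤ.* z
  ≡ᴷ⇒congruent (n ∷ ns) c M q pr q∣M@(divides m M≡) x≡frac (p , x≡ιp , y , coprime , p-c≡My) =
    n , ≡.cong (n ∷_) (tail-zero ns (≡.cong Vec.tail frac≡ιp)) , quotient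
    where
    open ≡.≡-Reasoning
    frac≡ιp : frac e (n ∷ ns) ≡ K.ι p
    frac≡ιp = ≡.trans (≡.sym x≡frac) x≡ιp

    -- Rationality of x forces the other nine coordinates to vanish, because e is invertible.
    tail-zero : ∀ {j} (ws : Vec ℤ j) → frac e ws ≡ replicate j 0ℚ → ws ≡ replicate j (+ 0)
    tail-zero []       _  = ≡.refl
    tail-zero (w ∷ ws) eq = ≡.cong₂ _∷_
      (fromℤ-injective (≡.trans (≡.sym (scale-E w)) (≡.trans (≡.cong (ℚ._* fromℤ E) (≡.cong Vec.head eq)) (ℚ.*-zeroˡ (fromℤ E)))))
      (tail-zero ws (≡.cong Vec.tail eq))

    d : ℤ
    d = ↧ y

    cleared : n ℤ.* d ≡ E ℤ.* c ℤ.* d ℤ.+ + M ℤ.* (↥ y ℤ.* E)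
    cleared = fromℤ-injective (begin
      fromℤ (n ℤ.* d)                                   ≡⟨ fromℤ-homo-* n d ⟩
      fromℤ n ℚ.* fromℤ d                               ≡⟨ ≡.cong (ℚ._* fromℤ d) (scale-E n) ⟨
      (scale e n ℚ.* fromℤ E) ℚ.* fromℤ d               ≡⟨ ≡.cong (λ u → (u ℚ.* fromℤ E) ℚ.* fromℤ d)
                                                            (≡.trans (≡.cong Vec.head frac≡ιp) (move p (fromℤ c) _ p-c≡My)) ⟩
      ((fromℤ c ℚ.+ fromℤ (+ M) ℚ.* y) ℚ.* fromℤ E) ℚ.* fromℤ d
        ≡⟨ rearrange (fromℤ c) (fromℤ (+ M)) y (fromℤ E) (fromℤ d) ⟩
      fromℤ E ℚ.* fromℤ c ℚ.* fromℤ d ℚ.+ fromℤ (+ M) ℚ.* (y ℚ.* fromℤ d ℚ.* fromℤ E)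
        ≡⟨ ≡.cong₂ ℚ._+_
             (≡.trans (fromℤ-homo-* (E ℤ.* c) d) (≡.cong (ℚ._* fromℤ d) (fromℤ-homo-* E c)))
             (≡.trans (fromℤ-homo-* (+ M) (↥ y ℤ.* E)) (≡.cong (fromℤ (+ M) ℚ.*_)
               (≡.trans (fromℤ-homo-* (↥ y) E) (≡.cong (ℚ._* fromℤ E) (≡.sym (*-denominator y)))))) ⟨
      fromℤ (E ℤ.* c ℤ.* d) ℚ.+ fromℤ (+ M ℤ.* (↥ y ℤ.* E))
        ≡⟨ fromℤ-homo-+ (E ℤ.* c ℤ.* d) (+ M ℤ.* (↥ y ℤ.* E)) ⟨
      fromℤ (E ℤ.* c ℤ.* d ℤ.+ + M ℤ.* (↥ y ℤ.* E)) ∎)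

    difference : (n ℤ.- E ℤ.* c) ℤ.* d ≡ + M ℤ.* (↥ y ℤ.* E)
    difference = begin
      (n ℤ.- E ℤ.* c) ℤ.* d                       ≡⟨ ℤ.*-distribʳ-+ d n (ℤ.- (E ℤ.* c)) ⟩
      n ℤ.* d ℤ.+ ℤ.- (E ℤ.* c) ℤ.* d             ≡⟨ ≡.cong₂ ℤ._+_ cleared (≡.sym (ℤ.neg-distribˡ-* (E ℤ.* c) d)) ⟩
      (E ℤ.* c ℤ.* d ℤ.+ w) ℤ.- E ℤ.* c ℤ.* d     ≡⟨ ≡.cong (ℤ._- E ℤ.* c ℤ.* d) (ℤ.+-comm (E ℤ.* c ℤ.* d) w) ⟩
      (w ℤ.+ E ℤ.* c ℤ.* d) ℤ.- E ℤ.* c ℤ.* d     ≡⟨ ℤ.+-assoc w (E ℤ.* c ℤ.* d) (ℤ.- (E ℤ.* c ℤ.* d)) ⟩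
      w ℤ.+ (E ℤ.* c ℤ.* d ℤ.- E ℤ.* c ℤ.* d)     ≡⟨ ≡.cong (λ u → w ℤ.+ u) (ℤ.+-inverseʳ (E ℤ.* c ℤ.* d)) ⟩
      w ℤ.+ + 0                                   ≡⟨ ℤ.+-identityʳ w ⟩
      w                                           ∎
      where w = + M ℤ.* (↥ y ℤ.* E)

    q∤d : ¬ q ℕ.∣ ↧ₙ y
    q∤d q∣d = contradiction (≡.subst Prime (coprime (q∣d , q∣M)) pr) ℕ.¬prime[1]

    q∣difference : q ℕ.∣ ℤ.∣ n ℤ.- E ℤ.* c ∣
    q∣difference = euclid pr
      (≡.subst (q ℕ.∣_) (≡.trans (≡.trans (≡.sym (ℤ.abs-* (+ M) (↥ y ℤ.* E))) (≡.cong ℤ.∣_∣ (≡.sym difference)))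
          (ℤ.abs-* (n ℤ.- E ℤ.* c) d))
        (ℕ.∣m⇒∣m*n ℤ.∣ ↥ y ℤ.* E ∣ q∣M))
      q∤d

    quotient : ∃[ z ] n ≡ E ℤ.* c ℤ.+ + q ℤ.* z
    quotient = difference⇒congruent n (E ℤ.* c) q q∣difference

-- The primality criterion

open import Data.Nat.Base using (_+_; _^_; _∸_; _≥_)
open import Data.Integer.Base using (-_)
open import Data.Integer.Divisibility using (_∣_)
open import Function.Bundles using (_⇔_; mk⇔)

22^even : ∀ h → ∃[ m ] 22 ^ (2 ℕ.* h) ≡ 1 + 23 ℕ.* m
22^even zero    = 0 , ≡.refl
22^even (suc h) with 22^even h
-- The witness comes from 22² = 484 = 1 + 23 · 21.
... | m , e = 21 + 484 ℕ.* m , (begin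
  22 ^ (2 ℕ.* suc h)              ≡⟨ ≡.cong (22 ^_) (ℕ.*-suc 2 h) ⟩
  22 ^ (2 + 2 ℕ.* h)              ≡⟨ ℕ.^-distribˡ-+-* 22 2 (2 ℕ.* h) ⟩
  484 ℕ.* 22 ^ (2 ℕ.* h)          ≡⟨ ≡.cong (484 ℕ.*_) e ⟩
  484 ℕ.* (1 + 23 ℕ.* m)          ≡⟨ solve 1 (λ m → con 484 :* (con 1 :+ con 23 :* m) := con 1 :+ con 23 :* (con 21 :+ con 484 :* m)) ≡.refl m ⟩
  1 + 23 ℕ.* (21 + 484 ℕ.* m)     ∎)
  where
  open ≡.≡-Reasoning
  open import Data.Nat.Solver using (module +-*-Solver)
  open +-*-Solver

prime∣^ : ∀ {p} x n → Prime p → p ℕ.∣ ℤ.∣ x ℤᵖ.^ n ∣ → p ℕ.∣ ℤ.∣ x ∣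
prime∣^ x zero    pr p∣1 = contradiction (≡.subst Prime (ℕ.∣1⇒≡1 p∣1) pr) ℕ.¬prime[1]
prime∣^ x (suc n) pr p∣ with ℕ.euclidsLemma ℤ.∣ x ∣ ℤ.∣ x ℤᵖ.^ n ∣ pr (≡.subst (_ ℕ.∣_) (ℤ.abs-* x (x ℤᵖ.^ n)) p∣)
... | inj₁ p∣x  = p∣x
... | inj₂ p∣xⁿ = prime∣^ x n pr p∣xⁿ

prime∣D^ : ∀ {p} k j → Prime p → p ℕ.∣ ℤ.∣ D k ℤᵖ.^ j ∣ → p ℕ.∣ 23
prime∣D^ k j pr p∣ = prime∣^ (+ 23) 11 pr (prime∣^ 23¹¹ (22 ^ k) pr (prime∣^ (D k) j pr p∣))

prime-coprime : ∀ {p m} → Prime p → ¬ p ℕ.∣ m → ℕ.Coprime m p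
prime-coprime pr p∤m (d∣m , d∣p) with ℕ.prime⇒irreducible pr d∣p
... | inj₁ d≡1    = d≡1
... | inj₂ ≡.refl = contradiction d∣m p∤m

prime[23] : Prime 23
prime[23] = by (ℕ.prime? 23) ≡.refl

prime∤ : ∀ {p q} → Prime p → Prime q → ¬ p ≡ q → ¬ p ℕ.∣ q
prime∤ pr-p pr-q p≢q p∣q with ℕ.prime⇒irreducible pr-q p∣q
... | inj₁ ≡.refl = ℕ.¬prime[1] pr-p
... | inj₂ p≡q    = p≢q p≡q

inverse-23 : ∀ q → ℕ.Coprime 23 q → ∃[ e ] + 23 ℤ.* e ≈ℤ + 1 [ q ]
inverse-23 q c = case (ℕ.coprime-Bézout c)
  where
  open ≡.≡-Reasoning
  case : ℕ.Bézout.Identity 1 23 q → ∃[ e ] + 23 ℤ.* e ≈ℤ + 1 [ q ]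
  case (+- x y eq) = + x , Quotient.congruent (+ y) (begin
    + 23 ℤ.* + x                  ≡⟨ ℤ.pos-* 23 x ⟨
    + (23 ℕ.* x)                  ≡⟨ ≡.cong +_ (≡.trans (ℕ.*-comm 23 x) (≡.trans (≡.sym eq) (≡.cong suc (ℕ.*-comm y q)))) ⟩
    + 1 ℤ.+ + (q ℕ.* y)           ≡⟨ ≡.cong (λ u → + 1 ℤ.+ u) (ℤ.pos-* q y) ⟩
    + 1 ℤ.+ + q ℤ.* + y           ≡⟨ ≡.cong (λ u → + 1 ℤ.+ u ℤ.* + y) (modulus-ℤ q) ⟨
    _                             ∎)
  case (-+ x y eq) = ℤ.- + x , Quotient.congruent (ℤ.- + y) (begin
    + 23 ℤ.* (ℤ.- + x)                        ≡⟨ ℤ.neg-distribʳ-* (+ 23) (+ x) ⟨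
    ℤ.- (+ 23 ℤ.* + x)                        ≡⟨ ≡.cong ℤ.-_ (ℤ.pos-* 23 x) ⟨
    ℤ.- + (23 ℕ.* x)                          ≡⟨ ℤ.+-identityˡ (ℤ.- + (23 ℕ.* x)) ⟨
    + 0 ℤ.- + (23 ℕ.* x)                      ≡⟨ ≡.cong (ℤ._- + (23 ℕ.* x)) (ℤ.+-inverseʳ (+ 1)) ⟨
    (+ 1 ℤ.- + 1) ℤ.- + (23 ℕ.* x)            ≡⟨ ℤ.+-assoc (+ 1) (ℤ.- + 1) (ℤ.- + (23 ℕ.* x)) ⟩
    + 1 ℤ.+ (ℤ.- + 1 ℤ.- + (23 ℕ.* x))        ≡⟨ ≡.cong (λ u → + 1 ℤ.+ u) (ℤ.neg-distrib-+ (+ 1) (+ (23 ℕ.* x))) ⟨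
    + 1 ℤ.- + (1 + 23 ℕ.* x)                  ≡⟨ ≡.cong (λ u → + 1 ℤ.- + u) (≡.trans (≡.cong suc (ℕ.*-comm 23 x)) (≡.trans eq (ℕ.*-comm y q))) ⟩
    + 1 ℤ.- + (q ℕ.* y)                       ≡⟨ ≡.cong (λ u → + 1 ℤ.- u) (ℤ.pos-* q y) ⟩
    + 1 ℤ.- + q ℤ.* + y                       ≡⟨ ≡.cong (λ u → + 1 ℤ.+ u) (ℤ.neg-distribʳ-* (+ q) (+ y)) ⟩
    + 1 ℤ.+ + q ℤ.* (ℤ.- + y)                 ≡⟨ ≡.cong (λ u → + 1 ℤ.+ u ℤ.* (ℤ.- + y)) (modulus-ℤ q) ⟨
    _                                         ∎)

primeDivisor : ∀ d → 1 ℕ.< d → ∃[ q ] Prime q × q ℕ.∣ d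
primeDivisor d@(suc _) 1<d = from (ℕ.PrimeFactorisation.factors f) (ℕ.PrimeFactorisation.isFactorisation f) (ℕ.PrimeFactorisation.factorsPrime f)
  where
  f = ℕ.factorise d
  from : ∀ qs → d ≡ productℕ qs → ListAll.All Prime qs → ∃[ q ] Prime q × q ℕ.∣ d
  from []       d≡ _        = contradiction (≡.sym d≡) (ℕ.<⇒≢ 1<d)
  from (q ∷ qs) d≡ (pr ∷ _) = q , pr , ≡.subst (q ℕ.∣_) (≡.sym d≡) (ℕ.m∣m*n (productℕ qs))

-- If M = c d, a prime divisor of the smaller factor has square at most c d.
smallPrimeDivisor : ∀ M → ℕ.Composite M → ∃[ q ] Prime q × q ℕ.∣ M × q ℕ.* q ℕ.≤ M
smallPrimeDivisor M (ℕ.hasNonTrivialDivisor {d} d<M d∣M@(divides c M≡)) with ℕ.≤-total d c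
... | inj₁ d≤c = q , pr , ℕ.∣-trans q∣d d∣M , ℕ.≤-trans (ℕ.*-mono-≤ (ℕ.≤-trans q≤d d≤c) q≤d) (ℕ.≤-reflexive (≡.sym M≡))
  where
  1<d : 1 ℕ.< d
  1<d = ℕ.nonTrivial⇒n>1 d
  prime-d = primeDivisor d 1<d
  q = proj₁ prime-d
  pr = proj₁ (proj₂ prime-d)
  q∣d = proj₂ (proj₂ prime-d)
  q≤d = ℕ.∣⇒≤ {{ℕ.>-nonZero (ℕ.<-trans ℕ.z<s 1<d)}} q∣d
... | inj₂ c≤d = q , pr , ℕ.∣-trans q∣c (divides d (≡.trans M≡ (ℕ.*-comm c d))) ,
  ℕ.≤-trans (ℕ.*-mono-≤ q≤c (ℕ.≤-trans q≤c c≤d)) (ℕ.≤-reflexive (≡.sym M≡))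
  where
  1<c : 1 ℕ.< c
  1<c = ℕ.≰⇒> (λ c≤1 → ℕ.<⇒≱ d<M (ℕ.≤-trans (ℕ.≤-reflexive M≡) (ℕ.≤-trans (ℕ.*-monoˡ-≤ d c≤1) (ℕ.≤-reflexive (ℕ.*-identityˡ d)))))
  prime-c = primeDivisor c 1<c
  q = proj₁ prime-c
  pr = proj₁ (proj₂ prime-c)
  q∣c = proj₂ (proj₂ prime-c)
  q≤c = ℕ.∣⇒≤ {{ℕ.>-nonZero (ℕ.<-trans ℕ.z<s 1<c)}} q∣c

-- In terms of the criterion, M < (11^r)², so a prime q with q² ≤ M lies below 11^r.
22^+1<121^ : ∀ r → suc (22 ^ suc r) ℕ.< 121 ^ suc r
22^+1<121^ r = begin-strict
  1 + 22 ^ suc r           ≤⟨ ℕ.+-monoˡ-≤ (22 ^ suc r) (ℕ.m^n>0 22 (suc r)) ⟩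
  22 ^ suc r + 22 ^ suc r  ≡⟨ ℕ.*-distribʳ-+ (22 ^ r) 22 22 ⟨
  44 ℕ.* 22 ^ r            ≤⟨ ℕ.*-monoʳ-≤ 44 (ℕ.^-monoˡ-≤ r (ℕ.m≤m+n 22 99)) ⟩
  44 ℕ.* 121 ^ r           <⟨ ℕ.*-monoˡ-< (121 ^ r) {{ℕ.m^n≢0 121 r}} (ℕ.m≤m+n 45 76) ⟩
  121 ℕ.* 121 ^ r          ∎
  where open ℕ.≤-Reasoning

rational-esym : ∀ k j → Zˢ.esym j (conjugates (t k)) ≡ Z.ι (Vec.head (Zˢ.esym j (conjugates (t k))))
rational-esym k j = fixed⇒rational (Zˢ.esym j (conjugates (t k))) (σ₃-esym (t k) (bar-t k) j) (bar-esym (t k) (bar-t k) j)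

symmetries⇒≡ᴷ : ∀ M k → Prime M → ¬ M ℕ.∣ 23 → SymmetriesModulo M k →
  ∀ (i : Fin 5) → S k (suc (toℕ i)) ≡ᴷ value i [mod M ]
symmetries⇒≡ᴷ M k pr M∤23 h i = congruent⇒≡ᴷ n (value i) z M
  (prime-coprime pr (λ M∣D → M∤23 (prime∣D^ k j pr M∣D))) n≡
  (≡.trans (S≡frac k j) (≡.cong (frac (δ^ k ℚᵖ.^ j)) (rational-esym k j)))
  where
  j = suc (toℕ i)
  open Bridge (δ^ k ℚᵖ.^ j) (D k ℤᵖ.^ j) (δ^-unit k j) using (congruent⇒≡ᴷ)
  module A = AdjoinModulo ℤ.+-*-isCommutativeRing ζ¹⁰ᶻ M
  n = Vec.head (Zˢ.esym j (conjugates (t k)))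
  n≈ : Z.ι n A.≈ₘ Z.ι (D k ℤᵖ.^ j ℤ.* value i)
  n≈ = ≡.subst (A._≈ₘ Z.ι (D k ℤᵖ.^ j ℤ.* value i)) (rational-esym k j) (h i)
  open A.B._≈ₘ_ (A.≈ₘ-lookup Fin.zero n≈) renaming (factor to z)
  n≡ : n ≡ D k ℤᵖ.^ j ℤ.* value i ℤ.+ + M ℤ.* z
  n≡ = ≡.trans equation (≡.cong (λ m → D k ℤᵖ.^ j ℤ.* value i ℤ.+ m ℤ.* z) (modulus-ℤ M))

≡ᴷ⇒symmetries : ∀ M k q → Prime q → q ℕ.∣ M →
  (∀ (i : Fin 5) → S k (suc (toℕ i)) ≡ᴷ value i [mod M ]) → SymmetriesModulo q k
≡ᴷ⇒symmetries M k q pr q∣M h i = from (≡ᴷ⇒congruent (Zˢ.esym j (conjugates (t k))) (value i) M q pr q∣M (S≡frac k j) (h i))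
  where
  j = suc (toℕ i)
  open Bridge (δ^ k ℚᵖ.^ j) (D k ℤᵖ.^ j) (δ^-unit k j) using (≡ᴷ⇒congruent)
  module A = AdjoinModulo ℤ.+-*-isCommutativeRing ζ¹⁰ᶻ q
  from : ∀ {v w} → ∃[ n ] v ≡ Z.ι n × ∃[ z ] n ≡ w ℤ.+ + q ℤ.* z → v A.≈ₘ Z.ι w
  from {w = w} (n , ≡.refl , z , n≡) = A.ι-≈ₘ (A.B.congruent z
    (≡.trans n≡ (≡.cong (λ m → w ℤ.+ m ℤ.* z) (≡.sym (modulus-ℤ q)))))

∤22^+1 : ∀ {q} d r → Prime d → d ℕ.∣ 22 → q ℕ.∣ suc (22 ^ suc r) → ¬ d ℕ.∣ q
∤22^+1 d r pr d∣22 q∣M d∣q = contradiction (≡.subst Prime (ℕ.∣1⇒≡1 d∣1) pr) ℕ.¬prime[1]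
  where
  d∣1 : d ℕ.∣ 1
  d∣1 = ℕ.∣m+n∣m⇒∣n (≡.subst (d ℕ.∣_) (ℕ.+-comm 1 (22 ^ suc r)) (ℕ.∣-trans d∣q q∣M)) (ℕ.∣m⇒∣m*n (22 ^ r) d∣22)

^10-∣ : ∀ q d → 0 ℕ.< q → d ℕ.∣ q ^ 10 ∸ 1 → + d ∣ ((+ q) ℤ.^ 10 ℤ.- + 1)
^10-∣ q d 0<q d∣ = ≡.subst (λ z → d ℕ.∣ ℤ.∣ z ∣) (≡.sym (begin
  (+ q) ℤ.^ 10 ℤ.- + 1   ≡⟨ ≡.cong (ℤ._- + 1) (pos-^ 10) ⟩
  + (q ^ 10) ℤ.- + 1   ≡⟨ ℤ.m-n≡m⊖n (q ^ 10) 1 ⟩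
  q ^ 10 ℤ.⊖ 1         ≡⟨ ℤ.⊖-≥ (ℕ.m^n>0 q {{ℕ.>-nonZero 0<q}} 10) ⟩
  + (q ^ 10 ∸ 1)       ∎)) d∣
  where
  open ≡.≡-Reasoning
  pos-^ : ∀ k → (+ q) ℤ.^ k ≡ + (q ^ k)
  pos-^ zero    = ≡.refl
  pos-^ (suc k) = ≡.trans (≡.cong (λ z → + q ℤ.* z) (pos-^ k)) (≡.sym (ℤ.pos-* q (q ^ k)))

module Criterion (k m : ℕ) (22^r≡ : 22 ^ suc (suc k) ≡ 1 + 23 ℕ.* m) where

  r M : ℕ
  r = suc (suc k)
  M = suc (22 ^ r)

  M≡ : M ≡ 2 + 23 ℕ.* m
  M≡ = ≡.cong suc 22^r≡

  Conditions : Set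
  Conditions = ∀ (i : Fin 5) → S (suc k) (suc (toℕ i)) ≡ᴷ value i [mod M ]

  -- M is 2 modulo 23. This keeps 23 invertible modulo every prime divisor of M.
  23∤M : ¬ 23 ℕ.∣ M
  23∤M 23∣M = ℕ.>⇒∤ (ℕ.m≤m+n 3 20)
    (ℕ.∣m+n∣m⇒∣n (≡.subst (23 ℕ.∣_) (≡.trans M≡ (ℕ.+-comm 2 (23 ℕ.* m))) 23∣M) (ℕ.m∣m*n {23} m))

  prime⇒conditions : Prime M → Conditions
  prime⇒conditions pr = symmetries⇒≡ᴷ M (suc k) pr
    (prime∤ pr prime[23] (λ M≡23 → 23∤M (≡.subst (23 ℕ.∣_) (≡.sym M≡23) ℕ.∣-refl)))
    (Forward.forward M k m pr ≡.refl M≡)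

  module _ (H : (x : ℤ) → + 1 ℤ.< x → x ℤ.< + (11 ^ r) → + (11 ^ r) ∣ (x ℤ.^ 10 ℤ.- + 1) → ¬ (x ∣ + M)) where

    conditions⇒¬composite : Conditions → ¬ ℕ.Composite M
    conditions⇒¬composite conditions composite = absurd (smallPrimeDivisor M composite)
      where
      absurd : ¬ (∃[ q ] Prime q × q ℕ.∣ M × q ℕ.* q ℕ.≤ M)
      -- The hypothesis on integers x is applied to x = q.
      absurd (q , pr , q∣M , q²≤M) = H (+ q) (ℤ.+<+ (ℕ.nonTrivial⇒n>1 q {{ℕ.prime⇒nonTrivial pr}})) (ℤ.+<+ q<11^r)
        (^10-∣ q (11 ^ r) (ℕ.<-trans ℕ.z<s (ℕ.nonTrivial⇒n>1 q {{ℕ.prime⇒nonTrivial pr}})) 11^r∣) q∣M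
        where
        q<11^r : q ℕ.< 11 ^ r
        q<11^r = ℕ.≰⇒> (λ 11^r≤q → ℕ.<⇒≱ (22^+1<121^ (suc k)) (ℕ.≤-trans
          (ℕ.≤-trans (ℕ.≤-reflexive (^-distribʳ-* r 11 11)) (ℕ.*-mono-≤ 11^r≤q 11^r≤q)) q²≤M))
        23-inverse : ∃[ e ] + 23 ℤ.* e ≈ℤ + 1 [ q ]
        23-inverse = inverse-23 q (prime-coprime pr
          (prime∤ pr prime[23] (λ q≡23 → 23∤M (≡.subst (ℕ._∣ M) q≡23 q∣M))))
        11^r∣ : 11 ^ r ℕ.∣ q ^ 10 ∸ 1
        11^r∣ = Reverse.reverse q (suc k) pr
          (∤22^+1 2 (suc k) ℕ.prime[2] (divides 11 ≡.refl) q∣M)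
          (∤22^+1 11 (suc k) prime[11] (divides 2 ≡.refl) q∣M)
          (proj₁ 23-inverse) (proj₂ 23-inverse)
          (≡ᴷ⇒symmetries M (suc k) q pr q∣M conditions)

    conditions⇒prime : Conditions → Prime M
    conditions⇒prime conditions = ℕ.¬composite⇒prime {{ℕ.n>1⇒nonTrivial (ℕ.s≤s (ℕ.m^n>0 22 r))}}
      (conditions⇒¬composite conditions)

-- With r, k and M as separate parameters, `subst` can exchange suc (22^r) for 22^r + 1 and suc k
-- for r ∸ 1.
Criterion′ : (r k M : ℕ) → Set
Criterion′ r k M =
  ((x : ℤ) → + 1 ℤ.< x → x ℤ.< + (11 ^ r) → + (11 ^ r) ∣ (x ℤ.^ 10 ℤ.- + 1) → ¬ (x ∣ + M)) →
  Prime M ⇔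
  ( S k 1 ≡ᴷ - + 1 [mod M ]
  × S k 2 ≡ᴷ - + 4 [mod M ]
  × S k 3 ≡ᴷ + 3 [mod M ]
  × S k 4 ≡ᴷ + 3 [mod M ]
  × S k 5 ≡ᴷ - + 1 [mod M ])

tuple : (P : ℕ → ℤ → Set) → (∀ (i : Fin 5) → P (suc (toℕ i)) (value i)) →
  P 1 (- + 1) × P 2 (- + 4) × P 3 (+ 3) × P 4 (+ 3) × P 5 (- + 1)
tuple P p = p 0F , p 1F , p 2F , p 3F , p 4F

untuple : (P : ℕ → ℤ → Set) → P 1 (- + 1) × P 2 (- + 4) × P 3 (+ 3) × P 4 (+ 3) × P 5 (- + 1) →
  ∀ (i : Fin 5) → P (suc (toℕ i)) (value i)
untuple P (p₁ , p₂ , p₃ , p₄ , p₅) 0F = p₁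
untuple P (p₁ , p₂ , p₃ , p₄ , p₅) 1F = p₂
untuple P (p₁ , p₂ , p₃ , p₄ , p₅) 2F = p₃
untuple P (p₁ , p₂ , p₃ , p₄ , p₅) 3F = p₄
untuple P (p₁ , p₂ , p₃ , p₄ , p₅) 4F = p₅

criterion : ∀ k m → 22 ^ suc (suc k) ≡ 1 + 23 ℕ.* m →
  Criterion′ (suc (suc k)) (suc k) (suc (22 ^ suc (suc k)))
criterion k m 22^r≡ H = mk⇔ (λ pr → tuple P (prime⇒conditions pr)) (λ c → conditions⇒prime H (untuple P c))
  where
  open Criterion k m 22^r≡
  P : ℕ → ℤ → Set
  P j c = S (suc k) j ≡ᴷ c [mod M ]

criterion-even : ∀ r k h → suc (suc k) ≡ r → r ≡ 2 ℕ.* h → Criterion′ r (r ∸ 1) (22 ^ r + 1)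
criterion-even r k h k+2≡r r≡2h = ≡.subst₂ (Criterion′ r) (≡.cong (_∸ 1) k+2≡r) (ℕ.+-comm 1 (22 ^ r))
  (≡.subst (λ r → Criterion′ r (suc k) (suc (22 ^ r))) k+2≡r
    (criterion k (proj₁ even) (≡.trans (≡.cong (22 ^_) (≡.trans k+2≡r r≡2h)) (proj₂ even))))
  where even = 22^even h

proposition4p4 : (n : ℕ) → n ≥ 1 →
    let r = 2 ^ n
        M = 22 ^ (2 ^ n) + 1
    in
    ((x : ℤ) → + 1 ℤ.< x → x ℤ.< + (11 ^ r) → + (11 ^ r) ∣ (x ℤ.^ 10 ℤ.- + 1) → ¬ (x ∣ + M)) →
    Prime M ⇔
      ( S (r ∸ 1) 1 ≡ᴷ - + 1 [mod M ]
      × S (r ∸ 1) 2 ≡ᴷ - + 4 [mod M ]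
      × S (r ∸ 1) 3 ≡ᴷ + 3 [mod M ]
      × S (r ∸ 1) 4 ≡ᴷ + 3 [mod M ]
      × S (r ∸ 1) 5 ≡ᴷ - + 1 [mod M ])
-- Here r = 2 · 2ⁿ is even and at least 2, so r ∸ 2 is a true difference and h = 2ⁿ.
proposition4p4 (suc n) _ = criterion-even (2 ^ suc n) (2 ^ suc n ∸ 2) (2 ^ n)
  (ℕ.m+[n∸m]≡n (ℕ.*-monoʳ-≤ 2 (ℕ.m^n>0 2 n))) ≡.refl
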